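{- Let $k\ge2$. Then the following identities hold: $$F_k(x,p,q,u,v,s,t)=1+\sum_{i=0}^{k-2}\big(f_{k,i}(x,p,q,u,v,s,t)+g_{k,i}(x,p,q,u,v,s,t)\big),$$ and, writing $f_{k,i}=f_{k,i}(x,p,q,u,v,s,t)$, $g_{k,i}=g_{k,i}(x,p,q,u,v,s,t)$, for $1\le i\le k-2$, \begin{align*} f_{k,i}=& pquvx^{i+1} X_i(p,q,u,1,s,t) \left(F_{k-i}(x,p,q,1,v,1,t) - 1\right) \\ &+pq^2uvx^{i+1} X_i(p,q,u,1,s,1) \left(F_{k-i}(x,p,q,1,v,1,1) - 1\right)\left(F_{k}(x,p,q,1,v,s,t)-1\right)\\ &+pq\left(F_{k-i}(x,p,q,1,v,1,1) - 1\right)\sum_{j=1}^{i-1}X_j(p,q,u,1,1,1) x^j f_{k,i-j}, \end{align*} \begin{align*} g_{k,i} =& puvtx^{i+1} X_i(p,q,u,1,s,t) + pquvx^{i+1} X_i(p,q,u,1,s,1) \left(F_k(x,p,q,1,v,s,t) - 1\right) \\ &+p^2quvx^{i+1} \sum_{j=1}^{i-1} X_j(p,q,u,1,1,1) X_{i-j}(p,q,u,1,s,t)\left(F_{k-i+j}(x,p,q,1,v,1,t) - 1\right) \\ &+pq\sum_{j=1}^{i-1} X_{j}(p,q,u,1,1,1) x^j \left(F_{k-i+j}(x,p,q,1,v,1,1) - 1\right)\left(g_{k,i-j}-puvtx^{i-j+1} X_{i-j}(p,q,u,1,s,t)\right), \end{align*} with initial conditions $f_{k,0}=uvstx+quvsx\left(F_k(x,p,q,1,v,s,t)-1\right)$,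 $g_{k,0}=0$, and $f_{2,0}=\frac{uvstx}{1-qvsx}$.
   Context: A permutation avoids a classical pattern $p$ if it has no subsequence order-isomorphic to $p$. For $k\ge1$, a permutation $\pi$ avoids the partially ordered pattern $P_k$ iff there are no indices $i_1<\cdots<i_k$ with $\pi_{i_j}<\pi_{i_k}$ for all $j<k$. Separable permutations are those avoiding $2413$ and $3142$ (the empty permutation included). For a permutation $\pi$, $\mathrm{asc},\mathrm{des}$ are the numbers of ascents and descents and $\mathrm{lrmax},\mathrm{rlmax},\mathrm{lrmin},\mathrm{rlmin}$ the numbers of left-to-right maxima, right-to-left maxima, left-to-right minima, right-to-left minima. Write $w(\pi)=p^{\mathrm{asc}(\pi)}q^{\mathrm{des}(\pi)}u^{\mathrm{lrmax}(\pi)}v^{\mathrm{rlmax}(\pi)}s^{\mathrm{lrmin}(\pi)}t^{\mathrm{rlmin}(\pi)}$. Define $F_k(x,p,q,u,v,s,t)=\sum_{n\ge0}x^n\sum_{\pi\in S_n(2413,3142,P_k)}w(\pi)$, and $X_n(p,q,u,v,s,t)=\sum_{\pi}w(\pi)$ over separable permutations $\pi$ of length $n$. For $0\le i\le k-2$, $f_{k,i}(x,p,q,u,v,s,t)=\sum_{n\ge1}x^n\sum_\pi w(\pi)$ where $\pi$ ranges over $S_n(2413,3142,P_k)$ having exactly $i$ entries to the left of $n$ and with $n-1$ (if $n\ge2$) to the right of $n$; $g_{k,i}(x,p,q,u,v,s,t)=\sum_{n\ge2}x^n\sum_\sigma w(\sigma)$ over $\sigma\in S_n(2413,3142,P_k)$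 with exactly $i$ entries to the left of $n$ and with $n-1$ to the left of $n$. Substituting a value (such as $1$) into an argument of $F_j$ or $X_j$ means evaluating the series at that value. -}

module Defs where

open import Level using (Level)
open import Data.Bool using (Bool; true; false; _∧_; _∨_; not; _xor_; if_then_else_)
open import Data.Nat using (ℕ; zero; suc; _∸_; _≡ᵇ_; _<ᵇ_; _≤ᵇ_)
open import Data.List using (List; []; _∷_; [_]; _++_; map; concatMap; upTo; length; reverse; take; drop; foldr; zip)
open import Data.Bool.ListAction using (all; any)
import Data.Nat as N
open import Data.Product using (_×_; _,_)
open import Algebra.Bundles using (CommutativeRing)

-- Combinatorics of permutations (one-line notation, values 1..n)

select : {A : Set} → (A → Bool) → List A → List A
select P [] = []
select P (x ∷ xs) = if P x then x ∷ select P xs else select P xs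

oneTo : ℕ → List ℕ
oneTo n = map suc (upTo n)

words : ℕ → ℕ → List (List ℕ)
words n zero = [ [] ]
words n (suc m) = concatMap (λ a → map (a ∷_) (words n m)) (oneTo n)

elemᵇ : ℕ → List ℕ → Bool
elemᵇ x xs = any (x ≡ᵇ_) xs

allDistinct : List ℕ → Bool
allDistinct [] = true
allDistinct (x ∷ xs) = not (elemᵇ x xs) ∧ allDistinct xs

perms : ℕ → List (List ℕ)
perms n = select allDistinct (words n n)

subseqs : {A : Set} → List A → List (List A)
subseqs [] = [ [] ]
subseqs (x ∷ xs) = map (x ∷_) (subseqs xs) ++ subseqs xs

iffᵇ : Bool → Bool → Bool
iffᵇ a b = not (a xor b)

orderIso : List ℕ → List ℕ → Bool
orderIso σ pat =
  (length σ ≡ᵇ length pat) ∧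
  all (λ { (a , b) → all (λ { (c , d) → iffᵇ (a <ᵇ c) (b <ᵇ d) }) zs }) zs
  where zs = zip σ pat

containsᵇ : List ℕ → List ℕ → Bool
containsᵇ π pat = any (λ σ → orderIso σ pat) (subseqs π)

lastAbove : List ℕ → Bool
lastAbove σ with reverse σ
... | [] = false
... | l ∷ rest = all (λ a → a <ᵇ l) rest

containsPᵇ : ℕ → List ℕ → Bool
containsPᵇ k π = any (λ σ → (length σ ≡ᵇ k) ∧ lastAbove σ) (subseqs π)

p2413 p3142 : List ℕ
p2413 = 2 ∷ 4 ∷ 1 ∷ 3 ∷ []
p3142 = 3 ∷ 1 ∷ 4 ∷ 2 ∷ []

separableᵇ : List ℕ → Bool
separableᵇ π = not (containsᵇ π p2413) ∧ not (containsᵇ π p3142)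

Sep : ℕ → List (List ℕ)
Sep n = select separableᵇ (perms n)

Av : ℕ → ℕ → List (List ℕ)
Av k n = select (λ π → separableᵇ π ∧ not (containsPᵇ k π)) (perms n)

asc : List ℕ → ℕ
asc (a ∷ b ∷ xs) = (if a <ᵇ b then 1 else 0) N.+ asc (b ∷ xs)
asc _ = 0

des : List ℕ → ℕ
des (a ∷ b ∷ xs) = (if b <ᵇ a then 1 else 0) N.+ des (b ∷ xs)
des _ = 0

records : (ℕ → ℕ → Bool) → List ℕ → ℕ
records R π = go [] π
  where
  go : List ℕ → List ℕ → ℕ
  go seen [] = 0
  go seen (x ∷ xs) = (if all (λ y → R y x) seen then 1 else 0) N.+ go (x ∷ seen) xs

lrmax lrmin rlmax rlmin : List ℕ → ℕ
lrmax π = records (λ y x → y <ᵇ x) π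
lrmin π = records (λ y x → x <ᵇ y) π
rlmax π = lrmax (reverse π)
rlmin π = lrmin (reverse π)

indexOf : ℕ → List ℕ → ℕ
indexOf x [] = 0
indexOf x (y ∷ ys) = if x ≡ᵇ y then 0 else suc (indexOf x ys)

condF : ℕ → ℕ → List ℕ → Bool
condF n i π = (1 ≤ᵇ n) ∧ (indexOf n π ≡ᵇ i) ∧
              ((n <ᵇ 2) ∨ elemᵇ (n ∸ 1) (drop (suc (indexOf n π)) π))

condG : ℕ → ℕ → List ℕ → Bool
condG n i π = (2 ≤ᵇ n) ∧ (indexOf n π ≡ᵇ i) ∧ elemᵇ (n ∸ 1) (take (indexOf n π) π)

-- Generating functions with coefficients in an arbitrary commutative ring.
-- A formal power series in x is its coefficient sequence.

module GF {c ℓ : Level} (R : CommutativeRing c ℓ) where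
  open CommutativeRing R

  Elt : Set c
  Elt = Carrier

  infixl 7 _·_
  _·_ : Carrier → Carrier → Carrier
  _·_ = _*_

  𝟙 : Carrier
  𝟙 = 1#

  pow : Carrier → ℕ → Carrier
  pow a zero = 1#
  pow a (suc n) = a * pow a n

  sumR : List Carrier → Carrier
  sumR = foldr _+_ 0#

  w : (p q u v s t : Carrier) → List ℕ → Carrier
  w p q u v s t π =
    pow p (asc π) * pow q (des π) * pow u (lrmax π) * pow v (rlmax π)
      * pow s (lrmin π) * pow t (rlmin π)

  Series : Set c
  Series = ℕ → Carrier

  infix 4 _≐_
  _≐_ : Series → Series → Set ℓ
  a ≐ b = ∀ n → a n ≈ b n

  infixl 6 _⊕_ _⊖_
  infixl 7 _⊛_
  _⊕_ _⊖_ _⊛_ : Series → Series → Series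
  (a ⊕ b) n = a n + b n
  (a ⊖ b) n = a n - b n
  (a ⊛ b) n = sumR (map (λ j → a j * b (n ∸ j)) (upTo (suc n)))

  scale : Carrier → Series → Series
  scale c a n = c * a n

  sh : ℕ → Series → Series
  sh m a n = if m ≤ᵇ n then a (n ∸ m) else 0#

  mono : ℕ → Carrier → Series
  mono m c n = if n ≡ᵇ m then c else 0#

  zeroS oneS : Series
  zeroS n = 0#
  oneS = mono 0 1#

  ssum : List ℕ → (ℕ → Series) → Series
  ssum js a n = sumR (map (λ j → a j n) js)

  -- [j ∈ {a..b}]  (empty if b < a)
  range : ℕ → ℕ → List ℕ
  range a b = map (a N.+_) (upTo (suc b ∸ a))

  X : ℕ → (p q u v s t : Carrier) → Carrier
  X n p q u v s t = sumR (map (w p q u v s t) (Sep n))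

  F : ℕ → (p q u v s t : Carrier) → Series
  F k p q u v s t n = sumR (map (w p q u v s t) (Av k n))

  f : ℕ → ℕ → (p q u v s t : Carrier) → Series
  f k i p q u v s t n = sumR (map (w p q u v s t) (select (condF n i) (Av k n)))

  g : ℕ → ℕ → (p q u v s t : Carrier) → Series
  g k i p q u v s t n = sumR (map (w p q u v s t) (select (condG n i) (Av k n)))

  F₋ : ℕ → (p q u v s t : Carrier) → Series
  F₋ j p q u v s t = F j p q u v s t ⊖ oneS

{-# OPTIONS --safe #-}

-- Write a permutation as L n R with n its largest entry. Avoiding 2413 and 3142 with n in the
-- role of 4 forces the values of L and R to interleave in blocks: from top to bottom, the blocks
-- of L are read from right to left and those of R from left to right. Peeling off the top block
-- B leaves a permutation of the same kind in which the next block lies on the other side of n.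
--
-- If B lies in R = B R′ (so L < B), the rest L n R′ is counted by g_{k,i}, and B has to avoid
-- P_{k-i}, because all i entries of L are below it. If B lies in L = L′ B and R is not empty, the
-- rest L′ n R is counted by f_{k,i-|B|}, and B is any separable permutation, because the entries
-- of L are too few to complete a P_k. With g₂_i = g_{k,i} − (the terms with R empty) this gives
--   f_{k,i} = p q u v x^{i+1} X_i(s,t) (F_{k-i}(v,t) − 1) + q (F_{k-i}(v) − 1) g₂_i,
--   g₂_i    = p q u v x^{i+1} X_i(s) (F_k(v,s,t) − 1) + p Σ_{1≤j<i} X_j x^j f_{k,i-j},
-- listing only the variables among s, t, v that are not set to 1; substituting each identity into
-- the other yields the recurrences.
--
-- Conversely n B and B n are intervals on top of everything else, so putting them in place of n
-- inflates one letter; this preserves separability since both patterns are simple, and the six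
-- statistics change in a way that depends only on the new block.

module Submission where

open import Defs
open import Level using (Level)
open import Data.Nat
open import Data.Nat.Properties
open import Data.Bool using (Bool; true; false; T; not; if_then_else_; _∧_; _∨_)
open import Data.Bool.Properties using (T-∧; T-∨; T-≡; ∧-assoc; ∧-comm; ∧-identityʳ; ∧-zeroʳ)
open import Data.Bool.ListAction using (all)
open import Data.Unit using (⊤; tt)
open import Data.Empty using (⊥; ⊥-elim)
open import Data.Product using (∃; ∃₂; _×_; _,_; proj₁; proj₂)
open import Data.Sum using (_⊎_; inj₁; inj₂)
open import Data.List using (List; []; _∷_; [_]; _++_; map; concatMap; upTo; length; reverse; take; drop)
open import Data.List.Properties
open import Data.List.Relation.Unary.All as All using (All; []; _∷_)
import Data.List.Relation.Unary.All.Properties as AllP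
open import Data.List.Relation.Unary.Any as Any using (Any; here; there)
import Data.List.Relation.Unary.Any.Properties as AnyP
open import Data.List.Relation.Unary.AllPairs using ([]; _∷_)
open import Data.List.Relation.Unary.Unique.Propositional using (Unique)
import Data.List.Relation.Unary.Unique.Propositional.Properties as UniqueP
open import Data.List.Membership.Propositional using (_∈_; _∉_; find)
open import Data.List.Membership.Propositional.Properties
open import Data.List.Membership.DecPropositional _≟_ using (_∈?_)
open import Data.List.Relation.Binary.Sublist.Propositional using (_⊆_; []; _∷ʳ_; _∷_; ⊆-refl; ⊆-trans; minimum; from∈)
import Data.List.Relation.Binary.Sublist.Propositional.Properties as SubP
open import Data.List.Relation.Binary.Permutation.Propositional as ↭ using (_↭_; prep; swap; ↭-sym; ↭-trans; ↭-reflexive; ↭⇒↭ₛ)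
import Data.List.Relation.Binary.Permutation.Propositional.Properties as PermP
open import Function using (_∘_; id; _∋_; case_of_; Equivalence; mk⇔)
open import Relation.Nullary using (¬_; yes; no; contradiction)
open import Relation.Binary.PropositionalEquality using (_≡_; _≢_; refl; sym; trans; cong; cong₂; subst; subst₂; module ≡-Reasoning)
open import Relation.Binary.PropositionalEquality.Properties using () renaming (setoid to ≡-setoid)
open import Relation.Binary.Definitions using (tri<; tri≈; tri>)
open import Algebra.Bundles using (CommutativeRing)
import Data.List.Relation.Binary.Permutation.Setoid.Properties (≡-setoid ℕ) as PermS
open import Data.List.Relation.Binary.BagAndSetEquality using (∼bag⇒↭)
open import Data.List.Membership.Propositional.Properties.WithK using (unique∧set⇒bag)

-- Separable permutations

-- The classes f and g record on which side of n the entry n - 1 stands, and this makes the peeling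
-- invertible: since the remainder has its second largest entry on the other side, the removed block
-- is a maximal one and its size can be read off the result. Avoidance of P_k is not a condition on
-- the pieces separately, because a block standing to the right of i smaller entries has already
-- filled i of the k - 1 lower places. It is therefore encoded with a counter of smaller entries
-- already seen, and moving a constant i from the counter to the threshold produces F_{k-i}. The
-- terms with R empty are kept apart because nothing then hides the right-to-left minima of a block
-- put after n: t survives there and is set to 1 otherwise, which is why both F_{k-i}(v,t) and
-- F_{k-i}(v) occur. Coefficients lie in an arbitrary commutative ring, so weights cannot be
-- divided; a change of weight is obtained by comparing two inflations inside the same frame.

infix 4 _≺_
_≺_ : List ℕ → List ℕ → Set
xs ≺ ys = ∀ {x y} → x ∈ xs → y ∈ ys → x < y

Avoids2413 Avoids3142 Separable : List ℕ → Set
Avoids2413 π = ∀ {a b c d} → a ∷ b ∷ c ∷ d ∷ [] ⊆ π → c < a → a < d → d < b → ⊥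
Avoids3142 π = ∀ {a b c d} → a ∷ b ∷ c ∷ d ∷ [] ⊆ π → b < d → d < a → a < c → ⊥
Separable π = Avoids2413 π × Avoids3142 π

∈-⊆ : ∀ {x : ℕ} {xs ys} → xs ⊆ ys → x ∈ xs → x ∈ ys
∈-⊆ (y ∷ʳ τ) p = there (∈-⊆ τ p)
∈-⊆ (refl ∷ τ) (here e) = here e
∈-⊆ (refl ∷ τ) (there p) = there (∈-⊆ τ p)

⊆-++-split : ∀ (xs : List ℕ) {ys zs} → zs ⊆ xs ++ ys →
  ∃₂ λ as bs → zs ≡ as ++ bs × as ⊆ xs × bs ⊆ ys
⊆-++-split [] τ = [] , _ , refl , [] , τ
⊆-++-split (x ∷ xs) (.x ∷ʳ τ) with ⊆-++-split xs τ
... | as , bs , e , α , β = as , bs , e , x ∷ʳ α , β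
⊆-++-split (x ∷ xs) (refl ∷ τ) with ⊆-++-split xs τ
... | as , bs , refl , α , β = x ∷ as , bs , refl , refl ∷ α , β

separable-⊆ : ∀ {xs ys} → xs ⊆ ys → Separable ys → Separable xs
separable-⊆ τ (s₁ , s₂) = (λ σ → s₁ (⊆-trans σ τ)) , (λ σ → s₂ (⊆-trans σ τ))

separable-map⁻ : ∀ (h : ℕ → ℕ) {xs} → (∀ {x y} → x ∈ xs → y ∈ xs → x < y → h x < h y) →
  Separable (map h xs) → Separable xs
separable-map⁻ h mono (s₁ , s₂) =
  (λ τ p q r → s₁ (SubP.map⁺ h τ) (mono (i₃ τ) (i₁ τ) p) (mono (i₁ τ) (i₄ τ) q) (mono (i₄ τ) (i₂ τ) r)) ,
  (λ τ p q r → s₂ (SubP.map⁺ h τ) (mono (i₂ τ) (i₄ τ) p) (mono (i₄ τ) (i₁ τ) q) (mono (i₁ τ) (i₃ τ) r))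
  where
  i₁ : ∀ {a b c d xs} → a ∷ b ∷ c ∷ d ∷ [] ⊆ xs → a ∈ xs
  i₁ τ = ∈-⊆ τ (here refl)
  i₂ : ∀ {a b c d xs} → a ∷ b ∷ c ∷ d ∷ [] ⊆ xs → b ∈ xs
  i₂ τ = ∈-⊆ τ (there (here refl))
  i₃ : ∀ {a b c d xs} → a ∷ b ∷ c ∷ d ∷ [] ⊆ xs → c ∈ xs
  i₃ τ = ∈-⊆ τ (there (there (here refl)))
  i₄ : ∀ {a b c d xs} → a ∷ b ∷ c ∷ d ∷ [] ⊆ xs → d ∈ xs
  i₄ τ = ∈-⊆ τ (there (there (there (here refl))))

separable-short : ∀ z → Separable [ z ]
separable-short z = (λ { (_ ∷ʳ ()) ; (_ ∷ ()) }) , (λ { (_ ∷ʳ ()) ; (_ ∷ ()) })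

-- Neither pattern begins with its 4.
separable-max∷ : ∀ {z xs} → (∀ {x} → x ∈ xs → x < z) → Separable xs → Separable (z ∷ xs)
separable-max∷ {z} {xs} top (s₁ , s₂) = av₁ , av₂
  where
  av₁ : Avoids2413 (z ∷ xs)
  av₁ (_ ∷ʳ τ) = s₁ τ
  av₁ (refl ∷ τ) _ a<d _ = <-asym a<d (top (∈-⊆ τ (there (there (here refl)))))
  av₂ : Avoids3142 (z ∷ xs)
  av₂ (_ ∷ʳ τ) = s₂ τ
  av₂ (refl ∷ τ) _ _ a<c = <-asym a<c (top (∈-⊆ τ (there (here refl))))

-- Both patterns are simple, so no two or three consecutive letters carry the top values.
separable-inflate : ∀ L M R z → L ≺ M → R ≺ M → L ≺ [ z ] → R ≺ [ z ] →
  Separable (L ++ z ∷ R) → Separable M → Separable (L ++ M ++ R)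
separable-inflate L M R z L≺M R≺M L≺z R≺z (s₁ , s₂) (m₁ , m₂) = av₁ , av₂
  where
  one : ∀ {as bs} → as ⊆ L → bs ⊆ R → as ++ z ∷ bs ⊆ L ++ z ∷ R
  one α β = SubP.++⁺ α (refl ∷ β)
  none : ∀ {as bs} → as ⊆ L → bs ⊆ R → as ++ bs ⊆ L ++ z ∷ R
  none α β = SubP.++⁺ α (_ ∷ʳ β)
  h : ∀ {a : ℕ} {as} → a ∈ a ∷ as
  h = here refl
  lm : ∀ {as ms} → as ⊆ L → ms ⊆ M → as ≺ ms
  lm α μ p q = L≺M (∈-⊆ α p) (∈-⊆ μ q)
  rm : ∀ {bs ms} → bs ⊆ R → ms ⊆ M → bs ≺ ms
  rm β μ p q = R≺M (∈-⊆ β p) (∈-⊆ μ q)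
  lz : ∀ {as} → as ⊆ L → ∀ {x} → x ∈ as → x < z
  lz α p = L≺z (∈-⊆ α p) h
  rz : ∀ {as} → as ⊆ R → ∀ {x} → x ∈ as → x < z
  rz α p = R≺z (∈-⊆ α p) h
  1# : ∀ {a b : ℕ} {as} → b ∈ a ∷ b ∷ as
  1# = there h
  2# : ∀ {a b c : ℕ} {as} → c ∈ a ∷ b ∷ c ∷ as
  2# = there 1#

  av₁ : Avoids2413 (L ++ M ++ R)
  av₁ τ c<a a<d d<b with ⊆-++-split L τ
  ... | as , ns , e , α , ν with ⊆-++-split M ν
  ... | ms , bs , refl , μ , β = go as ms bs α μ β e c<a a<d d<b
    where
    -- The cases run over how many of the four letters lie in `L`, `M` and `R`. A single letter in
    -- `M` must be the 4, and then `z` takes its place; every other split with letters both inside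
    -- and outside `M` puts a letter of `L` or `R` above one of `M`.
    go : ∀ {a b c d} as ms bs → as ⊆ L → ms ⊆ M → bs ⊆ R →
      a ∷ b ∷ c ∷ d ∷ [] ≡ as ++ ms ++ bs → c < a → a < d → d < b → ⊥
    go as [] bs α μ β e = s₁ (subst (_⊆ (L ++ z ∷ R)) (sym e) (none α β))
    go [] (_ ∷ []) _ α μ β refl p q r = <-asym q (rm β μ 2# h)
    go (_ ∷ []) (_ ∷ []) _ α μ β refl p q r = s₁ (one α β) p q (rz β 1#)
    go (_ ∷ _ ∷ []) (_ ∷ []) _ α μ β refl p q r = <-asym p (lm α μ h h)
    go (_ ∷ _ ∷ _ ∷ []) (_ ∷ []) _ α μ β refl p q r = <-asym r (lm α μ 1# h)
    go [] (_ ∷ _ ∷ []) _ α μ β refl p q r = <-asym q (rm β μ 1# h)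
    go (_ ∷ []) (_ ∷ _ ∷ []) _ α μ β refl p q r = <-asym p (lm α μ h 1#)
    go (_ ∷ _ ∷ []) (_ ∷ _ ∷ []) _ α μ β refl p q r = <-asym p (lm α μ h h)
    go [] (_ ∷ _ ∷ _ ∷ []) _ α μ β refl p q r = <-asym q (rm β μ h h)
    go (_ ∷ []) (_ ∷ _ ∷ _ ∷ []) _ α μ β refl p q r = <-asym p (lm α μ h 1#)
    go [] (_ ∷ _ ∷ _ ∷ _ ∷ []) _ α μ β refl = m₁ μ
    go (_ ∷ _ ∷ _ ∷ _ ∷ []) (_ ∷ _) _ α μ β ()
    go (_ ∷ _ ∷ _ ∷ _ ∷ _ ∷ _) (_ ∷ _) _ α μ β ()

  av₂ : Avoids3142 (L ++ M ++ R)
  av₂ τ b<d d<a a<c with ⊆-++-split L τ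
  ... | as , ns , e , α , ν with ⊆-++-split M ν
  ... | ms , bs , refl , μ , β = go as ms bs α μ β e b<d d<a a<c
    where
    go : ∀ {a b c d} as ms bs → as ⊆ L → ms ⊆ M → bs ⊆ R →
      a ∷ b ∷ c ∷ d ∷ [] ≡ as ++ ms ++ bs → b < d → d < a → a < c → ⊥
    go as [] bs α μ β e = s₂ (subst (_⊆ (L ++ z ∷ R)) (sym e) (none α β))
    go [] (_ ∷ []) _ α μ β refl p q r = <-asym r (rm β μ 1# h)
    go (_ ∷ []) (_ ∷ []) _ α μ β refl p q r = <-asym p (rm β μ 1# h)
    go (_ ∷ _ ∷ []) (_ ∷ []) _ α μ β refl p q r = s₂ (one α β) p q (lz α h)
    go (_ ∷ _ ∷ _ ∷ []) (_ ∷ []) _ α μ β refl p q r = <-asym q (lm α μ h h)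
    go [] (_ ∷ _ ∷ []) _ α μ β refl p q r = <-asym p (rm β μ 1# 1#)
    go (_ ∷ []) (_ ∷ _ ∷ []) _ α μ β refl p q r = <-asym p (rm β μ h h)
    go (_ ∷ _ ∷ []) (_ ∷ _ ∷ []) _ α μ β refl p q r = <-asym q (lm α μ h 1#)
    go [] (_ ∷ _ ∷ _ ∷ []) _ α μ β refl p q r = <-asym p (rm β μ h 1#)
    go (_ ∷ []) (_ ∷ _ ∷ _ ∷ []) _ α μ β refl p q r = <-asym q (lm α μ h 2#)
    go [] (_ ∷ _ ∷ _ ∷ _ ∷ []) _ α μ β refl = m₂ μ
    go (_ ∷ _ ∷ _ ∷ _ ∷ []) (_ ∷ _) _ α μ β ()
    go (_ ∷ _ ∷ _ ∷ _ ∷ _ ∷ _) (_ ∷ _) _ α μ β ()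

-- Avoiding P_k

indicator : Bool → ℕ
indicator b = if b then 1 else 0

below : ℕ → List ℕ → ℕ
below z [] = 0
below z (x ∷ xs) = indicator (x <ᵇ z) + below z xs

-- `AvoidsP k (λ _ → 0) ys` says that ys avoids P_k; in general `c z` counts further entries
-- below z standing to the left of ys.
AvoidsP : ℕ → (ℕ → ℕ) → List ℕ → Set
AvoidsP k c [] = ⊤
AvoidsP k c (y ∷ ys) = 2 + c y ≤ k × AvoidsP k (λ z → indicator (y <ᵇ z) + c z) ys

noneSeen : ℕ → ℕ
noneSeen _ = 0

-- Only the slack between threshold and counter matters, and both counters grow by the same
-- indicator along `ys`. The inequality is additive in order to avoid truncated subtraction. It lets
-- a constant counter i be traded for the threshold k - i.
avoidsP-mono : ∀ {k k′ c c′} ys → (∀ {z} → z ∈ ys → c z + k′ ≤ c′ z + k) →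
  AvoidsP k′ c′ ys → AvoidsP k c ys
avoidsP-mono [] h a = tt
avoidsP-mono {k} {k′} {c} {c′} (y ∷ ys) h (a , as) =
  +-cancelˡ-≤ (c′ y) _ _ (begin
    c′ y + (2 + c y)  ≡⟨ +-comm (c′ y) (2 + c y) ⟩
    2 + c y + c′ y    ≡⟨ cong (2 +_) (+-comm (c y) (c′ y)) ⟩
    2 + c′ y + c y    ≤⟨ +-monoˡ-≤ (c y) a ⟩
    k′ + c y          ≡⟨ +-comm k′ (c y) ⟩
    c y + k′          ≤⟨ h (here refl) ⟩
    c′ y + k          ∎) ,
  avoidsP-mono ys step as
  where
  open ≤-Reasoning
  step : ∀ {z} → z ∈ ys →
    indicator (y <ᵇ z) + c z + k′ ≤ indicator (y <ᵇ z) + c′ z + k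
  step {z} p rewrite +-assoc (indicator (y <ᵇ z)) (c z) k′ | +-assoc (indicator (y <ᵇ z)) (c′ z) k =
    +-monoʳ-≤ (indicator (y <ᵇ z)) (h (there p))

avoidsP-cong : ∀ {k c c′} ys → (∀ {z} → z ∈ ys → c z ≡ c′ z) → AvoidsP k c ys → AvoidsP k c′ ys
avoidsP-cong {k} ys h = avoidsP-mono ys (λ p → ≤-reflexive (cong (_+ k) (sym (h p))))

below-seen : ∀ x xs (c : ℕ → ℕ) z → below z xs + (indicator (x <ᵇ z) + c z) ≡ below z (x ∷ xs) + c z
below-seen x xs c z = trans (sym (+-assoc (below z xs) i (c z))) (cong (_+ c z) (+-comm (below z xs) i))
  where i = indicator (x <ᵇ z)

avoidsP-++⁺ : ∀ {k c} xs {ys} → AvoidsP k c xs → AvoidsP k (λ z → below z xs + c z) ys →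
  AvoidsP k c (xs ++ ys)
avoidsP-++⁺ [] a b = b
avoidsP-++⁺ {c = c} (x ∷ xs) {ys} (a , as) b =
  a , avoidsP-++⁺ xs as (avoidsP-cong ys (λ {z} _ → sym (below-seen x xs c z)) b)

avoidsP-++⁻ : ∀ {k c} xs {ys} → AvoidsP k c (xs ++ ys) →
  AvoidsP k c xs × AvoidsP k (λ z → below z xs + c z) ys
avoidsP-++⁻ [] b = tt , b
avoidsP-++⁻ {c = c} (x ∷ xs) {ys} (a , b) with avoidsP-++⁻ xs {ys} b
... | as , bs = (a , as) , avoidsP-cong ys (λ {z} _ → below-seen x xs c z) bs

indicator≤1 : ∀ b → indicator b ≤ 1
indicator≤1 true = s≤s z≤n
indicator≤1 false = z≤n

-- An entry has at most `length ys` - 1 entries of `ys` to its left, so its counter stays within k -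
-- 2. Along the induction the length falls by one while the counter grows by at most one.
avoidsP-short : ∀ {k c} ys → (∀ {z} → z ∈ ys → length ys + c z + 1 ≤ k) → AvoidsP k c ys
avoidsP-short [] h = tt
avoidsP-short {k} {c} (y ∷ ys) h =
  ≤-trans (s≤s (≤-trans (≤-reflexive (+-comm 1 (c y))) (+-monoˡ-≤ 1 (m≤n+m (c y) (length ys))))) (h (here refl)) ,
  avoidsP-short ys (λ {z} p → ≤-trans (+-monoˡ-≤ 1 (begin
    length ys + (indicator (y <ᵇ z) + c z)  ≤⟨ +-monoʳ-≤ (length ys) (+-monoˡ-≤ (c z) (indicator≤1 (y <ᵇ z))) ⟩
    length ys + (1 + c z)                   ≡⟨ +-suc (length ys) (c z) ⟩
    suc (length ys + c z)                   ∎)) (h (there p)))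
  where open ≤-Reasoning

<ᵇ-true : ∀ {m n} → m < n → (m <ᵇ n) ≡ true
<ᵇ-true p = Equivalence.to T-≡ (<⇒<ᵇ p)

<ᵇ-false : ∀ {m n} → n ≤ m → (m <ᵇ n) ≡ false
<ᵇ-false {m} {n} p with m <ᵇ n in e
... | false = refl
... | true = contradiction (<ᵇ⇒< m n (Equivalence.from T-≡ e)) (≤⇒≯ p)

below-all : ∀ {z} xs → (∀ {x} → x ∈ xs → x < z) → below z xs ≡ length xs
below-all [] h = refl
below-all (x ∷ xs) h rewrite <ᵇ-true (h (here refl)) = cong suc (below-all xs (h ∘ there))

below-none : ∀ {z} xs → (∀ {x} → x ∈ xs → z ≤ x) → below z xs ≡ 0
below-none [] h = refl
below-none (x ∷ xs) h rewrite <ᵇ-false (h (here refl)) = below-none xs (h ∘ there)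

-- Every entry of `M` has all of `L` below it, whence the constant counter `length L`. For the
-- entries of `R` neither `M` nor `z` counts, so exchanging them changes nothing there.
avoidsP-inflate⁺ : ∀ {k} L M R z → L ≺ M → R ≺ M → R ≺ [ z ] →
  AvoidsP k noneSeen (L ++ z ∷ R) → AvoidsP k (λ _ → length L) M → AvoidsP k noneSeen (L ++ M ++ R)
avoidsP-inflate⁺ {k} L M R z L≺M R≺M R≺z a m with avoidsP-++⁻ L a
... | l , (_ , r) = avoidsP-++⁺ L l (avoidsP-++⁺ M
  (avoidsP-cong M (λ {x} p → sym (trans (+-identityʳ _) (below-all L (λ q → L≺M q p)))) m)
  (avoidsP-cong R (λ {x} p → cong (_+ (below x L + 0))
      (trans (cong indicator (<ᵇ-false (<⇒≤ (R≺z p (here refl))))) (sym (below-none M (λ q → <⇒≤ (R≺M p q)))))) r))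

-- All of `L` lies below `z`, so the bound on `length L` is exactly what `AvoidsP` asks of this
-- letter.
avoidsP-inflate⁻ : ∀ {k} L M R z → 2 + length L ≤ k → L ≺ M → R ≺ M → L ≺ [ z ] → R ≺ [ z ] →
  AvoidsP k noneSeen (L ++ M ++ R) → AvoidsP k noneSeen (L ++ z ∷ R) × AvoidsP k (λ _ → length L) M
avoidsP-inflate⁻ {k} L M R z small L≺M R≺M L≺z R≺z a with avoidsP-++⁻ L a
... | l , mr with avoidsP-++⁻ M mr
... | m , r =
  avoidsP-++⁺ L l
    ( subst (λ n → 2 + n ≤ k) (sym (trans (+-identityʳ _) (below-all L (λ q → L≺z q (here refl))))) small
    , avoidsP-cong R (λ {x} p → cong (_+ (below x L + 0))
        (trans (below-none M (λ q → <⇒≤ (R≺M p q))) (cong indicator (sym (<ᵇ-false (<⇒≤ (R≺z p (here refl)))))))) r) ,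
  avoidsP-cong M (λ {x} p → trans (+-identityʳ _) (below-all L (λ q → L≺M q p))) m

<ᵇ-shift : ∀ c x y → (c + x <ᵇ c + y) ≡ (x <ᵇ y)
<ᵇ-shift zero x y = refl
<ᵇ-shift (suc c) x y = <ᵇ-shift c x y

avoidsP-shift⁺ : ∀ {k b b′} c ys → (∀ z → b′ (c + z) ≡ b z) → AvoidsP k b ys → AvoidsP k b′ (map (c +_) ys)
avoidsP-shift⁺ c [] h a = tt
avoidsP-shift⁺ {k} c (y ∷ ys) h (a , as) = subst (λ n → 2 + n ≤ k) (sym (h y)) a ,
  avoidsP-shift⁺ c ys (λ z → cong₂ _+_ (cong indicator (<ᵇ-shift c y z)) (h z)) as

avoidsP-shift⁻ : ∀ {k b b′} c ys → (∀ z → b′ (c + z) ≡ b z) → AvoidsP k b′ (map (c +_) ys) → AvoidsP k b ys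
avoidsP-shift⁻ c [] h a = tt
avoidsP-shift⁻ {k} c (y ∷ ys) h (a , as) = subst (λ n → 2 + n ≤ k) (h y) a ,
  avoidsP-shift⁻ c ys (λ z → cong₂ _+_ (cong indicator (<ᵇ-shift c y z)) (h z)) as

-- Follow the embedding through `π`: an entry passed over can only raise the counter of `l`, and an
-- entry used by `σ` raises it by exactly one, because it is below `l`. When `l` is reached, its
-- counter is at most k - 2.
avoidsP⇒bound : ∀ {k c l} π σ → AvoidsP k c π → σ ++ [ l ] ⊆ π → All (_< l) σ → length σ + c l + 2 ≤ k
avoidsP⇒bound (y ∷ π) [] (a , as) (.y ∷ʳ τ) h =
  ≤-trans (+-monoˡ-≤ 2 (m≤n+m _ _)) (avoidsP⇒bound π [] as τ h)
avoidsP⇒bound (y ∷ π) (x ∷ σ) (a , as) (.y ∷ʳ τ) h =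
  ≤-trans (+-monoˡ-≤ 2 (+-monoʳ-≤ (suc (length σ)) (m≤n+m _ _))) (avoidsP⇒bound π (x ∷ σ) as τ h)
avoidsP⇒bound {c = c} (y ∷ π) [] (a , as) (refl ∷ τ) h = ≤-trans (≤-reflexive (+-comm (c y) 2)) a
avoidsP⇒bound {c = c} {l} (y ∷ π) (_ ∷ σ) (a , as) (refl ∷ τ) (y<l ∷ h) =
  ≤-trans (≤-reflexive (cong (_+ 2) (trans (sym (+-suc (length σ) (c l)))
    (cong (λ b → length σ + (indicator b + c l)) (sym (<ᵇ-true y<l))))))
    (avoidsP⇒bound π σ as τ h)

bound⇒avoidsP : ∀ {k c} π → (∀ σ l → σ ++ [ l ] ⊆ π → All (_< l) σ → length σ + c l + 2 ≤ k) → AvoidsP k c π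
bound⇒avoidsP [] h = tt
bound⇒avoidsP {k} {c} (y ∷ π) h =
  ≤-trans (≤-reflexive (+-comm 2 (c y))) (h [] y (refl ∷ minimum π) []) , bound⇒avoidsP π step
  where
  step : ∀ σ l → σ ++ [ l ] ⊆ π → All (_< l) σ → length σ + (indicator (y <ᵇ l) + c l) + 2 ≤ k
  step σ l τ s with y <ᵇ l in e
  ... | false = h σ l (y ∷ʳ τ) s
  ... | true = ≤-trans (≤-reflexive (cong (_+ 2) (+-suc (length σ) (c l))))
    (h (y ∷ σ) l (refl ∷ τ) (<ᵇ⇒< y l (Equivalence.from T-≡ e) ∷ s))

-- Permutations

-- Surjectivity onto 1..n is not a field; it is recovered from `pigeonhole`, in the form
-- `perm-max∈`.
record Perm (n : ℕ) (π : List ℕ) : Set where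
  constructor perm
  field
    size : length π ≡ n
    bounds : ∀ {x} → x ∈ π → 1 ≤ x × x ≤ n
    distinct : Unique π
open Perm

unique-resp-↭ : ∀ {xs ys : List ℕ} → xs ↭ ys → Unique xs → Unique ys
unique-resp-↭ σ = PermS.Unique-resp-↭ (↭⇒↭ₛ σ)

perm-resp-↭ : ∀ {n xs ys} → xs ↭ ys → Perm n xs → Perm n ys
perm-resp-↭ σ p = perm (trans (sym (PermP.↭-length σ)) (size p))
  (bounds p ∘ PermP.∈-resp-↭ (↭-sym σ)) (unique-resp-↭ σ (distinct p))

∉-tail : ∀ {x y : ℕ} {xs} → Unique (x ∷ xs) → y ∈ xs → y ≢ x
∉-tail (h ∷ _) p refl = All.lookup h p refl

pigeonhole : ∀ m {xs} → Unique xs → (∀ {x} → x ∈ xs → 1 ≤ x × x ≤ m) → length xs ≤ m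
pigeonhole zero {[]} u b = z≤n
pigeonhole zero {x ∷ xs} u b with b (here refl)
... | 1≤x , x≤0 = contradiction (≤-trans 1≤x x≤0) λ ()
pigeonhole (suc m) {xs} u b with suc m ∈? xs
... | no ∉ = m≤n⇒m≤1+n (pigeonhole m u λ p → proj₁ (b p) ,
  ≤-pred (≤∧≢⇒< (proj₂ (b p)) λ e → ∉ (subst (_∈ xs) e p)))
... | yes ∈ with ∈-∃++ ∈
... | ys , zs , refl with unique-resp-↭ (PermP.shift (suc m) ys zs) u
... | u′@(_ ∷ us) = ≤-trans (≤-reflexive (PermP.↭-length (PermP.shift (suc m) ys zs)))
  (s≤s (pigeonhole m us λ p → let q = b (PermP.∈-resp-↭ (↭-sym (PermP.shift (suc m) ys zs)) (there p)) in
    proj₁ q , ≤-pred (≤∧≢⇒< (proj₂ q) (∉-tail u′ p))))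

perm-max∈ : ∀ {m xs} → Perm (suc m) xs → suc m ∈ xs
perm-max∈ {m} {xs} p with suc m ∈? xs
... | yes ∈ = ∈
... | no ∉ = contradiction (pigeonhole m (distinct p) λ q → proj₁ (bounds p q) ,
  ≤-pred (≤∧≢⇒< (proj₂ (bounds p q)) λ e → ∉ (subst (_∈ xs) e q))) (<⇒≱ (≤-reflexive (sym (size p))))

perm-max∷⁺ : ∀ {m xs} → Perm m xs → Perm (suc m) (suc m ∷ xs)
perm-max∷⁺ p = perm (cong suc (size p))
  (λ { (here refl) → s≤s z≤n , ≤-refl ; (there q) → proj₁ (bounds p q) , m≤n⇒m≤1+n (proj₂ (bounds p q)) })
  (All.tabulate (λ q e → <⇒≢ (s≤s (proj₂ (bounds p q))) (sym e)) ∷ distinct p)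

perm-max∷⁻ : ∀ {m xs} → Perm (suc m) (suc m ∷ xs) → Perm m xs
perm-max∷⁻ (perm s b u@(_ ∷ us)) = perm (suc-injective s)
  (λ q → proj₁ (b (there q)) , ≤-pred (≤∧≢⇒< (proj₂ (b (there q))) (∉-tail u q))) us

perm-max⁺ : ∀ {m} L {R} → Perm m (L ++ R) → Perm (suc m) (L ++ suc m ∷ R)
perm-max⁺ L {R} p = perm-resp-↭ (↭-sym (PermP.shift _ L R)) (perm-max∷⁺ p)

perm-max⁻ : ∀ {m} L {R} → Perm (suc m) (L ++ suc m ∷ R) → Perm m (L ++ R)
perm-max⁻ L {R} p = perm-max∷⁻ (perm-resp-↭ (PermP.shift _ L R) p)

perm-⊕ : ∀ {c m lo σ} → Perm c lo → Perm m σ → Perm (c + m) (lo ++ map (c +_) σ)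
perm-⊕ {c} {m} {lo} {σ} p q = perm
  (trans (length-++ lo) (cong₂ _+_ (size p) (trans (length-map (c +_) σ) (size q))))
  (λ x∈ → case ∈-++⁻ lo x∈ of λ
    { (inj₁ i) → proj₁ (bounds p i) , ≤-trans (proj₂ (bounds p i)) (m≤m+n c m)
    ; (inj₂ i) → case ∈-map⁻ (c +_) i of λ
      { (y , y∈ , refl) → ≤-trans (proj₁ (bounds q y∈)) (m≤n+m y c) , +-monoʳ-≤ c (proj₂ (bounds q y∈)) } })
  (UniqueP.++⁺ (distinct p) (UniqueP.map⁺ (+-cancelˡ-≡ c _ _) (distinct q))
    λ { (i , j) → case ∈-map⁻ (c +_) j of λ
      { (y , y∈ , refl) → contradiction (proj₂ (bounds p i)) (<⇒≱ (m<m+n c (proj₁ (bounds q y∈)))) } })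

unique-++⁻ : ∀ (xs : List ℕ) {ys} → Unique (xs ++ ys) → Unique xs × Unique ys
unique-++⁻ [] u = [] , u
unique-++⁻ (x ∷ xs) (h ∷ u) with unique-++⁻ xs u
... | a , b = AllP.++⁻ˡ xs h ∷ a , b

-- By `pigeonhole` the two parts have at most a and n - a entries. Their lengths add up to n, so
-- both bounds are attained.
perm-⊕⁻ : ∀ {a n} lo {σ} → a ≤ n → (∀ {x} → x ∈ lo → x ≤ a) → (∀ {x} → x ∈ σ → 1 ≤ x) →
  Perm n (lo ++ map (a +_) σ) → Perm a lo × Perm (n ∸ a) σ
perm-⊕⁻ {a} {n} lo {σ} a≤n lo≤a 1≤σ p with unique-++⁻ lo (distinct p)
... | ulo , uhi = perm lo≡a blo ulo , perm σ≡ bσ uσ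
  where
  uσ : Unique σ
  uσ = UniqueP.map⁻ uhi
  blo : ∀ {x} → x ∈ lo → 1 ≤ x × x ≤ a
  blo i = proj₁ (bounds p (∈-++⁺ˡ i)) , lo≤a i
  bσ : ∀ {x} → x ∈ σ → 1 ≤ x × x ≤ n ∸ a
  bσ {x} i = 1≤σ i , m+n≤o⇒m≤o∸n x (subst (_≤ n) (+-comm a x)
    (proj₂ (bounds p (∈-++⁺ʳ lo (∈-map⁺ (a +_) i)))))
  total : length lo + length σ ≡ n
  total = trans (cong (length lo +_) (sym (length-map (a +_) σ))) (trans (sym (length-++ lo)) (size p))
  lo≡a : length lo ≡ a
  lo≡a = ≤-antisym (pigeonhole a ulo blo) (+-cancelʳ-≤ (length σ) _ _ (begin
    a + length σ          ≤⟨ +-monoʳ-≤ a (pigeonhole (n ∸ a) uσ bσ) ⟩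
    a + (n ∸ a)           ≡⟨ m+[n∸m]≡n a≤n ⟩
    n                     ≡⟨ sym total ⟩
    length lo + length σ  ∎))
    where open ≤-Reasoning
  σ≡ : length σ ≡ n ∸ a
  σ≡ = trans (sym (m+n∸m≡n a (length σ))) (cong (_∸ a) (trans (cong (_+ length σ) (sym lo≡a)) total))

unshift : ∀ a xs → (∀ {x} → x ∈ xs → a < x) → map (a +_) (map (_∸ a) xs) ≡ xs
unshift a [] h = refl
unshift a (x ∷ xs) h = cong₂ _∷_ (m+[n∸m]≡n (<⇒≤ (h (here refl)))) (unshift a xs (h ∘ there))

separable-shift⁻ : ∀ c σ → Separable (map (c +_) σ) → Separable σ
separable-shift⁻ c σ = separable-map⁻ (c +_) (λ _ _ → +-monoʳ-< c)

-- Uses `separable-map⁻` along the inverse `_∸ c`, which is strictly increasing only from `c`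
-- upwards; hence the membership hypotheses there.
separable-shift⁺ : ∀ c σ → Separable σ → Separable (map (c +_) σ)
separable-shift⁺ c σ s = separable-map⁻ (_∸ c)
  (λ i _ x<y → case ∈-map⁻ (c +_) i of λ { (_ , _ , refl) → ∸-monoˡ-< x<y (m≤m+n c _) })
  (subst Separable (sym (trans (sym (map-∘ σ)) (trans (map-cong (m+n∸m≡n c) σ) (map-id σ)))) s)

maximum∈ : ∀ x xs → ∃ λ a → a ∈ x ∷ xs × (∀ {y} → y ∈ x ∷ xs → y ≤ a)
maximum∈ x [] = x , here refl , λ { (here refl) → ≤-refl }
maximum∈ x (y ∷ ys) with maximum∈ y ys
... | a , a∈ , h with ≤-total x a
... | inj₁ x≤a = a , there a∈ , λ { (here refl) → x≤a ; (there p) → h p }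
... | inj₂ a≤x = x , here refl , λ { (here refl) → ≤-refl ; (there p) → ≤-trans (h p) a≤x }

-- Turns pattern avoidance into a block decomposition: `P` and `Q` will say on which side of the
-- maximum of the opposite part an entry lies, and a pair in the wrong order will complete a
-- forbidden pattern.
separate : ∀ {P Q : ℕ → Set} xs → (∀ {x} → x ∈ xs → P x ⊎ Q x) →
  (∀ {y z} → y ∷ z ∷ [] ⊆ xs → Q y → P z → ⊥) →
  ∃₂ λ ys zs → xs ≡ ys ++ zs × (∀ {x} → x ∈ ys → P x) × (∀ {x} → x ∈ zs → Q x)
separate [] h ¬qp = [] , [] , refl , (λ ()) , (λ ())
separate {P} {Q} (x ∷ xs) h ¬qp with h (here refl)
... | inj₂ q = [] , x ∷ xs , refl , (λ ()) , λ
  { (here refl) → q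
  ; (there i) → case h (there i) of λ { (inj₁ p) → ⊥-elim (¬qp (refl ∷ from∈ i) q p) ; (inj₂ q) → q } }
... | inj₁ p with separate {P} {Q} xs (h ∘ there) (¬qp ∘ (x ∷ʳ_))
... | ys , zs , refl , hp , hq = x ∷ ys , zs , refl , (λ { (here refl) → p ; (there i) → hp i }) , hq

-- Membership in the enumerations

T-not⁺ : ∀ {b} → ¬ T b → T (not b)
T-not⁺ {true} h = h tt
T-not⁺ {false} h = tt

T-not⁻ : ∀ {b} → T (not b) → ¬ T b
T-not⁻ {true} ()
T-not⁻ {false} _ ()

∧⁺ : ∀ {a b} → T a → T b → T (a ∧ b)
∧⁺ p q = Equivalence.from T-∧ (p , q)

∧⁻ : ∀ {a b} → T (a ∧ b) → T a × T b
∧⁻ = Equivalence.to T-∧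

module _ {A : Set} where

  ∈-select⁺ : ∀ (P : A → Bool) {x} {xs} → x ∈ xs → T (P x) → x ∈ select P xs
  ∈-select⁺ P {x} (here refl) t with P x
  ... | true = here refl
  ∈-select⁺ P {x} {y ∷ xs} (there i) t with P y
  ... | true = there (∈-select⁺ P i t)
  ... | false = ∈-select⁺ P i t

  ∈-select⁻ : ∀ (P : A → Bool) {x} xs → x ∈ select P xs → x ∈ xs × T (P x)
  ∈-select⁻ P (y ∷ xs) i with P y in e
  ∈-select⁻ P (y ∷ xs) (here refl) | true = here refl , Equivalence.from T-≡ e
  ∈-select⁻ P (y ∷ xs) (there i) | true with ∈-select⁻ P xs i
  ... | j , t = there j , t
  ∈-select⁻ P (y ∷ xs) i | false with ∈-select⁻ P xs i
  ... | j , t = there j , t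

  unique-select : ∀ (P : A → Bool) {xs} → Unique xs → Unique (select P xs)
  unique-select P {[]} [] = []
  unique-select P {x ∷ xs} (h ∷ u) with P x
  ... | true = All.tabulate (λ i → All.lookup h (proj₁ (∈-select⁻ P xs i))) ∷ unique-select P u
  ... | false = unique-select P u

unique-concatMap : ∀ {A B C : Set} (φ : A → B → C) →
  (∀ {a a′ b b′} → φ a b ≡ φ a′ b′ → a ≡ a′ × b ≡ b′) →
  (h : A → List B) → (∀ a → Unique (h a)) → ∀ {as} → Unique as →
  Unique (concatMap (λ a → map (φ a) (h a)) as)
unique-concatMap φ inj h uh [] = []
unique-concatMap φ inj h uh {a ∷ as} (a∉ ∷ u) =
  UniqueP.++⁺ (UniqueP.map⁺ (proj₂ ∘ inj) (uh a)) (unique-concatMap φ inj h uh u) disjoint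
  where
  disjoint : ∀ {x} → ¬ (x ∈ map (φ a) (h a) × x ∈ concatMap (λ a → map (φ a) (h a)) as)
  disjoint (i , j) with ∈-map⁻ (φ a) i | find (∈-concatMap⁻ (λ a → map (φ a) (h a)) {xs = as} j)
  ... | b , _ , refl | a′ , a′∈ , k with ∈-map⁻ (φ a′) k
  ... | _ , _ , e = All.lookup a∉ a′∈ (proj₁ (inj e))

oneTo⁺ : ∀ {x n} → 1 ≤ x → x ≤ n → x ∈ oneTo n
oneTo⁺ {suc x} _ x<n = ∈-map⁺ suc (∈-upTo⁺ x<n)

oneTo⁻ : ∀ {x n} → x ∈ oneTo n → 1 ≤ x × x ≤ n
oneTo⁻ i with ∈-map⁻ suc i
... | _ , j , refl = s≤s z≤n , ∈-upTo⁻ j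

unique-oneTo : ∀ n → Unique (oneTo n)
unique-oneTo n = UniqueP.map⁺ suc-injective (UniqueP.upTo⁺ n)

∈-words⁺ : ∀ n {π} → (∀ {x} → x ∈ π → 1 ≤ x × x ≤ n) → π ∈ words n (length π)
∈-words⁺ n {[]} b = here refl
∈-words⁺ n {x ∷ π} b = ∈-concatMap⁺ _ (Any.map (λ { refl → ∈-map⁺ (x ∷_) (∈-words⁺ n (b ∘ there)) })
  (oneTo⁺ (proj₁ (b (here refl))) (proj₂ (b (here refl)))))

∈-words⁻ : ∀ n m {π} → π ∈ words n m → length π ≡ m × (∀ {x} → x ∈ π → 1 ≤ x × x ≤ n)
∈-words⁻ n zero (here refl) = refl , λ ()
∈-words⁻ n (suc m) i with find (∈-concatMap⁻ (λ a → map (a ∷_) (words n m)) {xs = oneTo n} i)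
... | a , a∈ , j with ∈-map⁻ (a ∷_) j
... | π , k , refl with ∈-words⁻ n m k
... | l , b = cong suc l , λ { (here refl) → oneTo⁻ a∈ ; (there p) → b p }

unique-words : ∀ n m → Unique (words n m)
unique-words n zero = [] ∷ []
unique-words n (suc m) =
  unique-concatMap _∷_ ∷-injective (λ _ → words n m) (λ _ → unique-words n m) (unique-oneTo n)

elem⁺ : ∀ {x xs} → x ∈ xs → T (elemᵇ x xs)
elem⁺ {x} i = AnyP.any⁺ (x ≡ᵇ_) (Any.map (λ e → ≡⇒≡ᵇ x _ e) i)

elem⁻ : ∀ {x} xs → T (elemᵇ x xs) → x ∈ xs
elem⁻ {x} xs t = Any.map (λ e → ≡ᵇ⇒≡ x _ e) (AnyP.any⁻ (x ≡ᵇ_) xs t)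

allDistinct⁺ : ∀ {xs} → Unique xs → T (allDistinct xs)
allDistinct⁺ [] = tt
allDistinct⁺ {x ∷ xs} (h ∷ u) =
  ∧⁺ (T-not⁺ (λ t → All.lookup h (elem⁻ xs t) refl)) (allDistinct⁺ u)

allDistinct⁻ : ∀ xs → T (allDistinct xs) → Unique xs
allDistinct⁻ [] _ = []
allDistinct⁻ (x ∷ xs) t with ∧⁻ t
... | t₁ , t₂ = All.tabulate (λ { i refl → T-not⁻ t₁ (elem⁺ i) }) ∷ allDistinct⁻ xs t₂

∈-perms⁺ : ∀ {n π} → Perm n π → π ∈ perms n
∈-perms⁺ {n} p = ∈-select⁺ allDistinct (subst (λ m → _ ∈ words n m) (size p) (∈-words⁺ n (bounds p)))
  (allDistinct⁺ (distinct p))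

∈-perms⁻ : ∀ {n π} → π ∈ perms n → Perm n π
∈-perms⁻ {n} {π} i with ∈-select⁻ allDistinct (words n n) i
... | j , t with ∈-words⁻ n n j
... | l , b = perm l b (allDistinct⁻ π t)

unique-perms : ∀ n → Unique (perms n)
unique-perms n = unique-select allDistinct (unique-words n n)

∈-subseqs⁺ : ∀ {σ π : List ℕ} → σ ⊆ π → σ ∈ subseqs π
∈-subseqs⁺ [] = here refl
∈-subseqs⁺ (y ∷ʳ τ) = ∈-++⁺ʳ _ (∈-subseqs⁺ τ)
∈-subseqs⁺ (refl ∷ τ) = ∈-++⁺ˡ (∈-map⁺ _ (∈-subseqs⁺ τ))

∈-subseqs⁻ : ∀ {σ} (π : List ℕ) → σ ∈ subseqs π → σ ⊆ π
∈-subseqs⁻ [] (here refl) = []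
∈-subseqs⁻ (x ∷ π) i with ∈-++⁻ (map (x ∷_) (subseqs π)) i
... | inj₂ j = x ∷ʳ ∈-subseqs⁻ π j
... | inj₁ j with ∈-map⁻ (x ∷_) j
... | _ , k , refl = refl ∷ ∈-subseqs⁻ π k

-- The boolean tests for 2413, 3142 and P_k

iff-true⁺ : ∀ {x y} → x < y → T (iffᵇ (x <ᵇ y) true)
iff-true⁺ p rewrite <ᵇ-true p = tt

iff-false⁺ : ∀ {x y} → y ≤ x → T (iffᵇ (x <ᵇ y) false)
iff-false⁺ p rewrite <ᵇ-false p = tt

iff-true⁻ : ∀ x y → T (iffᵇ (x <ᵇ y) true) → x < y
iff-true⁻ x y t with x <ᵇ y in e
... | true = <ᵇ⇒< x y (Equivalence.from T-≡ e)

-- Stands in for the anonymous functions inside `orderIso`. On four explicit pairs both sides reduce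
-- to the same conjunction, so results about `agree` apply to `orderIso` by computation.
agree : ℕ × ℕ → ℕ × ℕ → Bool
agree (a , b) (c , d) = iffᵇ (a <ᵇ c) (b <ᵇ d)

Agree : List (ℕ × ℕ) → Set
Agree zs = All (λ z → All (λ z′ → T (agree z z′)) zs) zs

agree⁺ : ∀ {zs} → Agree zs → T (all (λ z → all (agree z) zs) zs)
agree⁺ {zs} h = AllP.all⁻ (λ z → all (agree z) zs) (All.map (λ {z} → AllP.all⁻ (agree z)) h)

agree⁻ : ∀ zs → T (all (λ z → all (agree z) zs) zs) → Agree zs
agree⁻ zs t = All.map (λ {z} → AllP.all⁺ (agree z) zs) (AllP.all⁺ (λ z → all (agree z) zs) zs t)

orderIso-2413⁺ : ∀ {a b c d} → c < a → a < d → d < b → T (orderIso (a ∷ b ∷ c ∷ d ∷ []) p2413)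
orderIso-2413⁺ {a} {b} {c} {d} c<a a<d d<b = agree⁺ {(a , 2) ∷ (b , 4) ∷ (c , 1) ∷ (d , 3) ∷ []} (
  (r a ∷ t a<b ∷ f (<⇒≤ c<a) ∷ t a<d ∷ []) ∷
  (f (<⇒≤ a<b) ∷ r b ∷ f (<⇒≤ c<b) ∷ f (<⇒≤ d<b) ∷ []) ∷
  (t c<a ∷ t c<b ∷ r c ∷ t c<d ∷ []) ∷
  (f (<⇒≤ a<d) ∷ t d<b ∷ f (<⇒≤ c<d) ∷ r d ∷ []) ∷ [])
  where
  t : ∀ {x y} → x < y → T (iffᵇ (x <ᵇ y) true)
  t = iff-true⁺
  f : ∀ {x y} → y ≤ x → T (iffᵇ (x <ᵇ y) false)
  f = iff-false⁺
  r : ∀ x → T (iffᵇ (x <ᵇ x) false)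
  r x = f {x} ≤-refl
  a<b = <-trans a<d d<b
  c<d = <-trans c<a a<d
  c<b = <-trans c<d d<b

orderIso-3142⁺ : ∀ {a b c d} → b < d → d < a → a < c → T (orderIso (a ∷ b ∷ c ∷ d ∷ []) p3142)
orderIso-3142⁺ {a} {b} {c} {d} b<d d<a a<c = agree⁺ {(a , 3) ∷ (b , 1) ∷ (c , 4) ∷ (d , 2) ∷ []} (
  (r a ∷ f (<⇒≤ b<a) ∷ t a<c ∷ f (<⇒≤ d<a) ∷ []) ∷
  (t b<a ∷ r b ∷ t b<c ∷ t b<d ∷ []) ∷
  (f (<⇒≤ a<c) ∷ f (<⇒≤ b<c) ∷ r c ∷ f (<⇒≤ d<c) ∷ []) ∷
  (t d<a ∷ f (<⇒≤ b<d) ∷ t d<c ∷ r d ∷ []) ∷ [])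
  where
  t : ∀ {x y} → x < y → T (iffᵇ (x <ᵇ y) true)
  t = iff-true⁺
  f : ∀ {x y} → y ≤ x → T (iffᵇ (x <ᵇ y) false)
  f = iff-false⁺
  r : ∀ x → T (iffᵇ (x <ᵇ x) false)
  r x = f {x} ≤-refl
  b<a = <-trans b<d d<a
  d<c = <-trans d<a a<c
  b<c = <-trans b<d d<c

orderIso-2413⁻ : ∀ σ → T (orderIso σ p2413) →
  ∃₂ λ a b → ∃₂ λ c d → σ ≡ a ∷ b ∷ c ∷ d ∷ [] × c < a × a < d × d < b
orderIso-2413⁻ (a ∷ b ∷ c ∷ d ∷ []) t with agree⁻ ((a , 2) ∷ (b , 4) ∷ (c , 1) ∷ (d , 3) ∷ []) t
... | (_ ∷ _ ∷ _ ∷ ad ∷ []) ∷ _ ∷ (ca ∷ _) ∷ (_ ∷ db ∷ _) ∷ [] =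
  a , b , c , d , refl , iff-true⁻ c a ca , iff-true⁻ a d ad , iff-true⁻ d b db

orderIso-3142⁻ : ∀ σ → T (orderIso σ p3142) →
  ∃₂ λ a b → ∃₂ λ c d → σ ≡ a ∷ b ∷ c ∷ d ∷ [] × b < d × d < a × a < c
orderIso-3142⁻ (a ∷ b ∷ c ∷ d ∷ []) t with agree⁻ ((a , 3) ∷ (b , 1) ∷ (c , 4) ∷ (d , 2) ∷ []) t
... | (_ ∷ _ ∷ ac ∷ _) ∷ (_ ∷ _ ∷ _ ∷ bd ∷ []) ∷ _ ∷ (da ∷ _) ∷ [] =
  a , b , c , d , refl , iff-true⁻ b d bd , iff-true⁻ d a da , iff-true⁻ a c ac

contains⁺ : ∀ {σ π} pat → σ ⊆ π → T (orderIso σ pat) → T (containsᵇ π pat)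
contains⁺ pat τ t = AnyP.any⁺ _ (Any.map (λ { refl → t }) (∈-subseqs⁺ τ))

contains⁻ : ∀ π pat → T (containsᵇ π pat) → ∃ λ σ → σ ⊆ π × T (orderIso σ pat)
contains⁻ π pat t with find (AnyP.any⁻ (λ σ → orderIso σ pat) (subseqs π) t)
... | σ , i , o = σ , ∈-subseqs⁻ π i , o

separableᵇ⁺ : ∀ {π} → Separable π → T (separableᵇ π)
separableᵇ⁺ {π} (s₁ , s₂) = ∧⁺ (T-not⁺ no₁) (T-not⁺ no₂)
  where
  no₁ : ¬ T (containsᵇ π p2413)
  no₁ t with contains⁻ π p2413 t
  ... | σ , τ , o with orderIso-2413⁻ σ o
  ... | _ , _ , _ , _ , refl , x , y , z = s₁ τ x y z
  no₂ : ¬ T (containsᵇ π p3142)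
  no₂ t with contains⁻ π p3142 t
  ... | σ , τ , o with orderIso-3142⁻ σ o
  ... | _ , _ , _ , _ , refl , x , y , z = s₂ τ x y z

separableᵇ⁻ : ∀ π → T (separableᵇ π) → Separable π
separableᵇ⁻ π t with ∧⁻ {not (containsᵇ π p2413)} t
... | t₁ , t₂ = (λ τ x y z → T-not⁻ t₁ (contains⁺ p2413 τ (orderIso-2413⁺ x y z))) ,
                (λ τ x y z → T-not⁻ t₂ (contains⁺ p3142 τ (orderIso-3142⁺ x y z)))

all-reverse : ∀ {P : ℕ → Set} {xs} → All P xs → All P (reverse xs)
all-reverse h = All.tabulate (All.lookup h ∘ AnyP.reverse⁻)

lastAbove⁺ : ∀ σ l → All (_< l) σ → T (lastAbove (σ ++ [ l ]))
lastAbove⁺ σ l h rewrite reverse-++ σ [ l ] = AllP.all⁻ _ (All.map <⇒<ᵇ (all-reverse h))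

lastAbove⁻ : ∀ σ → T (lastAbove σ) → ∃₂ λ ρ l → σ ≡ ρ ++ [ l ] × All (_< l) ρ
lastAbove⁻ σ t with reverse σ in e
... | l ∷ rest = reverse rest , l ,
  trans (sym (reverse-involutive σ)) (trans (cong reverse e) (unfold-reverse l rest)) ,
  all-reverse (All.map (λ {x} → <ᵇ⇒< x l) (AllP.all⁺ _ rest t))

avoidsP⇒¬contains : ∀ {k} π → AvoidsP k noneSeen π → ¬ T (containsPᵇ k π)
avoidsP⇒¬contains {k} π a t with find (AnyP.any⁻ (λ σ → (length σ ≡ᵇ k) ∧ lastAbove σ) (subseqs π) t)
... | σ , i , o with ∧⁻ {length σ ≡ᵇ k} o
... | len , last with lastAbove⁻ σ last
... | ρ , l , refl , h = <⇒≢ (begin-strict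
    length (ρ ++ [ l ])  ≡⟨ length-++ ρ ⟩
    length ρ + 1         <⟨ +-monoʳ-< (length ρ) (s≤s (s≤s z≤n)) ⟩
    length ρ + 2         ≡⟨ cong (_+ 2) (sym (+-identityʳ (length ρ))) ⟩
    length ρ + 0 + 2     ≤⟨ avoidsP⇒bound π ρ a (∈-subseqs⁻ π i) h ⟩
    k                    ∎) (≡ᵇ⇒≡ _ k len)
  where open ≤-Reasoning

-- `containsPᵇ` looks for subsequences of exactly k entries, while the bound speaks of all lengths.
-- A violation that is too long is trimmed from the front, which keeps its last entry above all the
-- others. `1 ≤ k` leaves room for that last entry; for k = 0 the test never succeeds.
¬contains⇒avoidsP : ∀ {k} π → 1 ≤ k → ¬ T (containsPᵇ k π) → AvoidsP k noneSeen π
¬contains⇒avoidsP {k} π 1≤k ¬t = bound⇒avoidsP π bound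
  where
  bound : ∀ σ l → σ ++ [ l ] ⊆ π → All (_< l) σ → length σ + 0 + 2 ≤ k
  bound σ l τ h with length σ + 0 + 2 ≤? k
  ... | yes p = p
  ... | no p = contradiction (AnyP.any⁺ (λ σ → (length σ ≡ᵇ k) ∧ lastAbove σ) (Any.map (λ { refl → found }) (∈-subseqs⁺ (⊆-trans τ′ τ)))) ¬t
    where
    d = length σ + 1 ∸ k
    σ′ = drop d σ
    τ′ : σ′ ++ [ l ] ⊆ σ ++ [ l ]
    τ′ = SubP.++⁺ (SubP.drop-⊆ d σ) ⊆-refl
    k≤ : k ≤ length σ + 1
    k≤ = ≤-pred (≤-trans (≰⇒> p) (≤-reflexive (trans (cong (_+ 2) (+-identityʳ (length σ))) (+-suc (length σ) 1))))
    d≤ : d ≤ length σ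
    d≤ = ≤-trans (∸-monoʳ-≤ (length σ + 1) 1≤k) (≤-reflexive (m+n∸n≡m (length σ) 1))
    len : length (σ′ ++ [ l ]) ≡ k
    len = begin
      length (σ′ ++ [ l ])               ≡⟨ length-++ σ′ ⟩
      length σ′ + 1                      ≡⟨ cong (_+ 1) (length-drop d σ) ⟩
      (length σ ∸ d) + 1                 ≡⟨ +-∸-comm 1 d≤ ⟨
      length σ + 1 ∸ d                   ≡⟨ m∸[m∸n]≡n k≤ ⟩
      k                                  ∎
      where open ≡-Reasoning
    found : T ((length (σ′ ++ [ l ]) ≡ᵇ k) ∧ lastAbove (σ′ ++ [ l ]))
    found = ∧⁺ (≡⇒≡ᵇ _ k len) (lastAbove⁺ σ′ l (AllP.drop⁺ d h))

record InAv (k n : ℕ) (π : List ℕ) : Set where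
  constructor inAv
  field
    isPerm : Perm n π
    isSeparable : Separable π
    isAvoiding : AvoidsP k noneSeen π
open InAv

∈-Av⁺ : ∀ {k n π} → InAv k n π → π ∈ Av k n
∈-Av⁺ {k} {n} {π} a = ∈-select⁺ _ (∈-perms⁺ (isPerm a))
  (∧⁺ {separableᵇ π} (separableᵇ⁺ (isSeparable a)) (T-not⁺ (avoidsP⇒¬contains π (isAvoiding a))))

∈-Av⁻ : ∀ {k n π} → 1 ≤ k → π ∈ Av k n → InAv k n π
∈-Av⁻ {k} {n} {π} 1≤k i with ∈-select⁻ _ (perms n) i
... | j , t with ∧⁻ {separableᵇ π} t
... | t₁ , t₂ = inAv (∈-perms⁻ j) (separableᵇ⁻ π t₁) (¬contains⇒avoidsP π 1≤k (T-not⁻ t₂))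

unique-Av : ∀ k n → Unique (Av k n)
unique-Av k n = unique-select _ (unique-perms n)

∈-Sep⁺ : ∀ {n π} → Perm n π → Separable π → π ∈ Sep n
∈-Sep⁺ p s = ∈-select⁺ separableᵇ (∈-perms⁺ p) (separableᵇ⁺ s)

∈-Sep⁻ : ∀ {n π} → π ∈ Sep n → Perm n π × Separable π
∈-Sep⁻ {n} {π} i with ∈-select⁻ separableᵇ (perms n) i
... | j , t = ∈-perms⁻ j , separableᵇ⁻ π t

unique-Sep : ∀ n → Unique (Sep n)
unique-Sep n = unique-select separableᵇ (unique-perms n)

-- Peeling off the top block

++-cancel-length : ∀ (xs ys : List ℕ) {zs ws} → length xs ≡ length ys → xs ++ zs ≡ ys ++ ws →
  xs ≡ ys × zs ≡ ws
++-cancel-length [] [] _ e = refl , e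
++-cancel-length (x ∷ xs) (y ∷ ys) l e with ∷-injective e
... | refl , e′ with ++-cancel-length xs ys (suc-injective l) e′
... | refl , e″ = refl , e″

take-prefix : ∀ (L : List ℕ) {R} → take (length L) (L ++ R) ≡ L
take-prefix [] = refl
take-prefix (x ∷ L) = cong (x ∷_) (take-prefix L)

drop-prefix : ∀ (L : List ℕ) {y R} → drop (suc (length L)) (L ++ y ∷ R) ≡ R
drop-prefix [] = refl
drop-prefix (x ∷ L) = drop-prefix L

indexOf-prefix : ∀ n L {R} → n ∉ L → indexOf n (L ++ n ∷ R) ≡ length L
indexOf-prefix n [] ∉ rewrite Equivalence.to T-≡ (≡⇒≡ᵇ n n refl) = refl
indexOf-prefix n (x ∷ L) ∉ with n ≡ᵇ x in e
... | true = ⊥-elim (∉ (here (≡ᵇ⇒≡ n x (Equivalence.from T-≡ e))))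
... | false = cong suc (indexOf-prefix n L (∉ ∘ there))

-- The permutations of Av k (m + 1) are L (m + 1) R, with i entries to the left of the maximum.
record Conf (k i m : ℕ) (L R : List ℕ) : Set where
  constructor conf
  field
    left : length L ≡ i
    perm-LR : Perm m (L ++ R)
    separable : Separable (L ++ suc m ∷ R)
    avoiding : AvoidsP k noneSeen (L ++ suc m ∷ R)

  ≤m : ∀ {x} → x ∈ L ++ R → x ≤ m
  ≤m = proj₂ ∘ bounds perm-LR

  max∉L : suc m ∉ L
  max∉L p = <⇒≱ (n<1+n m) (≤m (∈-++⁺ˡ p))

  index≡ : indexOf (suc m) (L ++ suc m ∷ R) ≡ i
  index≡ = trans (indexOf-prefix (suc m) L max∉L) left
open Conf

-- `m` is the second largest entry, except for the permutation of length one, which is counted by f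
-- and accounts for the case `m ≡ 0`.
FMember GMember : ℕ → ℕ → ℕ → List ℕ → Set
FMember k i n π = ∃ λ m → ∃₂ λ L R → n ≡ suc m × π ≡ L ++ suc m ∷ R × Conf k i m L R × (m ≡ 0 ⊎ m ∈ R)
GMember k i n π = ∃ λ m → ∃₂ λ L R → n ≡ suc m × π ≡ L ++ suc m ∷ R × Conf k i m L R × m ∈ L

fList gList : ℕ → ℕ → ℕ → List (List ℕ)
fList k i n = select (condF n i) (Av k n)
gList k i n = select (condG n i) (Av k n)

unique-fList : ∀ k i n → Unique (fList k i n)
unique-fList k i n = unique-select _ (unique-Av k n)

unique-gList : ∀ k i n → Unique (gList k i n)
unique-gList k i n = unique-select _ (unique-Av k n)

conf⇒∈Av : ∀ {k i m L R} → Conf k i m L R → L ++ suc m ∷ R ∈ Av k (suc m)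
conf⇒∈Av {L = L} c = ∈-Av⁺ (inAv (perm-max⁺ L (perm-LR c)) (separable c) (avoiding c))

∈Av⇒conf : ∀ {k m π} → 1 ≤ k → π ∈ Av k (suc m) →
  ∃₂ λ L R → π ≡ L ++ suc m ∷ R × Conf k (length L) m L R
∈Av⇒conf {m = m} 1≤k p with ∈-Av⁻ 1≤k p
... | inAv isP isS isA with ∈-∃++ (perm-max∈ {m} isP)
... | L , R , refl = L , R , refl , conf refl (perm-max⁻ L isP) isS isA

∈-fList⁺ : ∀ {k i m L R} → Conf k i m L R → m ≡ 0 ⊎ m ∈ R → L ++ suc m ∷ R ∈ fList k i (suc m)
∈-fList⁺ {k} {i} {m} {L} {R} c h = ∈-select⁺ (condF (suc m) i) (conf⇒∈Av c)
  (∧⁺ (≡⇒≡ᵇ _ i (index≡ c)) (Equivalence.from T-∨ (right h)))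
  where
  right : m ≡ 0 ⊎ m ∈ R →
    T (suc m <ᵇ 2) ⊎ T (elemᵇ m (drop (suc (indexOf (suc m) (L ++ suc m ∷ R))) (L ++ suc m ∷ R)))
  right (inj₁ refl) = inj₁ tt
  right (inj₂ p) rewrite indexOf-prefix (suc m) L {R} (max∉L c) | drop-prefix L {suc m} {R} = inj₂ (elem⁺ p)

∈-fList⁻ : ∀ k i n {π} → 1 ≤ k → π ∈ fList k i n → FMember k i n π
∈-fList⁻ k i zero 1≤k p with ∈-select⁻ (condF 0 i) (Av k 0) p
... | _ , ()
∈-fList⁻ k i (suc m) 1≤k p with ∈-select⁻ (condF (suc m) i) (Av k (suc m)) p
... | q , t with ∈Av⇒conf {m = m} 1≤k q
... | L , R , refl , c rewrite index≡ c with ∧⁻ {length L ≡ᵇ i} t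
... | t₁ , t₂ with ≡ᵇ⇒≡ (length L) i t₁
... | refl = m , L , R , refl , refl , c , side (Equivalence.to T-∨ t₂)
  where
  side : T (suc m <ᵇ 2) ⊎ T (elemᵇ m (drop (suc (length L)) (L ++ suc m ∷ R))) → m ≡ 0 ⊎ m ∈ R
  side (inj₁ s) = inj₁ (n<1⇒n≡0 (<ᵇ⇒< m 1 s))
  side (inj₂ s) rewrite drop-prefix L {suc m} {R} = inj₂ (elem⁻ R s)

∈-gList⁺ : ∀ {k i m L R} → Conf k i m L R → m ∈ L → L ++ suc m ∷ R ∈ gList k i (suc m)
∈-gList⁺ {k} {i} {zero} c p with proj₁ (bounds (perm-LR c) (∈-++⁺ˡ p))
... | ()
∈-gList⁺ {k} {i} {suc m} {L} {R} c p = ∈-select⁺ (condG (suc (suc m)) i) (conf⇒∈Av c)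
  (∧⁺ (≡⇒≡ᵇ _ i (index≡ c)) prefix)
  where
  prefix : T (elemᵇ (suc m) (take (indexOf (suc (suc m)) (L ++ suc (suc m) ∷ R)) (L ++ suc (suc m) ∷ R)))
  prefix rewrite indexOf-prefix (suc (suc m)) L {R} (max∉L c) | take-prefix L {suc (suc m) ∷ R} = elem⁺ p

∈-gList⁻ : ∀ k i n {π} → 1 ≤ k → π ∈ gList k i n → GMember k i n π
∈-gList⁻ k i zero 1≤k p with ∈-select⁻ (condG 0 i) (Av k 0) p
... | _ , ()
∈-gList⁻ k i (suc m) 1≤k p with ∈-select⁻ (condG (suc m) i) (Av k (suc m)) p
... | q , t with ∈Av⇒conf {m = m} 1≤k q
... | L , R , refl , c rewrite index≡ c with ∧⁻ {length L ≡ᵇ i} (proj₂ (∧⁻ {2 ≤ᵇ suc m} t))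
... | t₁ , t₂ with ≡ᵇ⇒≡ (length L) i t₁
... | refl = m , L , R , refl , refl , c , side t₂
  where
  side : T (elemᵇ m (take (length L) (L ++ suc m ∷ R))) → m ∈ L
  side s rewrite take-prefix L {suc m ∷ R} = elem⁻ L s

shift-≺ : ∀ {c j xs σ} → (∀ {x} → x ∈ xs → x ≤ c) → Perm j σ → xs ≺ map (c +_) σ
shift-≺ {c} le p i q with ∈-map⁻ (c +_) q
... | y , y∈ , refl = ≤-<-trans (le i) (m<m+n c (proj₁ (bounds p y∈)))

shift-bounded : ∀ {c j σ} → Perm j σ → ∀ {x} → x ∈ map (c +_) σ → x < suc (c + j)
shift-bounded {c} p q with ∈-map⁻ (c +_) q
... | y , y∈ , refl = s≤s (+-monoʳ-≤ c (proj₂ (bounds p y∈)))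

shift-max∈ : ∀ c {j σ} → 1 ≤ j → Perm j σ → c + j ∈ map (c +_) σ
shift-max∈ c {suc j} _ p = ∈-map⁺ (c +_) (perm-max∈ p)

shiftView : ∀ a xs → (∀ {x} → x ∈ xs → a < x) → ∃ λ σ → xs ≡ map (a +_) σ × (∀ {x} → x ∈ σ → 1 ≤ x)
shiftView a xs h = map (_∸ a) xs , sym (unshift a xs h) , λ i → case ∈-map⁻ (_∸ a) i of λ
  { (y , y∈ , refl) → m<n⇒0<n∸m (h y∈) }

≺-max∷ : ∀ {xs N B} → (∀ {x} → x ∈ xs → x < N) → xs ≺ B → xs ≺ N ∷ B
≺-max∷ h k p (here refl) = h p
≺-max∷ h k p (there q) = k p q

≺-∷ʳmax : ∀ {xs N} B → (∀ {x} → x ∈ xs → x < N) → xs ≺ B → xs ≺ B ++ [ N ]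
≺-∷ʳmax B h k p q with ∈-++⁻ B q
... | inj₁ i = k p i
... | inj₂ (here refl) = h p

≤⇒≺[suc] : ∀ {xs c} → (∀ {x} → x ∈ xs → x ≤ c) → xs ≺ [ suc c ]
≤⇒≺[suc] h p (here refl) = s≤s (h p)

↭-swapʳ : ∀ (xs : List ℕ) ys zs → xs ++ (ys ++ zs) ↭ (xs ++ zs) ++ ys
↭-swapʳ xs ys zs = ↭-trans (PermP.++⁺ˡ xs (PermP.++-comm ys zs)) (↭-reflexive (sym (++-assoc xs zs ys)))

unique-disjoint : ∀ (xs : List ℕ) {ys y} → Unique (xs ++ ys) → y ∈ xs → y ∈ ys → ⊥
unique-disjoint (x ∷ xs) (h ∷ u) (here refl) q = All.lookup h (∈-++⁺ʳ xs q) refl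
unique-disjoint (x ∷ xs) (h ∷ u) (there p) q = unique-disjoint xs u p q

addTopRight : ∀ {k i m j L R σ} → Conf k i m L R → 2 + i ≤ k → 1 ≤ j → InAv (k ∸ i) j σ →
  Conf k i (m + j) L (map (m +_) σ ++ R) × m + j ∈ map (m +_) σ ++ R
addTopRight {k} {i} {m} {j} {L} {R} {σ} c 2+i≤k 1≤j a =
  conf (left c) (perm-resp-↭ (↭-sym (↭-swapʳ L B R)) (perm-⊕ (perm-LR c) (isPerm a)))
    (separable-inflate L (N ∷ B) R (suc m) L≺M R≺M (≤⇒≺[suc] leL) R≺z (separable c)
      (separable-max∷ (shift-bounded (isPerm a)) (separable-shift⁺ m σ (isSeparable a))))
    (avoidsP-inflate⁺ L (N ∷ B) R (suc m) L≺M R≺M R≺z (avoiding c)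
      (subst (λ l → 2 + l ≤ k) (sym (left c)) 2+i≤k ,
       avoidsP-mono B bound (avoidsP-shift⁺ m σ (λ _ → refl) (isAvoiding a)))) ,
  ∈-++⁺ˡ (shift-max∈ m 1≤j (isPerm a))
  where
  B = map (m +_) σ
  N = suc (m + j)
  leL : ∀ {x} → x ∈ L → x ≤ m
  leL p = ≤m c (∈-++⁺ˡ p)
  leR : ∀ {x} → x ∈ R → x ≤ m
  leR p = ≤m c (∈-++⁺ʳ L p)
  L≺M : L ≺ N ∷ B
  L≺M = ≺-max∷ (λ p → s≤s (≤-trans (leL p) (m≤m+n m j))) (shift-≺ leL (isPerm a))
  R≺M : R ≺ N ∷ B
  R≺M = ≺-max∷ (λ p → s≤s (≤-trans (leR p) (m≤m+n m j))) (shift-≺ leR (isPerm a))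
  R≺z : R ≺ [ suc m ]
  R≺z = ≤⇒≺[suc] leR
  -- `N` precedes the block but exceeds it, so a block entry has counter i plus what the block
  -- itself contributes: threshold k with counter i amounts to threshold k - i with counter 0.
  bound : ∀ {z} → z ∈ B → indicator (N <ᵇ z) + length L + (k ∸ i) ≤ 0 + k
  bound p rewrite <ᵇ-false (<⇒≤ (shift-bounded (isPerm a) p)) | left c =
    ≤-reflexive (m+[n∸m]≡n (≤-trans (m≤n+m i 2) 2+i≤k))

-- The cut is made at `a`, the maximum of `L`, which exists because `1 ≤ i`. An entry of `R` below
-- `a` followed by one above `a` would form 2413 with `a` as the 2 and the overall maximum as the 4.
-- So the entries of `R` above `a` come first, and they form the block.
removeTopRight : ∀ {k i m L R} → Conf k i m L R → 1 ≤ i → 2 + i ≤ k → m ∈ R →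
  ∃₂ λ a j → ∃₂ λ σ R′ → m ≡ a + j × R ≡ map (a +_) σ ++ R′ × 1 ≤ j ×
    Conf k i a L R′ × a ∈ L × InAv (k ∸ i) j σ
removeTopRight {L = []} (conf refl _ _ _) () _ _
removeTopRight {k} {i} {m} {L = x ∷ xs} {R} c 1≤i 2+i≤k m∈R with maximum∈ x xs
... | a , a∈L , L≤a with separate {P = a <_} {Q = _< a} R sides noDescent
  where
  a≤m : a ≤ m
  a≤m = ≤m c (∈-++⁺ˡ a∈L)
  sides : ∀ {r} → r ∈ R → a < r ⊎ r < a
  sides {r} r∈ with <-cmp a r
  ... | tri< p _ _ = inj₁ p
  ... | tri> _ _ p = inj₂ p
  ... | tri≈ _ refl _ = ⊥-elim (unique-disjoint (x ∷ xs) (distinct (perm-LR c)) a∈L r∈)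
  noDescent : ∀ {y z} → y ∷ z ∷ [] ⊆ R → y < a → a < z → ⊥
  noDescent τ y<a a<z = proj₁ (separable c) (SubP.++⁺ (from∈ a∈L) (refl ∷ τ)) y<a a<z
    (s≤s (≤m c (∈-++⁺ʳ (x ∷ xs) (∈-⊆ τ (there (here refl))))))
... | B , R′ , refl , B>a , R′<a with shiftView a B B>a
... | σ , refl , 1≤σ = a , m ∸ a , σ , R′ , sym (m+[n∸m]≡n a≤m) , refl , m<n⇒0<n∸m a<m ,
    conf (left c) (proj₁ parts)
      (separable-inflate L [ suc a ] R′ (suc m) (≤⇒≺[suc] L≤a) R′≺sa
        (λ p → ≤⇒≺[suc] (≤m c) (∈-++⁺ˡ p)) R′≺sm
        (separable-⊆ (SubP.++⁺ (⊆-refl {x = L}) (refl ∷ SubP.++⁺ˡ B ⊆-refl)) (separable c))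
        (separable-short (suc a)))
      (proj₁ av) ,
    a∈L ,
    inAv pσ
      (separable-shift⁻ a σ (separable-⊆ (SubP.++⁺ˡ L (_ ∷ʳ SubP.++⁺ʳ R′ ⊆-refl)) (separable c)))
      (avoidsP-shift⁻ a σ (λ _ → refl) (avoidsP-mono B bound (proj₂ (proj₂ av))))
  where
  L = x ∷ xs
  a≤m : a ≤ m
  a≤m = ≤m c (∈-++⁺ˡ a∈L)
  a<m : a < m
  a<m with ∈-++⁻ B m∈R
  ... | inj₁ p = B>a p
  ... | inj₂ p = ⊥-elim (<⇒≱ (R′<a p) a≤m)
  R′≺sa : R′ ≺ [ suc a ]
  R′≺sa = ≤⇒≺[suc] (<⇒≤ ∘ R′<a)
  R′≺sm : R′ ≺ [ suc m ]
  R′≺sm = ≤⇒≺[suc] (λ p → ≤m c (∈-++⁺ʳ L (∈-++⁺ʳ B p)))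
  parts : Perm a (L ++ R′) × Perm (m ∸ a) σ
  parts = perm-⊕⁻ (L ++ R′) a≤m
    (λ p → case ∈-++⁻ L p of λ { (inj₁ q) → L≤a q ; (inj₂ q) → <⇒≤ (R′<a q) })
    1≤σ (perm-resp-↭ (↭-swapʳ L B R′) (perm-LR c))
  pσ = proj₂ parts
  B<N : ∀ {z} → z ∈ B → z < suc m
  B<N p = s≤s (≤m c (∈-++⁺ʳ L (∈-++⁺ˡ p)))
  av : AvoidsP k noneSeen (L ++ suc a ∷ R′) × AvoidsP k (λ _ → length L) (suc m ∷ B)
  av = avoidsP-inflate⁻ L (suc m ∷ B) R′ (suc a) (subst (λ l → 2 + l ≤ k) (sym (left c)) 2+i≤k)
    (≺-max∷ (λ p → s≤s (≤-trans (L≤a p) a≤m)) (shift-≺ L≤a pσ))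
    (≺-max∷ (λ p → R′≺sm p (here refl)) (shift-≺ (<⇒≤ ∘ R′<a) pσ))
    (≤⇒≺[suc] L≤a) R′≺sa (avoiding c)
  bound : ∀ {z} → z ∈ B → 0 + k ≤ indicator (suc m <ᵇ z) + length L + (k ∸ i)
  bound p rewrite <ᵇ-false (<⇒≤ (B<N p)) =
    ≤-reflexive (sym (trans (cong (_+ (k ∸ i)) (left c)) (m+[n∸m]≡n (≤-trans (m≤n+m i 2) 2+i≤k))))

regroup : ∀ (L B : List ℕ) N R → L ++ (B ++ [ N ]) ++ R ≡ (L ++ B) ++ N ∷ R
regroup L B N R = trans (cong (L ++_) (++-assoc B [ N ] R)) (sym (++-assoc L B (N ∷ R)))

⊆-∷ʳ⁻ : ∀ (as : List ℕ) {d} xs {z} → as ++ [ d ] ⊆ xs ++ [ z ] → as ++ [ d ] ⊆ xs ⊎ (d ≡ z × as ⊆ xs)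
⊆-∷ʳ⁻ as xs τ with ⊆-++-split xs τ
... | bs , [] , e , α , _ = inj₁ (subst (_⊆ xs) (trans (sym (++-identityʳ bs)) (sym e)) α)
... | bs , b ∷ [] , e , α , refl ∷ _ with ∷ʳ-injective as bs e
... | refl , refl = inj₂ (refl , α)
⊆-∷ʳ⁻ as xs τ | bs , _ ∷ _ , e , α , _ ∷ʳ ()
⊆-∷ʳ⁻ as xs τ | bs , _ ∷ _ ∷ _ , e , α , _ ∷ ()

-- Neither pattern ends with its 4.
separable-∷ʳmax : ∀ {z xs} → (∀ {x} → x ∈ xs → x < z) → Separable xs → Separable (xs ++ [ z ])
separable-∷ʳmax {z} {xs} top (s₁ , s₂) = av₁ , av₂
  where
  av₁ : Avoids2413 (xs ++ [ z ])
  av₁ {a} {b} {c} τ c<a a<d d<b with ⊆-∷ʳ⁻ (a ∷ b ∷ c ∷ []) xs τ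
  ... | inj₁ τ′ = s₁ τ′ c<a a<d d<b
  ... | inj₂ (refl , α) = <-asym d<b (top (∈-⊆ α (there (here refl))))
  av₂ : Avoids3142 (xs ++ [ z ])
  av₂ {a} {b} {c} τ b<d d<a a<c with ⊆-∷ʳ⁻ (a ∷ b ∷ c ∷ []) xs τ
  ... | inj₁ τ′ = s₂ τ′ b<d d<a a<c
  ... | inj₂ (refl , α) = <-asym d<a (top (∈-⊆ α (here refl)))

addTopLeft : ∀ {k i m j L R σ} → Conf k i m L R → 2 + (i + j) ≤ k → 1 ≤ j → Perm j σ → Separable σ →
  Conf k (i + j) (m + j) (L ++ map (m +_) σ) R × m + j ∈ L ++ map (m +_) σ
addTopLeft {k} {i} {m} {j} {L} {R} {σ} c small 1≤j p s =
  conf (trans (length-++ L) (cong₂ _+_ (left c) lenB))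
    (perm-resp-↭ (↭-trans (↭-sym (↭-swapʳ L B R)) (↭-reflexive (sym (++-assoc L B R)))) (perm-⊕ (perm-LR c) p))
    (subst Separable (regroup L B N R)
      (separable-inflate L (B ++ [ N ]) R (suc m) L≺M R≺M (≤⇒≺[suc] leL) R≺z (separable c)
        (separable-∷ʳmax (shift-bounded p) (separable-shift⁺ m σ s))))
    (subst (AvoidsP k noneSeen) (regroup L B N R)
      (avoidsP-inflate⁺ L (B ++ [ N ]) R (suc m) L≺M R≺M R≺z (avoiding c)
        -- `L`, the block and `N` together have i + j + 1 entries, which is at most k - 1.
        (avoidsP-short (B ++ [ N ]) λ _ → ≤-trans (≤-reflexive sizes) small))) ,
  ∈-++⁺ʳ L (shift-max∈ m 1≤j p)
  where
  B = map (m +_) σ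
  N = suc (m + j)
  lenB : length B ≡ j
  lenB = trans (length-map (m +_) σ) (size p)
  leL : ∀ {x} → x ∈ L → x ≤ m
  leL p = ≤m c (∈-++⁺ˡ p)
  leR : ∀ {x} → x ∈ R → x ≤ m
  leR p = ≤m c (∈-++⁺ʳ L p)
  L≺M : L ≺ B ++ [ N ]
  L≺M = ≺-∷ʳmax B (λ p → s≤s (≤-trans (leL p) (m≤m+n m j))) (shift-≺ leL p)
  R≺M : R ≺ B ++ [ N ]
  R≺M = ≺-∷ʳmax B (λ p → s≤s (≤-trans (leR p) (m≤m+n m j))) (shift-≺ leR p)
  R≺z : R ≺ [ suc m ]
  R≺z = ≤⇒≺[suc] leR
  sizes : length (B ++ [ N ]) + length L + 1 ≡ 2 + (i + j)
  sizes = begin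
    length (B ++ [ N ]) + length L + 1  ≡⟨ cong₂ (λ x y → x + y + 1) (trans (length-++ B) (cong (_+ 1) lenB)) (left c) ⟩
    j + 1 + i + 1                       ≡⟨ +-comm (j + 1 + i) 1 ⟩
    1 + (j + 1 + i)                     ≡⟨ cong (λ x → 1 + (x + i)) (+-comm j 1) ⟩
    2 + (j + i)                         ≡⟨ cong (2 +_) (+-comm j i) ⟩
    2 + (i + j)                         ∎
    where open ≡-Reasoning

-- Here the cut is at `a`, the maximum of `R`. An entry of `L` above `a` followed by one below `a`
-- would form 3142 with the overall maximum as the 4 and `a` as the 2. So the entries of `L` above
-- `a` come last.
removeTopLeft : ∀ {k i m L R r} → Conf k i m L R → 2 + i ≤ k → r ∈ R → m ∈ L →
  ∃₂ λ a j → ∃₂ λ σ L′ → m ≡ a + j × L ≡ L′ ++ map (a +_) σ × 1 ≤ j × i ≡ length L′ + j ×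
    Conf k (length L′) a L′ R × a ∈ R × Perm j σ × Separable σ
removeTopLeft {R = []} _ _ () _
removeTopLeft {k} {i} {m} {L} {R = x ∷ xs} c 2+i≤k _ m∈L with maximum∈ x xs
... | a , a∈R , R≤a with separate {P = _< a} {Q = a <_} L sides noDescent
  where
  sides : ∀ {r} → r ∈ L → r < a ⊎ a < r
  sides {r} r∈ with <-cmp a r
  ... | tri< p _ _ = inj₂ p
  ... | tri> _ _ p = inj₁ p
  ... | tri≈ _ refl _ = ⊥-elim (unique-disjoint L (distinct (perm-LR c)) r∈ a∈R)
  noDescent : ∀ {y z} → y ∷ z ∷ [] ⊆ L → a < y → z < a → ⊥
  noDescent τ a<y z<a = proj₂ (separable c) (SubP.++⁺ τ (refl ∷ from∈ a∈R)) z<a a<y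
    (s≤s (≤m c (∈-++⁺ˡ (∈-⊆ τ (here refl)))))
... | L′ , B , refl , L′<a , B>a with shiftView a B B>a
... | σ , refl , 1≤σ = a , m ∸ a , σ , L′ , sym (m+[n∸m]≡n a≤m) , refl , m<n⇒0<n∸m a<m , lenL ,
    conf refl (proj₁ parts)
      (separable-inflate L′ [ suc a ] R (suc m) L′≺sa (≤⇒≺[suc] R≤a)
        (λ p → ≤⇒≺[suc] (≤m c) (∈-++⁺ˡ (∈-++⁺ˡ p))) (λ p → ≤⇒≺[suc] (≤m c) (∈-++⁺ʳ (L′ ++ B) p))
        (separable-⊆ (SubP.++⁺ (SubP.++⁺ʳ B (⊆-refl {x = L′})) ⊆-refl) (separable c))
        (separable-short (suc a)))
      (proj₁ (avoidsP-inflate⁻ L′ (B ++ [ suc m ]) R (suc a)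
        (≤-trans (+-monoʳ-≤ 2 (≤-trans (m≤m+n _ (m ∸ a)) (≤-reflexive (sym lenL)))) 2+i≤k)
        (≺-∷ʳmax B (λ p → s≤s (≤m c (∈-++⁺ˡ (∈-++⁺ˡ p)))) (shift-≺ (<⇒≤ ∘ L′<a) pσ))
        (≺-∷ʳmax B (λ p → s≤s (≤m c (∈-++⁺ʳ (L′ ++ B) p))) (shift-≺ R≤a pσ))
        L′≺sa (≤⇒≺[suc] R≤a)
        (subst (AvoidsP k noneSeen) (sym (regroup L′ B (suc m) R)) (avoiding c)))) ,
    a∈R , pσ ,
    separable-shift⁻ a σ (separable-⊆ (SubP.++⁺ʳ (suc m ∷ R) (SubP.++⁺ˡ L′ ⊆-refl)) (separable c))
  where
  R = x ∷ xs
  a≤m : a ≤ m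
  a≤m = ≤m c (∈-++⁺ʳ (L′ ++ B) a∈R)
  a<m : a < m
  a<m with ∈-++⁻ L′ m∈L
  ... | inj₁ p = ⊥-elim (<⇒≱ (L′<a p) a≤m)
  ... | inj₂ p = B>a p
  L′≺sa : L′ ≺ [ suc a ]
  L′≺sa = ≤⇒≺[suc] (<⇒≤ ∘ L′<a)
  parts : Perm a (L′ ++ R) × Perm (m ∸ a) σ
  parts = perm-⊕⁻ (L′ ++ R) a≤m
    (λ p → case ∈-++⁻ L′ p of λ { (inj₁ q) → <⇒≤ (L′<a q) ; (inj₂ q) → R≤a q })
    1≤σ (perm-resp-↭ (↭-trans (↭-reflexive (++-assoc L′ B R)) (↭-swapʳ L′ B R)) (perm-LR c))
  pσ = proj₂ parts
  lenL : i ≡ length L′ + (m ∸ a)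
  lenL = trans (sym (left c)) (trans (length-++ L′) (cong (length L′ +_) (trans (length-map (a +_) σ) (size pσ))))

-- Statistics

-- `recordsAfter R π seen xs` is the local loop `go` of `records`, which cannot be named from
-- outside: the `with` generalises its arguments to variables, so that unification can find it.
mutual
  recordsAfter : (ℕ → ℕ → Bool) → List ℕ → List ℕ → List ℕ → ℕ
  recordsAfter = _

  records-∷ : ∀ R x xs → records R (x ∷ xs) ≡ suc (recordsAfter R (x ∷ xs) (x ∷ []) xs)
  records-∷ R x xs with x ∷ xs | (List ℕ ∋ x ∷ [])
  ... | π | seen = refl

-- The list of entries already seen is replaced by the test which a new record has to pass. Nothing
-- else about the past matters, and in this form the count splits over a concatenation.
recordsIf : (ℕ → ℕ → Bool) → (ℕ → Bool) → List ℕ → ℕ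
recordsIf R ok [] = 0
recordsIf R ok (x ∷ xs) = indicator (ok x) + recordsIf R (λ z → R x z ∧ ok z) xs

recordsAfter≡ : ∀ R π seen xs → recordsAfter R π seen xs ≡ recordsIf R (λ x → all (λ y → R y x) seen) xs
recordsAfter≡ R π seen [] = refl
recordsAfter≡ R π seen (x ∷ xs) = cong (indicator (all (λ y → R y x) seen) +_) (recordsAfter≡ R π (x ∷ seen) xs)

records≡ : ∀ R π → records R π ≡ recordsIf R (λ _ → true) π
records≡ R [] = refl
records≡ R (x ∷ xs) = trans (records-∷ R x xs) (cong suc (recordsAfter≡ R (x ∷ xs) (x ∷ []) xs))

recordsIf-cong : ∀ R {ok ok′} xs → (∀ {x} → x ∈ xs → ok x ≡ ok′ x) → recordsIf R ok xs ≡ recordsIf R ok′ xs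
recordsIf-cong R [] h = refl
recordsIf-cong R (x ∷ xs) h = cong₂ _+_ (cong indicator (h (here refl)))
  (recordsIf-cong R xs (λ {z} p → cong (R x z ∧_) (h (there p))))

recordsIf-false : ∀ R {ok} xs → (∀ {x} → x ∈ xs → ok x ≡ false) → recordsIf R ok xs ≡ 0
recordsIf-false R [] h = refl
recordsIf-false R (x ∷ xs) h rewrite h (here refl) =
  recordsIf-false R xs (λ {z} p → trans (cong (R x z ∧_) (h (there p))) (∧-zeroʳ (R x z)))

recordsIf-++ : ∀ R ok xs ys →
  recordsIf R ok (xs ++ ys) ≡ recordsIf R ok xs + recordsIf R (λ z → all (λ y → R y z) xs ∧ ok z) ys
recordsIf-++ R ok [] ys = refl
recordsIf-++ R ok (x ∷ xs) ys = trans
  (cong (indicator (ok x) +_) (trans (recordsIf-++ R _ xs ys)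
    (cong (recordsIf R _ xs +_) (recordsIf-cong R ys λ {z} _ →
      trans (sym (∧-assoc (all (λ y → R y z) xs) (R x z) (ok z)))
            (cong (_∧ ok z) (∧-comm (all (λ y → R y z) xs) (R x z)))))))
  (sym (+-assoc (indicator (ok x)) _ _))

all-true : ∀ (P : ℕ → Bool) xs → (∀ {x} → x ∈ xs → P x ≡ true) → all P xs ≡ true
all-true P [] h = refl
all-true P (x ∷ xs) h rewrite h (here refl) = all-true P xs (h ∘ there)

all-false : ∀ (P : ℕ → Bool) {x} xs → x ∈ xs → P x ≡ false → all P xs ≡ false
all-false P (x ∷ xs) (here refl) e rewrite e = refl
all-false P (x ∷ xs) (there p) e = trans (cong (P x ∧_) (all-false P xs p e)) (∧-zeroʳ (P x))

records-++-all : ∀ R xs ys → (∀ {x y} → x ∈ xs → y ∈ ys → R x y ≡ true) →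
  records R (xs ++ ys) ≡ records R xs + records R ys
records-++-all R xs ys h = trans (records≡ R (xs ++ ys)) (trans (recordsIf-++ R _ xs ys)
  (cong₂ _+_ (sym (records≡ R xs)) (trans
    (recordsIf-cong R ys (λ {z} q → trans (∧-identityʳ _) (all-true (λ y → R y z) xs (λ p → h p q))))
    (sym (records≡ R ys)))))

records-++-none : ∀ R xs ys → (∀ {y} → y ∈ ys → ∃ λ x → x ∈ xs × R x y ≡ false) →
  records R (xs ++ ys) ≡ records R xs
records-++-none R xs ys h = trans (records≡ R (xs ++ ys)) (trans (recordsIf-++ R _ xs ys)
  (trans (cong₂ _+_ (sym (records≡ R xs)) (recordsIf-false R ys (λ {z} q → let x , p , e = h q in
    trans (∧-identityʳ _) (all-false (λ y → R y z) xs p e)))) (+-identityʳ _)))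

-- The entry `x` keeps every entry of `ms` from being a record, and whatever later beats `x` also
-- beats all of `ms`, so the middle part is invisible. It is used for minima, where any entry of `L`
-- (or of `R`, read from the right) hides the block.
records-middle : ∀ R {x} xs ms ys → x ∈ xs → (∀ {m} → m ∈ ms → R x m ≡ false) →
  (∀ {m z} → m ∈ ms → R x z ≡ true → R m z ≡ true) →
  records R (xs ++ ms ++ ys) ≡ records R (xs ++ ys)
records-middle R {x} xs ms ys x∈ blocked dominated = begin
  records R (xs ++ ms ++ ys)                    ≡⟨ records≡ R (xs ++ ms ++ ys) ⟩
  recordsIf R _ (xs ++ ms ++ ys)                ≡⟨ recordsIf-++ R _ xs (ms ++ ys) ⟩
  old + recordsIf R ok (ms ++ ys)                 ≡⟨ cong (old +_) (recordsIf-++ R ok ms ys) ⟩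
  old + (recordsIf R ok ms + recordsIf R ok′ ys)  ≡⟨ cong (λ n → old + (n + recordsIf R ok′ ys)) (recordsIf-false R ms skipped) ⟩
  old + recordsIf R ok′ ys                        ≡⟨ cong (old +_) (recordsIf-cong R ys (λ {z} _ → absorb z)) ⟩
  old + recordsIf R ok ys                         ≡⟨ sym (recordsIf-++ R _ xs ys) ⟩
  recordsIf R _ (xs ++ ys)                      ≡⟨ sym (records≡ R (xs ++ ys)) ⟩
  records R (xs ++ ys)                          ∎
  where
  open ≡-Reasoning
  old = recordsIf R (λ _ → true) xs
  ok ok′ : ℕ → Bool
  ok z = all (λ y → R y z) xs ∧ true
  ok′ z = all (λ y → R y z) ms ∧ ok z
  skipped : ∀ {m} → m ∈ ms → ok m ≡ false
  skipped {m} p = trans (∧-identityʳ _) (all-false (λ y → R y m) xs x∈ (blocked p))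
  absorb : ∀ z → ok′ z ≡ ok z
  absorb z with R x z in e
  ... | true = cong (_∧ ok z) (all-true (λ y → R y z) ms (λ p → dominated p e))
  ... | false rewrite all-false (λ y → R y z) xs x∈ e = ∧-zeroʳ _

asc-++-up : ∀ x xs y ys → (∀ {z} → z ∈ x ∷ xs → z < y) →
  asc ((x ∷ xs) ++ y ∷ ys) ≡ asc (x ∷ xs) + suc (asc (y ∷ ys))
asc-++-up x [] y ys h rewrite <ᵇ-true (h (here refl)) = refl
asc-++-up x (x′ ∷ xs) y ys h = trans (cong (indicator (x <ᵇ x′) +_) (asc-++-up x′ xs y ys (h ∘ there)))
  (sym (+-assoc (indicator (x <ᵇ x′)) _ _))

asc-++-down : ∀ x xs y ys → (∀ {z} → z ∈ x ∷ xs → y < z) →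
  asc ((x ∷ xs) ++ y ∷ ys) ≡ asc (x ∷ xs) + asc (y ∷ ys)
asc-++-down x [] y ys h rewrite <ᵇ-false (<⇒≤ (h (here refl))) = refl
asc-++-down x (x′ ∷ xs) y ys h = trans (cong (indicator (x <ᵇ x′) +_) (asc-++-down x′ xs y ys (h ∘ there)))
  (sym (+-assoc (indicator (x <ᵇ x′)) _ _))

des-++-up : ∀ x xs y ys → (∀ {z} → z ∈ x ∷ xs → z < y) →
  des ((x ∷ xs) ++ y ∷ ys) ≡ des (x ∷ xs) + des (y ∷ ys)
des-++-up x [] y ys h rewrite <ᵇ-false (<⇒≤ (h (here refl))) = refl
des-++-up x (x′ ∷ xs) y ys h = trans (cong (indicator (x′ <ᵇ x) +_) (des-++-up x′ xs y ys (h ∘ there)))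
  (sym (+-assoc (indicator (x′ <ᵇ x)) _ _))

des-++-down : ∀ x xs y ys → (∀ {z} → z ∈ x ∷ xs → y < z) →
  des ((x ∷ xs) ++ y ∷ ys) ≡ des (x ∷ xs) + suc (des (y ∷ ys))
des-++-down x [] y ys h rewrite <ᵇ-true (h (here refl)) = refl
des-++-down x (x′ ∷ xs) y ys h = trans (cong (indicator (x′ <ᵇ x) +_) (des-++-down x′ xs y ys (h ∘ there)))
  (sym (+-assoc (indicator (x′ <ᵇ x)) _ _))

record Stats : Set where
  constructor stats
  field ascents descents lrmaxima rlmaxima lrminima rlminima : ℕ

statsOf : List ℕ → Stats
statsOf π = stats (asc π) (des π) (lrmax π) (rlmax π) (lrmin π) (rlmin π)

stats≡ : ∀ {a b c d e f a′ b′ c′ d′ e′ f′} → a ≡ a′ → b ≡ b′ → c ≡ c′ → d ≡ d′ → e ≡ e′ → f ≡ f′ →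
  stats a b c d e f ≡ stats a′ b′ c′ d′ e′ f′
stats≡ refl refl refl refl refl refl = refl

rev⁻ : ∀ {x : ℕ} {xs} → x ∈ reverse xs → x ∈ xs
rev⁻ = AnyP.reverse⁻

rev⁺ : ∀ {x : ℕ} {xs} → x ∈ xs → x ∈ reverse xs
rev⁺ = AnyP.reverse⁺

statsOf-⊕ : ∀ {x y} xs ys → let X = x ∷ xs ; Y = y ∷ ys in X ≺ Y → statsOf (X ++ Y) ≡
  stats (asc X + suc (asc Y)) (des X + des Y) (lrmax X + lrmax Y) (rlmax Y) (lrmin X) (rlmin Y + rlmin X)
statsOf-⊕ {x} {y} xs ys X≺Y = stats≡
  (asc-++-up x xs y ys (λ p → X≺Y p (here refl)))
  (des-++-up x xs y ys (λ p → X≺Y p (here refl)))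
  (records-++-all _ X Y (λ p q → <ᵇ-true (X≺Y p q)))
  (trans (cong lrmax (reverse-++ X Y)) (records-++-none _ (reverse Y) (reverse X)
    λ p → y , rev⁺ {xs = Y} (here refl) , <ᵇ-false (<⇒≤ (X≺Y (rev⁻ p) (here refl)))))
  (records-++-none _ X Y λ p → x , here refl , <ᵇ-false (<⇒≤ (X≺Y (here refl) p)))
  (trans (cong lrmin (reverse-++ X Y)) (records-++-all _ (reverse Y) (reverse X)
    (λ p q → <ᵇ-true (X≺Y (rev⁻ q) (rev⁻ p)))))
  where
  X = x ∷ xs
  Y = y ∷ ys

statsOf-⊖ : ∀ {x y} xs ys → let X = x ∷ xs ; Y = y ∷ ys in Y ≺ X → statsOf (X ++ Y) ≡
  stats (asc X + asc Y) (des X + suc (des Y)) (lrmax X) (rlmax Y + rlmax X) (lrmin X + lrmin Y) (rlmin Y)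
statsOf-⊖ {x} {y} xs ys Y≺X = stats≡
  (asc-++-down x xs y ys (λ p → Y≺X (here refl) p))
  (des-++-down x xs y ys (λ p → Y≺X (here refl) p))
  (records-++-none _ X Y λ p → x , here refl , <ᵇ-false (<⇒≤ (Y≺X p (here refl))))
  (trans (cong lrmax (reverse-++ X Y)) (records-++-all _ (reverse Y) (reverse X)
    (λ p q → <ᵇ-true (Y≺X (rev⁻ p) (rev⁻ q)))))
  (records-++-all _ X Y (λ p q → <ᵇ-true (Y≺X q p)))
  (trans (cong lrmin (reverse-++ X Y)) (records-++-none _ (reverse Y) (reverse X)
    λ p → y , rev⁺ {xs = Y} (here refl) , <ᵇ-false (<⇒≤ (Y≺X (here refl) (rev⁻ p)))))
  where
  X = x ∷ xs
  Y = y ∷ ys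

-- The point is the separation: `M` enters only through its ascents, descents and maxima, because
-- its minima are hidden by `L` from the left and by `R` from the right. Two choices of `M` can then
-- be compared.
statsOf-inflate : ∀ {l m r} ls ms rs → let L = l ∷ ls ; M = m ∷ ms ; R = r ∷ rs in L ≺ M → R ≺ M →
  statsOf (L ++ M ++ R) ≡
  stats (asc L + suc (asc M + asc R)) (des L + (des M + suc (des R))) (lrmax L + lrmax M) (rlmax R + rlmax M)
    (lrmin (L ++ R)) (rlmin (L ++ R))
statsOf-inflate {l} {m} {r} ls ms rs L≺M R≺M = stats≡
  (trans (asc-++-up l ls m (ms ++ R) (λ p → L≺M p (here refl)))
    (cong (λ n → asc L + suc n) (asc-++-down m ms r rs (λ p → R≺M (here refl) p))))
  (trans (des-++-up l ls m (ms ++ R) (λ p → L≺M p (here refl)))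
    (cong (des L +_) (des-++-down m ms r rs (λ p → R≺M (here refl) p))))
  (trans (cong lrmax (sym (++-assoc L M R)))
    (trans (records-++-none _ (L ++ M) R
        λ p → m , ∈-++⁺ʳ L (here refl) , <ᵇ-false (<⇒≤ (R≺M p (here refl))))
      (records-++-all _ L M (λ p q → <ᵇ-true (L≺M p q)))))
  (trans (cong lrmax rev)
    (trans (cong lrmax (sym (++-assoc (reverse R) (reverse M) (reverse L))))
    (trans (records-++-none _ (reverse R ++ reverse M) (reverse L)
        λ p → m , ∈-++⁺ʳ (reverse R) (rev⁺ {xs = M} (here refl)) , <ᵇ-false (<⇒≤ (L≺M (rev⁻ p) (here refl))))
      (records-++-all _ (reverse R) (reverse M) (λ p q → <ᵇ-true (R≺M (rev⁻ p) (rev⁻ q)))))))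
  (records-middle _ L M R (here refl) (λ p → <ᵇ-false (<⇒≤ (L≺M (here refl) p)))
    (λ {_} {z} p e → <ᵇ-true (<-trans (<ᵇ⇒< z l (Equivalence.from T-≡ e)) (L≺M (here refl) p))))
  (trans (cong lrmin rev) (trans
    (records-middle _ (reverse R) (reverse M) (reverse L) (rev⁺ {xs = R} (here refl))
      (λ p → <ᵇ-false (<⇒≤ (R≺M (here refl) (rev⁻ p))))
      (λ {_} {z} p e → <ᵇ-true (<-trans (<ᵇ⇒< z r (Equivalence.from T-≡ e)) (R≺M (here refl) (rev⁻ p)))))
    (cong lrmin (sym (reverse-++ L R)))))
  where
  L = l ∷ ls
  M = m ∷ ms
  R = r ∷ rs
  rev : reverse (L ++ M ++ R) ≡ reverse R ++ reverse M ++ reverse L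
  rev = trans (reverse-++ L (M ++ R)) (trans (cong (_++ reverse L) (reverse-++ M R))
    (++-assoc (reverse R) (reverse M) (reverse L)))

asc-shift : ∀ c σ → asc (map (c +_) σ) ≡ asc σ
asc-shift c [] = refl
asc-shift c (x ∷ []) = refl
asc-shift c (x ∷ y ∷ σ) = cong₂ _+_ (cong indicator (<ᵇ-shift c x y)) (asc-shift c (y ∷ σ))

des-shift : ∀ c σ → des (map (c +_) σ) ≡ des σ
des-shift c [] = refl
des-shift c (x ∷ []) = refl
des-shift c (x ∷ y ∷ σ) = cong₂ _+_ (cong indicator (<ᵇ-shift c y x)) (des-shift c (y ∷ σ))

recordsIf-shift : ∀ R c {ok ok′} σ → (∀ x y → R (c + x) (c + y) ≡ R x y) → (∀ x → ok′ (c + x) ≡ ok x) →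
  recordsIf R ok′ (map (c +_) σ) ≡ recordsIf R ok σ
recordsIf-shift R c [] hR h = refl
recordsIf-shift R c (x ∷ σ) hR h = cong₂ _+_ (cong indicator (h x))
  (recordsIf-shift R c σ hR (λ z → cong₂ _∧_ (hR x z) (h z)))

records-shift : ∀ R c σ → (∀ x y → R (c + x) (c + y) ≡ R x y) → records R (map (c +_) σ) ≡ records R σ
records-shift R c σ hR = trans (records≡ R (map (c +_) σ))
  (trans (recordsIf-shift R c σ hR (λ _ → refl)) (sym (records≡ R σ)))

statsOf-shift : ∀ c σ → statsOf (map (c +_) σ) ≡ statsOf σ
statsOf-shift c σ = stats≡ (asc-shift c σ) (des-shift c σ)
  (lrmax-shift σ)
  (trans (cong lrmax (sym (reverse-map (c +_) σ))) (lrmax-shift (reverse σ)))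
  (lrmin-shift σ)
  (trans (cong lrmin (sym (reverse-map (c +_) σ))) (lrmin-shift (reverse σ)))
  where
  lrmax-shift : ∀ τ → lrmax (map (c +_) τ) ≡ lrmax τ
  lrmax-shift τ = records-shift _ c τ (<ᵇ-shift c)
  lrmin-shift : ∀ τ → lrmin (map (c +_) τ) ≡ lrmin τ
  lrmin-shift τ = records-shift _ c τ (λ x y → <ᵇ-shift c y x)

-- Sums over lists

unique-map-on : ∀ {A B : Set} (φ : A → B) {xs} → (∀ {x y} → x ∈ xs → y ∈ xs → φ x ≡ φ y → x ≡ y) →
  Unique xs → Unique (map φ xs)
unique-map-on φ inj [] = []
unique-map-on φ {x ∷ xs} inj (h ∷ u) =
  All.tabulate (λ p e → case ∈-map⁻ φ p of λ
    { (y , y∈ , refl) → All.lookup h y∈ (inj (here refl) (there y∈) e) })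
  ∷ unique-map-on φ (λ p q → inj (there p) (there q)) u

module _ {A B : Set} where

  pairs : List A → (A → List B) → List (A × B)
  pairs as h = concatMap (λ a → map (a ,_) (h a)) as

  ∈-pairs⁺ : ∀ {as h a b} → a ∈ as → b ∈ h a → (a , b) ∈ pairs as h
  ∈-pairs⁺ {h = h} p q = ∈-concatMap⁺ (λ a → map (a ,_) (h a)) (Any.map (λ { refl → ∈-map⁺ (_ ,_) q }) p)

  ∈-pairs⁻ : ∀ as h {a b} → (a , b) ∈ pairs as h → a ∈ as × b ∈ h a
  ∈-pairs⁻ as h i with find (∈-concatMap⁻ (λ a → map (a ,_) (h a)) {xs = as} i)
  ... | a , p , j with ∈-map⁻ (a ,_) j
  ... | b , q , refl = p , q

  unique-pairs : ∀ {as h} → Unique as → (∀ a → Unique (h a)) → Unique (pairs as h)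
  unique-pairs {h = h} u v = unique-concatMap _,_ (λ { refl → refl , refl }) h v u

module Sums {c ℓ : Level} (𝓡 : CommutativeRing c ℓ) where
  module K = CommutativeRing 𝓡
  open CommutativeRing 𝓡 using (Carrier; _≈_; 0#) renaming (_+_ to infixl 6 _⊹_; _*_ to infixl 7 _∙_)
  open GF 𝓡 using (sumR)
  import Relation.Binary.Reasoning.Setoid K.setoid as ≈-Reasoning

  ∑ : {A : Set} → List A → (A → Carrier) → Carrier
  ∑ xs h = sumR (map h xs)

  module _ {A : Set} where

    ∑-cong : ∀ (xs : List A) {h h′} → (∀ {x} → x ∈ xs → h x ≈ h′ x) → ∑ xs h ≈ ∑ xs h′
    ∑-cong [] e = K.refl
    ∑-cong (x ∷ xs) e = K.+-cong (e (here refl)) (∑-cong xs (e ∘ there))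

    ∑-++ : ∀ (xs ys : List A) h → ∑ (xs ++ ys) h ≈ ∑ xs h ⊹ ∑ ys h
    ∑-++ [] ys h = K.sym (K.+-identityˡ _)
    ∑-++ (x ∷ xs) ys h = K.trans (K.+-congˡ (∑-++ xs ys h)) (K.sym (K.+-assoc _ _ _))

    ∑-*ˡ : ∀ a (xs : List A) h → a ∙ ∑ xs h ≈ ∑ xs (λ x → a ∙ h x)
    ∑-*ˡ a [] h = K.zeroʳ a
    ∑-*ˡ a (x ∷ xs) h = K.trans (K.distribˡ a _ _) (K.+-congˡ (∑-*ˡ a xs h))

    ∑-*ʳ : ∀ a (xs : List A) h → ∑ xs h ∙ a ≈ ∑ xs (λ x → h x ∙ a)
    ∑-*ʳ a [] h = K.zeroˡ a
    ∑-*ʳ a (x ∷ xs) h = K.trans (K.distribʳ a _ _) (K.+-congˡ (∑-*ʳ a xs h))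

    ∑-0 : ∀ (xs : List A) → ∑ xs (λ _ → 0#) ≈ 0#
    ∑-0 [] = K.refl
    ∑-0 (x ∷ xs) = K.trans (K.+-identityˡ _) (∑-0 xs)

    ∑-+ : ∀ (xs : List A) h h′ → ∑ xs (λ x → h x ⊹ h′ x) ≈ ∑ xs h ⊹ ∑ xs h′
    ∑-+ [] h h′ = K.sym (K.+-identityˡ _)
    ∑-+ (x ∷ xs) h h′ = begin
      (h x ⊹ h′ x) ⊹ ∑ xs (λ x → h x ⊹ h′ x)  ≈⟨ K.+-congˡ (∑-+ xs h h′) ⟩
      (h x ⊹ h′ x) ⊹ (∑ xs h ⊹ ∑ xs h′)       ≈⟨ K.+-assoc _ _ _ ⟩
      h x ⊹ (h′ x ⊹ (∑ xs h ⊹ ∑ xs h′))       ≈⟨ K.+-congˡ (K.sym (K.+-assoc _ _ _)) ⟩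
      h x ⊹ ((h′ x ⊹ ∑ xs h) ⊹ ∑ xs h′)       ≈⟨ K.+-congˡ (K.+-congʳ (K.+-comm _ _)) ⟩
      h x ⊹ ((∑ xs h ⊹ h′ x) ⊹ ∑ xs h′)       ≈⟨ K.+-congˡ (K.+-assoc _ _ _) ⟩
      h x ⊹ (∑ xs h ⊹ (h′ x ⊹ ∑ xs h′))       ≈⟨ K.+-assoc _ _ _ ⟨
      (h x ⊹ ∑ xs h) ⊹ (h′ x ⊹ ∑ xs h′)       ∎
      where open ≈-Reasoning

    ∑-↭ : ∀ {xs ys : List A} h → xs ↭ ys → ∑ xs h ≈ ∑ ys h
    ∑-↭ h ↭.refl = K.refl
    ∑-↭ h (prep x p) = K.+-congˡ (∑-↭ h p)
    ∑-↭ h (swap x y p) = K.trans (K.sym (K.+-assoc _ _ _))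
      (K.trans (K.+-cong (K.+-comm _ _) (∑-↭ h p)) (K.+-assoc _ _ _))
    ∑-↭ h (↭.trans p q) = K.trans (∑-↭ h p) (∑-↭ h q)

  ∑-map : ∀ {A B : Set} (φ : B → A) ys h → ∑ (map φ ys) h ≡ ∑ ys (h ∘ φ)
  ∑-map φ ys h = cong sumR (sym (map-∘ ys))

  module _ {A B : Set} where

    ∑-swap : ∀ (xs : List A) (ys : List B) (h : A → B → Carrier) →
      ∑ xs (λ x → ∑ ys (λ y → h x y)) ≈ ∑ ys (λ y → ∑ xs (λ x → h x y))
    ∑-swap [] ys h = K.sym (∑-0 ys)
    ∑-swap (x ∷ xs) ys h = K.trans (K.+-congˡ (∑-swap xs ys h)) (K.sym (∑-+ ys _ _))

    ∑-product : ∀ (xs : List A) (ys : List B) a b →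
      ∑ xs (λ x → ∑ ys (λ y → a x ∙ b y)) ≈ ∑ xs a ∙ ∑ ys b
    ∑-product xs ys a b = K.trans (∑-cong xs λ {x} _ → K.sym (∑-*ˡ (a x) ys b)) (K.sym (∑-*ʳ _ xs a))

    -- Two duplicate-free lists with the same members are permutations of each other. Injectivity is
    -- asked for on `ys` only, since the insertion maps are not injective on arbitrary lists.
    ∑-bijection : ∀ {xs : List A} {ys : List B} h (φ : B → A) → Unique xs → Unique ys →
      (∀ {y} → y ∈ ys → φ y ∈ xs) →
      (∀ {y z} → y ∈ ys → z ∈ ys → φ y ≡ φ z → y ≡ z) →
      (∀ {x} → x ∈ xs → ∃ λ y → y ∈ ys × x ≡ φ y) →
      ∑ xs h ≈ ∑ ys (h ∘ φ)
    ∑-bijection {xs} {ys} h φ ux uy into inj onto =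
      K.trans (∑-↭ h (∼bag⇒↭ (unique∧set⇒bag ux (unique-map-on φ inj uy) (mk⇔ to from)))) (K.reflexive (∑-map φ ys h))
      where
      to : ∀ {x} → x ∈ xs → x ∈ map φ ys
      to p with onto p
      ... | y , q , refl = ∈-map⁺ φ q
      from : ∀ {x} → x ∈ map φ ys → x ∈ xs
      from p with ∈-map⁻ φ p
      ... | y , q , refl = into q

    ∑-pairs : ∀ as (h : A → List B) k → ∑ (pairs as h) k ≈ ∑ as (λ a → ∑ (h a) (λ b → k (a , b)))
    ∑-pairs [] h k = K.refl
    ∑-pairs (a ∷ as) h k = K.trans (∑-++ (map (a ,_) (h a)) (pairs as h) k)
      (K.+-cong (K.reflexive (∑-map (a ,_) (h a) k)) (∑-pairs as h k))

  -- The common shape of both peelings: `j` is the size of the block, `σ` the block and `ρ` the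
  -- remainder. Their ranges depend on `j` alone, so that the inner sums can factor.
  ∑-triples : ∀ {xs : List (List ℕ)} {js : List ℕ} (S T : ℕ → List (List ℕ)) h
    (φ : ℕ → List ℕ → List ℕ → List ℕ) →
    Unique xs → Unique js → (∀ j → Unique (S j)) → (∀ j → Unique (T j)) →
    (∀ {j σ ρ} → j ∈ js → σ ∈ S j → ρ ∈ T j → φ j σ ρ ∈ xs) →
    (∀ {j σ ρ j′ σ′ ρ′} → j ∈ js → σ ∈ S j → ρ ∈ T j → j′ ∈ js → σ′ ∈ S j′ → ρ′ ∈ T j′ →
      φ j σ ρ ≡ φ j′ σ′ ρ′ → j ≡ j′ × σ ≡ σ′ × ρ ≡ ρ′) →
    (∀ {x} → x ∈ xs → ∃ λ j → ∃₂ λ σ ρ → j ∈ js × σ ∈ S j × ρ ∈ T j × x ≡ φ j σ ρ) →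
    ∑ xs h ≈ ∑ js (λ j → ∑ (S j) (λ σ → ∑ (T j) (λ ρ → h (φ j σ ρ))))
  ∑-triples {xs} {js} S T h φ ux uj uS uT into inj onto = K.trans
    (∑-bijection h (λ (j , σ , ρ) → φ j σ ρ) ux (unique-pairs uj (λ j → unique-pairs (uS j) (λ _ → uT j)))
      (λ {(j , σ , ρ)} p → let j∈ , q = ∈-pairs⁻ js _ p ; σ∈ , ρ∈ = ∈-pairs⁻ (S j) _ q in into j∈ σ∈ ρ∈)
      injective
      λ p → let j , σ , ρ , j∈ , σ∈ , ρ∈ , e = onto p in (j , σ , ρ) , ∈-pairs⁺ j∈ (∈-pairs⁺ σ∈ ρ∈) , e)
    (K.trans (∑-pairs js (λ j → pairs (S j) (λ _ → T j)) _)
      (∑-cong js λ {j} _ → ∑-pairs (S j) (λ _ → T j) (λ (σ , ρ) → h (φ j σ ρ))))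
    where
    injective : ∀ {y z} → y ∈ pairs js (λ j → pairs (S j) (λ _ → T j)) →
      z ∈ pairs js (λ j → pairs (S j) (λ _ → T j)) →
      φ (proj₁ y) (proj₁ (proj₂ y)) (proj₂ (proj₂ y)) ≡ φ (proj₁ z) (proj₁ (proj₂ z)) (proj₂ (proj₂ z)) → y ≡ z
    injective {j , σ , ρ} {j′ , σ′ , ρ′} p p′ e with ∈-pairs⁻ js _ p | ∈-pairs⁻ js _ p′
    ... | j∈ , q | j∈′ , q′ with ∈-pairs⁻ (S j) _ q | ∈-pairs⁻ (S j′) _ q′
    ... | σ∈ , ρ∈ | σ∈′ , ρ∈′ with inj j∈ σ∈ ρ∈ j∈′ σ∈′ ρ∈′ e
    ... | refl , refl , refl = refl

-- Weights

module Weights {c ℓ : Level} (𝓡 : CommutativeRing c ℓ) where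
  open Sums 𝓡
  open CommutativeRing 𝓡 using (Carrier; _≈_; 1#) renaming (_*_ to infixl 7 _∙_)
  open GF 𝓡
  open import Algebra.Solver.CommutativeMonoid K.*-commutativeMonoid using (solve; _⊜_) renaming (_⊕_ to infixl 7 _⊗_; id to ı)

  pow-+ : ∀ a m n → pow a (m + n) ≈ pow a m ∙ pow a n
  pow-+ a zero n = K.sym (K.*-identityˡ _)
  pow-+ a (suc m) n = K.trans (K.*-congˡ (pow-+ a m n)) (K.sym (K.*-assoc _ _ _))

  pow-1 : ∀ n → pow 1# n ≈ 1#
  pow-1 zero = K.refl
  pow-1 (suc n) = K.trans (K.*-identityˡ _) (pow-1 n)

  monomial : (p q u v s t : Carrier) → Stats → Carrier
  monomial p q u v s t (stats a b c d e f) =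
    pow p a ∙ pow q b ∙ pow u c ∙ pow v d ∙ pow s e ∙ pow t f

  *-cong₆ : ∀ {a b c d e f a′ b′ c′ d′ e′ f′} → a ≈ a′ → b ≈ b′ → c ≈ c′ → d ≈ d′ → e ≈ e′ → f ≈ f′ →
    a ∙ b ∙ c ∙ d ∙ e ∙ f ≈ a′ ∙ b′ ∙ c′ ∙ d′ ∙ e′ ∙ f′
  *-cong₆ a b c d e f = K.*-cong (K.*-cong (K.*-cong (K.*-cong (K.*-cong a b) c) d) e) f

  module _ (p q : Carrier) where

    -- The ascent at the junction gives the factor `p`. A statistic to which a block contributes
    -- nothing has its variable set to 1 in the weight of that block; this is where the substituted
    -- ones of the recurrences come from.
    w-⊕ : ∀ u v s t {x y} xs ys → x ∷ xs ≺ y ∷ ys → w p q u v s t ((x ∷ xs) ++ y ∷ ys) ≈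
      p ∙ (w p q u 1# s t (x ∷ xs) ∙ w p q u v 1# t (y ∷ ys))
    w-⊕ u v s t {x} {y} xs ys X≺Y = K.trans
      (K.reflexive (cong (monomial p q u v s t) (statsOf-⊕ xs ys X≺Y)))
      (K.trans (*-cong₆ (pow-+ p (asc xs⁺) _) (pow-+ q (des xs⁺) _) (pow-+ u (lrmax xs⁺) _) K.refl K.refl (pow-+ t (rlmin ys⁺) _))
      (K.trans (solve 11 (λ p a a′ b b′ c c′ d′ e f f′ →
          (a ⊗ (p ⊗ a′)) ⊗ (b ⊗ b′) ⊗ (c ⊗ c′) ⊗ d′ ⊗ e ⊗ (f′ ⊗ f) ⊜
          p ⊗ ((a ⊗ b ⊗ c ⊗ ı ⊗ e ⊗ f) ⊗ (a′ ⊗ b′ ⊗ c′ ⊗ d′ ⊗ ı ⊗ f′))) K.refl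
        p (pow p (asc xs⁺)) (pow p (asc ys⁺)) (pow q (des xs⁺)) (pow q (des ys⁺)) (pow u (lrmax xs⁺)) (pow u (lrmax ys⁺))
        (pow v (rlmax ys⁺)) (pow s (lrmin xs⁺)) (pow t (rlmin xs⁺)) (pow t (rlmin ys⁺)))
      (K.*-congˡ (K.*-cong (*-cong₆ K.refl K.refl K.refl (K.sym (pow-1 (rlmax xs⁺))) K.refl K.refl)
                           (*-cong₆ K.refl K.refl K.refl K.refl (K.sym (pow-1 (lrmin ys⁺))) K.refl)))))
      where
      xs⁺ = x ∷ xs
      ys⁺ = y ∷ ys

    w-⊖ : ∀ u v s t {x y} xs ys → y ∷ ys ≺ x ∷ xs → w p q u v s t ((x ∷ xs) ++ y ∷ ys) ≈
      q ∙ (w p q u v s 1# (x ∷ xs) ∙ w p q 1# v s t (y ∷ ys))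
    w-⊖ u v s t {x} {y} xs ys Y≺X = K.trans
      (K.reflexive (cong (monomial p q u v s t) (statsOf-⊖ xs ys Y≺X)))
      (K.trans (*-cong₆ (pow-+ p (asc xs⁺) _) (pow-+ q (des xs⁺) _) K.refl (pow-+ v (rlmax ys⁺) _) (pow-+ s (lrmin xs⁺) _) K.refl)
      (K.trans (solve 11 (λ q a a′ b b′ c d d′ e e′ f′ →
          (a ⊗ a′) ⊗ (b ⊗ (q ⊗ b′)) ⊗ c ⊗ (d′ ⊗ d) ⊗ (e ⊗ e′) ⊗ f′ ⊜
          q ⊗ ((a ⊗ b ⊗ c ⊗ d ⊗ e ⊗ ı) ⊗ (a′ ⊗ b′ ⊗ ı ⊗ d′ ⊗ e′ ⊗ f′))) K.refl
        q (pow p (asc xs⁺)) (pow p (asc ys⁺)) (pow q (des xs⁺)) (pow q (des ys⁺)) (pow u (lrmax xs⁺))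
        (pow v (rlmax xs⁺)) (pow v (rlmax ys⁺)) (pow s (lrmin xs⁺)) (pow s (lrmin ys⁺)) (pow t (rlmin ys⁺)))
      (K.*-congˡ (K.*-cong (*-cong₆ K.refl K.refl K.refl K.refl K.refl (K.sym (pow-1 (rlmin xs⁺))))
                           (*-cong₆ K.refl K.refl (K.sym (pow-1 (lrmax ys⁺))) K.refl K.refl K.refl)))))
      where
      xs⁺ = x ∷ xs
      ys⁺ = y ∷ ys

    w-singleton : ∀ u v s t z → w p q u v s t [ z ] ≈ u ∙ v ∙ s ∙ t
    w-singleton u v s t z = solve 4 (λ u v s t →
      ı ⊗ ı ⊗ (u ⊗ ı) ⊗ (v ⊗ ı) ⊗ (s ⊗ ı) ⊗ (t ⊗ ı) ⊜ u ⊗ v ⊗ s ⊗ t) K.refl u v s t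

    -- What the weight of `L ++ M ++ R` keeps of `L` and `R`, including the ascent and the descent
    -- at the two ends of `M`.
    frame : (u v s t : Carrier) → List ℕ → List ℕ → Carrier
    frame u v s t L R = monomial p q u v s t
      (stats (asc L + suc (asc R)) (des L + suc (des R)) (lrmax L) (rlmax R) (lrmin (L ++ R)) (rlmin (L ++ R)))

    w-inflate : ∀ u v s t {l m r} ls ms rs → l ∷ ls ≺ m ∷ ms → r ∷ rs ≺ m ∷ ms →
      w p q u v s t ((l ∷ ls) ++ (m ∷ ms) ++ r ∷ rs) ≈ w p q u v 1# 1# (m ∷ ms) ∙ frame u v s t (l ∷ ls) (r ∷ rs)
    w-inflate u v s t {l} {m} {r} ls ms rs L≺M R≺M = K.trans
      (K.reflexive (cong (monomial p q u v s t) (statsOf-inflate ls ms rs L≺M R≺M)))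
      (K.trans (*-cong₆ (K.trans (pow-+ p (asc L) _) (K.*-congˡ (K.*-congˡ (pow-+ p (asc M) _))))
                        (K.trans (pow-+ q (des L) _) (K.*-congˡ (pow-+ q (des M) _)))
                        (pow-+ u (lrmax L) _) (pow-+ v (rlmax R) _) K.refl K.refl)
      (K.trans (solve 14 (λ p q a a′ a″ b b′ b″ c c′ d d′ e f →
          (a ⊗ (p ⊗ (a′ ⊗ a″))) ⊗ (b ⊗ (b′ ⊗ (q ⊗ b″))) ⊗ (c ⊗ c′) ⊗ (d ⊗ d′) ⊗ e ⊗ f ⊜
          (a′ ⊗ b′ ⊗ c′ ⊗ d′ ⊗ ı ⊗ ı) ⊗ ((a ⊗ (p ⊗ a″)) ⊗ (b ⊗ (q ⊗ b″)) ⊗ c ⊗ d ⊗ e ⊗ f)) K.refl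
        p q (pow p (asc L)) (pow p (asc M)) (pow p (asc R)) (pow q (des L)) (pow q (des M)) (pow q (des R))
        (pow u (lrmax L)) (pow u (lrmax M)) (pow v (rlmax R)) (pow v (rlmax M))
        (pow s (lrmin (L ++ R))) (pow t (rlmin (L ++ R))))
      (K.*-cong (*-cong₆ K.refl K.refl K.refl K.refl (K.sym (pow-1 (lrmin M))) (K.sym (pow-1 (rlmin M))))
                (*-cong₆ (K.sym (pow-+ p (asc L) _)) (K.sym (pow-+ q (des L) _)) K.refl K.refl K.refl K.refl))))
      where
      L = l ∷ ls
      M = m ∷ ms
      R = r ∷ rs

    w-shift : ∀ u v s t a σ → w p q u v s t (map (a +_) σ) ≈ w p q u v s t σ
    w-shift u v s t a σ = K.reflexive (cong (monomial p q u v s t) (statsOf-shift a σ))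

    w-∷max : ∀ u v s t {N b} bs → b ∷ bs ≺ [ N ] →
      w p q u v s t (N ∷ b ∷ bs) ≈ q ∙ u ∙ v ∙ s ∙ w p q 1# v s t (b ∷ bs)
    w-∷max u v s t {N} bs B≺N = K.trans (w-⊖ u v s t [] bs B≺N) (K.trans
      (K.*-congˡ (K.*-congʳ (w-singleton u v s 1# N)))
      (solve 5 (λ q u v s x → q ⊗ ((u ⊗ v ⊗ s ⊗ ı) ⊗ x) ⊜ q ⊗ u ⊗ v ⊗ s ⊗ x) K.refl q u v s _))

    w-∷ʳmax : ∀ u v s t {N b} bs → b ∷ bs ≺ [ N ] →
      w p q u v s t ((b ∷ bs) ++ [ N ]) ≈ p ∙ u ∙ v ∙ t ∙ w p q u 1# s t (b ∷ bs)
    w-∷ʳmax u v s t {N} bs B≺N = K.trans (w-⊕ u v s t bs [] B≺N) (K.trans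
      (K.*-congˡ (K.*-congˡ (w-singleton u v 1# t N)))
      (solve 5 (λ p u v t x → p ⊗ (x ⊗ (u ⊗ v ⊗ ı ⊗ t)) ⊜ p ⊗ u ⊗ v ⊗ t ⊗ x) K.refl p u v t _))

    w-topRight : ∀ u v s t {l b r N z} ls bs rs → let L = l ∷ ls ; B = b ∷ bs ; R = r ∷ rs in
      L ≺ N ∷ B → R ≺ N ∷ B → B ≺ [ N ] → L ≺ [ z ] → R ≺ [ z ] →
      w p q u v s t (L ++ N ∷ B ++ R) ≈ q ∙ w p q 1# v 1# 1# B ∙ w p q u v s t (L ++ z ∷ R)
    w-topRight u v s t {N = N} {z} ls bs rs L≺M R≺M B≺N L≺z R≺z = K.trans
      (w-inflate u v s t ls (_ ∷ bs) rs L≺M R≺M) (K.trans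
      (K.*-congʳ (w-∷max u v 1# 1# bs B≺N)) (K.trans
      (solve 5 (λ q u v b x → (q ⊗ u ⊗ v ⊗ ı ⊗ b) ⊗ x ⊜ (q ⊗ b) ⊗ ((u ⊗ v ⊗ ı ⊗ ı) ⊗ x)) K.refl q u v _ _)
      (K.*-congˡ (K.sym (K.trans (w-inflate u v s t ls [] rs L≺z R≺z) (K.*-congʳ (w-singleton u v 1# 1# z)))))))

    w-topLeft : ∀ u v s t {l b r N z} ls bs rs → let L = l ∷ ls ; B = b ∷ bs ; R = r ∷ rs in
      L ≺ B ++ [ N ] → R ≺ B ++ [ N ] → B ≺ [ N ] → L ≺ [ z ] → R ≺ [ z ] →
      w p q u v s t (L ++ (B ++ [ N ]) ++ R) ≈ p ∙ w p q u 1# 1# 1# B ∙ w p q u v s t (L ++ z ∷ R)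
    w-topLeft u v s t {N = N} {z} ls bs rs L≺M R≺M B≺N L≺z R≺z = K.trans
      (w-inflate u v s t ls (bs ++ [ N ]) rs L≺M R≺M) (K.trans
      (K.*-congʳ (w-∷ʳmax u v 1# 1# bs B≺N)) (K.trans
      (solve 5 (λ p u v b x → (p ⊗ u ⊗ v ⊗ ı ⊗ b) ⊗ x ⊜ (p ⊗ b) ⊗ ((u ⊗ v ⊗ ı ⊗ ı) ⊗ x)) K.refl p u v _ _)
      (K.*-congˡ (K.sym (K.trans (w-inflate u v s t ls [] rs L≺z R≺z) (K.*-congʳ (w-singleton u v 1# 1# z)))))))

-- The bijections

∸≡suc : ∀ N j {a} → N ∸ j ≡ suc a → N ≡ suc (a + j)
∸≡suc (suc N) zero {a} e = trans e (cong suc (sym (+-identityʳ a)))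
∸≡suc (suc N) (suc j) {a} e = cong suc (trans (∸≡suc N j e) (sym (+-suc a j)))

suc+∸ : ∀ a j → suc (a + j) ∸ j ≡ suc a
suc+∸ a j = m+n∸n≡m (suc a) j

conf-size : ∀ {k i m L R} → Conf k i m L R → i + length R ≡ m
conf-size {L = L} {R} c = trans (cong (_+ length R) (sym (left c))) (trans (sym (length-++ L)) (size (perm-LR c)))

length≡0 : ∀ {xs : List ℕ} → length xs ≡ 0 → xs ≡ []
length≡0 {[]} _ = refl

conf-zero⇒i≡0 : ∀ {k i L R} → Conf k i 0 L R → i ≡ 0
conf-zero⇒i≡0 {i = i} c = m+n≡0⇒m≡0 i (conf-size c)

2≤⇒1≤ : ∀ {k} i → 2 + i ≤ k → 1 ≤ k
2≤⇒1≤ i h = ≤-trans (s≤s z≤n) h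

-- The block σ has size j, and N ∸ j ∸ 1 is the number of entries of the result below it.
insertRight : ℕ → ℕ → ℕ → List ℕ → List ℕ → List ℕ
insertRight i N j σ ρ = take i ρ ++ N ∷ (map ((N ∸ j ∸ 1) +_) σ ++ drop (suc i) ρ)

-- `i` counts the entries to the left of the maximum in the result, so the maximum of the remainder
-- `ρ` stands behind i - j entries.
insertLeft : ℕ → ℕ → ℕ → List ℕ → List ℕ → List ℕ
insertLeft i N j σ ρ = (take (i ∸ j) ρ ++ map ((N ∸ j ∸ 1) +_) σ) ++ N ∷ drop (suc (i ∸ j)) ρ

insertRight≡ : ∀ {i} a j σ L R → length L ≡ i →
  insertRight i (suc (a + j)) j σ (L ++ suc a ∷ R) ≡ L ++ suc (a + j) ∷ (map (a +_) σ ++ R)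
insertRight≡ a j σ L R refl
  rewrite take-prefix L {suc a ∷ R} | drop-prefix L {suc a} {R} | suc+∸ a j = refl

insertLeft≡ : ∀ {i} a j σ L R → length L ≡ i ∸ j →
  insertLeft i (suc (a + j)) j σ (L ++ suc a ∷ R) ≡ (L ++ map (a +_) σ) ++ suc (a + j) ∷ R
insertLeft≡ a j σ L R e
  rewrite sym e | take-prefix L {suc a ∷ R} | drop-prefix L {suc a} {R} | suc+∸ a j = refl

module _ {k i N : ℕ} (2+i≤k : 2 + i ≤ k) where

  private
    1≤k = 2≤⇒1≤ i 2+i≤k
    1≤k∸i : 1 ≤ k ∸ i
    1≤k∸i = ≤-trans (s≤s z≤n) (m+n≤o⇒m≤o∸n 2 2+i≤k)

  insertRight-into : ∀ {j σ ρ} → 1 ≤ j → σ ∈ Av (k ∸ i) j → ρ ∈ gList k i (N ∸ j) →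
    insertRight i N j σ ρ ∈ fList k i N
  insertRight-into {j} {σ} 1≤j σ∈ ρ∈ with ∈-gList⁻ k i (N ∸ j) 1≤k ρ∈
  ... | a , L , R , n≡ , refl , c , a∈ with ∸≡suc N j n≡
  ... | refl with addTopRight c 2+i≤k 1≤j (∈-Av⁻ {n = j} 1≤k∸i σ∈)
  ... | c′ , h = subst (_∈ fList k i N) (sym (insertRight≡ a j σ L R (left c))) (∈-fList⁺ c′ (inj₂ h))

  insertRight-onto : 1 ≤ i → ∀ {x} → x ∈ fList k i N →
    ∃ λ j → ∃₂ λ σ ρ → j ∈ oneTo N × σ ∈ Av (k ∸ i) j × ρ ∈ gList k i (N ∸ j) × x ≡ insertRight i N j σ ρ
  insertRight-onto 1≤i x∈ with ∈-fList⁻ k i N 1≤k x∈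
  ... | m , L , R , refl , refl , c , inj₁ refl = contradiction (conf-zero⇒i≡0 c) (>⇒≢ 1≤i)
  ... | m , L , R , refl , refl , c , inj₂ m∈ with removeTopRight c 1≤i 2+i≤k m∈
  ... | a , j , σ , R′ , refl , refl , 1≤j , c′ , a∈ , isAv =
    j , σ , L ++ suc a ∷ R′ , oneTo⁺ 1≤j (≤-trans (m≤n+m j a) (n≤1+n _)) , ∈-Av⁺ isAv ,
    subst (λ n → L ++ suc a ∷ R′ ∈ gList k i n) (sym (suc+∸ a j)) (∈-gList⁺ c′ a∈) ,
    sym (insertRight≡ a j σ L R′ (left c))

  -- The first i entries of the result are `L`. As the remainder is counted by g, `a` is the maximum
  -- of `L` and hence determined; `N` then gives j, and j tells where the block ends.
  insertRight-injective : ∀ {j σ ρ j′ σ′ ρ′} → σ ∈ Av (k ∸ i) j → ρ ∈ gList k i (N ∸ j) →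
    σ′ ∈ Av (k ∸ i) j′ → ρ′ ∈ gList k i (N ∸ j′) → insertRight i N j σ ρ ≡ insertRight i N j′ σ′ ρ′ →
    j ≡ j′ × σ ≡ σ′ × ρ ≡ ρ′
  insertRight-injective {j} {σ} {ρ} {j′} {σ′} σ∈ ρ∈ σ∈′ ρ∈′ e with ∈-gList⁻ k i (N ∸ j) 1≤k ρ∈ | ∈-gList⁻ k i (N ∸ j′) 1≤k ρ∈′
  ... | a , L , R , n≡ , refl , c , a∈ | a′ , L′ , R′ , n≡′ , refl , c′ , a∈′
    with ++-cancel-length L L′ (trans (left c) (sym (left c′)))
      (trans (sym (eval {j = j} {σ} n≡ c)) (trans e (eval {j = j′} {σ′} n≡′ c′)))
    where
    eval : ∀ {a j σ L R} → N ∸ j ≡ suc a → Conf k i a L R →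
      insertRight i N j σ (L ++ suc a ∷ R) ≡ L ++ N ∷ (map (a +_) σ ++ R)
    eval {a} {j} {σ} {L} {R} n≡ c with ∸≡suc N j n≡
    ... | refl = insertRight≡ a j σ L R (left c)
  ... | refl , e₁ with ≤-antisym (≤m c′ (∈-++⁺ˡ a∈)) (≤m c (∈-++⁺ˡ a∈′))
  ... | refl with +-cancelˡ-≡ (suc a) j j′ (trans (sym (∸≡suc N j n≡)) (∸≡suc N j′ n≡′))
  ... | refl with ++-cancel-length (map (a +_) σ) (map (a +_) σ′)
      (trans (length-map _ σ) (trans (size (isPerm (∈-Av⁻ {n = j} 1≤k∸i σ∈)))
        (trans (sym (size (isPerm (∈-Av⁻ {n = j} 1≤k∸i σ∈′)))) (sym (length-map _ σ′))))) (∷-injectiveʳ e₁)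
  ... | e₂ , refl = refl , map-injective (+-cancelˡ-≡ a _ _) e₂ , refl

module _ {k i N : ℕ} (2+i≤k : 2 + i ≤ k) (N≢1+i : N ≢ suc i) where

  private
    1≤k = 2≤⇒1≤ i 2+i≤k

  -- The permutation 1 is the only one counted by f with nothing to the right of its maximum. It
  -- could occur as a remainder only for j = i and N = i + 1, which is excluded.
  fMember-right : ∀ {j ρ} → j ≤ i → ρ ∈ fList k (i ∸ j) (N ∸ j) → ∃ λ a → ∃₂ λ L R →
    N ≡ suc (a + j) × ρ ≡ L ++ suc a ∷ R × Conf k (i ∸ j) a L R × a ∈ R
  fMember-right {j} j≤i ρ∈ with ∈-fList⁻ k (i ∸ j) (N ∸ j) 1≤k ρ∈
  ... | a , L , R , n≡ , e , c , inj₂ a∈ = a , L , R , ∸≡suc N j n≡ , e , c , a∈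
  ... | .0 , L , R , n≡ , e , c , inj₁ refl = ⊥-elim (N≢1+i (trans (∸≡suc N j n≡)
    (cong suc (≤-antisym j≤i (m∸n≡0⇒m≤n (conf-zero⇒i≡0 c))))))

  insertLeft-into : ∀ {j σ ρ} → j ∈ oneTo i → σ ∈ Sep j → ρ ∈ fList k (i ∸ j) (N ∸ j) →
    insertLeft i N j σ ρ ∈ gList k i N
  insertLeft-into {j} {σ} j∈ σ∈ ρ∈ with oneTo⁻ j∈ | ∈-Sep⁻ {j} σ∈
  ... | 1≤j , j≤i | p , s with fMember-right j≤i ρ∈
  ... | a , L , R , refl , refl , c , a∈
    with addTopLeft c (subst (λ n → 2 + n ≤ k) (sym (m∸n+n≡m j≤i)) 2+i≤k) 1≤j p s
  ... | c′ , h = subst (_∈ gList k i N) (sym (insertLeft≡ a j σ L R (left c)))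
    (∈-gList⁺ (subst (λ n → Conf k n (a + j) (L ++ map (a +_) σ) R) (m∸n+n≡m j≤i) c′) h)

  insertLeft-onto : ∀ {x} → x ∈ gList k i N →
    ∃ λ j → ∃₂ λ σ ρ → j ∈ oneTo i × σ ∈ Sep j × ρ ∈ fList k (i ∸ j) (N ∸ j) × x ≡ insertLeft i N j σ ρ
  insertLeft-onto x∈ with ∈-gList⁻ k i N 1≤k x∈
  ... | m , L , [] , refl , refl , c , m∈ = contradiction (cong suc (trans (sym (conf-size c)) (+-identityʳ i))) N≢1+i
  ... | m , L , r ∷ R , refl , refl , c , m∈ with removeTopLeft c 2+i≤k (here refl) m∈
  ... | a , j , σ , L′ , refl , refl , 1≤j , refl , c′ , a∈ , p , s =
    j , σ , L′ ++ suc a ∷ r ∷ R , oneTo⁺ 1≤j (m≤n+m j (length L′)) , ∈-Sep⁺ p s ,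
    subst₂ (λ i n → L′ ++ suc a ∷ r ∷ R ∈ fList k i n) (sym lenL′) (sym (suc+∸ a j)) (∈-fList⁺ c′ (inj₂ a∈)) ,
    sym (insertLeft≡ a j σ L′ (r ∷ R) (sym lenL′))
    where
    lenL′ : length L′ + j ∸ j ≡ length L′
    lenL′ = m+n∸n≡m (length L′) j

  -- The first i entries are `L` together with the block, and what follows the maximum is `R`. As
  -- the remainder is counted by f, `a` is the maximum of `R`; it fixes j and thereby the cut
  -- between `L` and the block.
  insertLeft-injective : ∀ {j σ ρ j′ σ′ ρ′} → j ∈ oneTo i → σ ∈ Sep j → ρ ∈ fList k (i ∸ j) (N ∸ j) →
    j′ ∈ oneTo i → σ′ ∈ Sep j′ → ρ′ ∈ fList k (i ∸ j′) (N ∸ j′) → insertLeft i N j σ ρ ≡ insertLeft i N j′ σ′ ρ′ →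
    j ≡ j′ × σ ≡ σ′ × ρ ≡ ρ′
  insertLeft-injective {j} {σ} {ρ} {j′} {σ′} j∈ σ∈ ρ∈ j∈′ σ∈′ ρ∈′ e
    with oneTo⁻ j∈ | oneTo⁻ j∈′
  ... | _ , j≤i | _ , j≤i′ with fMember-right j≤i ρ∈ | fMember-right j≤i′ ρ∈′
  ... | a , L , R , n≡ , refl , c , a∈ | a′ , L′ , R′ , n≡′ , refl , c′ , a∈′
    with ++-cancel-length (L ++ map (a +_) σ) (L′ ++ map (a′ +_) σ′)
      (trans (total {σ = σ} c j≤i σ∈) (sym (total {σ = σ′} c′ j≤i′ σ∈′)))
      (trans (sym (eval {σ = σ} n≡ c)) (trans e (eval {σ = σ′} n≡′ c′)))
    where
    eval : ∀ {a j σ L R} → N ≡ suc (a + j) → Conf k (i ∸ j) a L R →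
      insertLeft i N j σ (L ++ suc a ∷ R) ≡ (L ++ map (a +_) σ) ++ N ∷ R
    eval {a} {j} {σ} {L} {R} refl c = insertLeft≡ a j σ L R (left c)
    total : ∀ {a j σ L R} → Conf k (i ∸ j) a L R → j ≤ i → σ ∈ Sep j → length (L ++ map (a +_) σ) ≡ i
    total {a} {j} {σ} {L} c j≤i σ∈ = trans (length-++ L)
      (trans (cong₂ _+_ (left c) (trans (length-map _ σ) (size (proj₁ (∈-Sep⁻ {j} σ∈))))) (m∸n+n≡m j≤i))
  ... | e₁ , e₂ with ∷-injectiveʳ e₂
  ... | refl with ≤-antisym (≤m c′ (∈-++⁺ʳ L′ a∈)) (≤m c (∈-++⁺ʳ L a∈′))
  ... | refl with +-cancelˡ-≡ (suc a) j j′ (trans (sym n≡) n≡′)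
  ... | refl with ++-cancel-length L L′ (trans (left c) (sym (left c′))) e₁
  ... | refl , e₃ = refl , map-injective (+-cancelˡ-≡ a _ _) e₃ , refl

-- A leading maximum lies below nothing that follows, so the counters of `R` are unchanged; the
-- maximum itself only asks for `2 ≤ k`.
consMax-into : ∀ {k m R} → 2 ≤ k → R ∈ Av k m → suc m ∷ R ∈ fList k 0 (suc m)
consMax-into {k} {m} {R} 2≤k R∈ with ∈-Av⁻ {n = m} (2≤⇒1≤ 0 2≤k) R∈
... | inAv p s a = ∈-fList⁺ {L = []} (conf refl p (separable-max∷ (λ q → s≤s (proj₂ (bounds p q))) s)
    (2≤k , avoidsP-cong R (λ q → cong (λ b → indicator b + 0)
      (sym (<ᵇ-false (m≤n⇒m≤1+n (proj₂ (bounds p q)))))) a))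
  (side m p)
  where
  side : ∀ m → Perm m R → m ≡ 0 ⊎ m ∈ R
  side zero _ = inj₁ refl
  side (suc m) p = inj₂ (perm-max∈ p)

consMax-onto : ∀ {k m x} → 2 ≤ k → x ∈ fList k 0 (suc m) → ∃ λ R → R ∈ Av k m × x ≡ suc m ∷ R
consMax-onto {k} {m} 2≤k x∈ with ∈-fList⁻ k 0 (suc m) (2≤⇒1≤ 0 2≤k) x∈
... | m , [] , R , refl , refl , c , _ = R , ∈-Av⁺ (inAv (perm-LR c)
    (separable-⊆ (_ ∷ʳ ⊆-refl) (separable c))
    (avoidsP-cong R (λ q → cong (λ b → indicator b + 0)
      (<ᵇ-false (m≤n⇒m≤1+n (proj₂ (bounds (perm-LR c) q))))) (proj₂ (avoiding c)))) , refl
... | m , _ ∷ _ , R , refl , refl , conf () _ _ _ , _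

-- There are only i + 1 < k entries in all, so P_k is avoided whatever `L` is.
snocMax-into : ∀ {k i L} → 1 ≤ i → 2 + i ≤ k → L ∈ Sep i → L ++ [ suc i ] ∈ gList k i (suc i)
snocMax-into {k} {suc i} {L} 1≤i 2+i≤k L∈ with ∈-Sep⁻ {suc i} L∈
... | p , s = ∈-gList⁺ (conf (size p) (subst (Perm _) (sym (++-identityʳ L)) p)
    (separable-∷ʳmax (λ q → s≤s (proj₂ (bounds p q))) s)
    (avoidsP-short (L ++ [ _ ]) λ _ → ≤-trans (≤-reflexive len) 2+i≤k))
  (perm-max∈ p)
  where
  len : length (L ++ [ suc (suc i) ]) + 0 + 1 ≡ 2 + suc i
  len = trans (+-comm _ 1) (cong suc (trans (+-identityʳ _) (trans (length-++ L) (trans (+-comm _ 1) (cong suc (size p))))))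

snocMax-onto : ∀ {k i x} → 2 + i ≤ k → x ∈ gList k i (suc i) → ∃ λ L → L ∈ Sep i × x ≡ L ++ [ suc i ]
snocMax-onto {k} {i} 2+i≤k x∈ with ∈-gList⁻ k i (suc i) (2≤⇒1≤ i 2+i≤k) x∈
... | m , L , R , refl , refl , c , _ with length≡0 {R} (+-cancelˡ-≡ m _ _ (trans (conf-size c) (sym (+-identityʳ m))))
... | refl = L , ∈-Sep⁺ (subst (Perm m) (++-identityʳ L) (perm-LR c))
  (separable-⊆ (SubP.++⁺ʳ _ ⊆-refl) (separable c)) , refl

-- The two peeling identities

oneTo-∷ʳ : ∀ n → oneTo (suc n) ≡ oneTo n ++ [ suc n ]
oneTo-∷ʳ n = trans (cong (map suc) (sym (upTo-∷ʳ n))) (map-++ suc (upTo n) [ n ])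

conf-nonempty : ∀ {k i m L R} → 1 ≤ i → Conf k i m L R → ∃₂ λ l ls → L ≡ l ∷ ls
conf-nonempty {L = []} () (conf refl _ _ _)
conf-nonempty {L = l ∷ ls} _ _ = l , ls , refl

perm-nonempty : ∀ {j σ} → 1 ≤ j → Perm j σ → ∃₂ λ x xs → σ ≡ x ∷ xs
perm-nonempty {σ = []} () (perm refl _ _)
perm-nonempty {σ = x ∷ xs} _ _ = x , xs , refl

module Recursion {c ℓ : Level} (𝓡 : CommutativeRing c ℓ) where
  open Sums 𝓡
  open Weights 𝓡
  open CommutativeRing 𝓡 using (Carrier; _≈_; 0#; 1#; _-_) renaming (_+_ to infixl 6 _⊹_; _*_ to infixl 7 _∙_)
  open GF 𝓡
  open import Algebra.Solver.CommutativeMonoid K.*-commutativeMonoid using (solve; _⊜_) renaming (_⊕_ to infixl 7 _⊗_; id to ı)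
  import Algebra.Properties.Ring K.ring as RingP
  import Relation.Binary.Reasoning.Setoid K.setoid as ≈-Reasoning

  ∑-empty : ∀ {A : Set} (xs : List A) h → (∀ {x} → x ∉ xs) → ∑ xs h ≈ 0#
  ∑-empty [] h _ = K.refl
  ∑-empty (x ∷ xs) h ∉ = ⊥-elim (∉ (here refl))

  x-0≈x : ∀ x → x - 0# ≈ x
  x-0≈x x = K.trans (K.+-congˡ RingP.-0#≈0#) (K.+-identityʳ x)

  mono-≡ : ∀ m a → mono m a m ≈ a
  mono-≡ m a rewrite Equivalence.to T-≡ (≡⇒≡ᵇ m m refl) = K.refl

  mono-≢ : ∀ m a {n} → n ≢ m → mono m a n ≈ 0#
  mono-≢ m a {n} n≢m with n ≡ᵇ m in e
  ... | false = K.refl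
  ... | true = contradiction (≡ᵇ⇒≡ n m (Equivalence.from T-≡ e)) n≢m

  -- Below degree m the shift is 0, whereas truncated subtraction yields `a 0`; the two agree once
  -- the constant term vanishes.
  sh-vanishing : ∀ m (a : Series) n → a 0 ≈ 0# → sh m a n ≈ a (n ∸ m)
  sh-vanishing m a n a₀ with m ≤ᵇ n in e
  ... | true = K.refl
  ... | false with m ≤? n
  ... | yes m≤n = contradiction (≤⇒≤ᵇ m≤n) (λ t → subst T e t)
  ... | no m≰n = K.sym (K.trans (K.reflexive (cong a (m≤n⇒m∸n≡0 (<⇒≤ (≰⇒> m≰n))))) a₀)

  -- Peeled blocks are nonempty, so the sums over block sizes start at 1; the vanishing constant
  -- term of `F₋` matches this.
  ⊛-tail : ∀ a b N → a 0 ≈ 0# → (a ⊛ b) N ≈ ∑ (oneTo N) (λ j → a j ∙ b (N ∸ j))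
  ⊛-tail a b N a₀ = K.trans
    (K.+-cong (K.trans (K.*-congʳ a₀) (K.zeroˡ _)) (K.reflexive (cong (λ js → ∑ js (λ j → a j ∙ b (N ∸ j))) (sym (map-upTo suc N)))))
    (K.+-identityˡ _)

  F-0 : ∀ {k} → 1 ≤ k → ∀ p q u v s t → F k p q u v s t 0 ≈ 1#
  F-0 {suc k} _ p q u v s t = K.trans (K.+-identityʳ _) (solve 0 (ı ⊗ ı ⊗ ı ⊗ ı ⊗ ı ⊗ ı ⊜ ı) K.refl)

  F₋-0 : ∀ {k} → 1 ≤ k → ∀ p q u v s t → F₋ k p q u v s t 0 ≈ 0#
  F₋-0 1≤k p q u v s t = K.trans (K.+-congʳ (F-0 1≤k p q u v s t)) (K.-‿inverseʳ 1#)

  F₋-≥1 : ∀ k p q u v s t {n} → 1 ≤ n → F₋ k p q u v s t n ≈ F k p q u v s t n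
  F₋-≥1 k p q u v s t {suc n} _ = x-0≈x _

  f-0 : ∀ {k} i → 1 ≤ k → ∀ p q u v s t → f k i p q u v s t 0 ≈ 0#
  f-0 {k} i 1≤k p q u v s t = ∑-empty (fList k i 0) _ λ x∈ →
    case ∈-fList⁻ k i 0 1≤k x∈ of λ { (_ , _ , _ , () , _) }

  g-0 : ∀ {k} i → 1 ≤ k → ∀ p q u v s t → g k i p q u v s t 0 ≈ 0#
  g-0 {k} i 1≤k p q u v s t = ∑-empty (gList k i 0) _ λ x∈ →
    case ∈-gList⁻ k i 0 1≤k x∈ of λ { (_ , _ , _ , () , _) }

  g₀≈0 : ∀ {k} → 1 ≤ k → ∀ p q u v s t → g k 0 p q u v s t ≐ zeroS
  g₀≈0 {k} 1≤k p q u v s t n = ∑-empty (gList k 0 n) _ λ x∈ →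
    case ∈-gList⁻ k 0 n 1≤k x∈ of λ
      { (_ , [] , _ , _ , _ , _ , ()) ; (_ , _ ∷ _ , _ , _ , _ , conf () _ _ _ , _) }

  -- With i entries to the left of the maximum, length i + 1 leaves no place on the right for the
  -- second largest entry.
  f-first : ∀ {k i} → 1 ≤ k → 1 ≤ i → ∀ p q u v s t → f k i p q u v s t (suc i) ≈ 0#
  f-first {k} {i} 1≤k 1≤i p q u v s t = ∑-empty (fList k i (suc i)) _ λ x∈ →
    case ∈-fList⁻ k i (suc i) 1≤k x∈ of λ
      { (m , L , R , refl , _ , c , inj₁ refl) → contradiction 1≤i λ ()
      ; (m , L , [] , refl , _ , c , inj₂ ())
      ; (m , L , r ∷ R , refl , _ , c , inj₂ _) → <⇒≢ (m<m+n m (s≤s z≤n)) (sym (conf-size c)) }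

  ∑-consMax : ∀ {k} → 2 ≤ k → ∀ m h → ∑ (fList k 0 (suc m)) h ≈ ∑ (Av k m) (λ R → h (suc m ∷ R))
  ∑-consMax {k} 2≤k m h = ∑-bijection h (suc m ∷_) (unique-fList k 0 (suc m)) (unique-Av k m)
    (consMax-into {k} {m} 2≤k) (λ _ _ → ∷-injectiveʳ) (consMax-onto {k} {m} 2≤k)

  ∑-snocMax : ∀ {k i} → 1 ≤ i → 2 + i ≤ k → ∀ h →
    ∑ (gList k i (suc i)) h ≈ ∑ (Sep i) (λ L → h (L ++ [ suc i ]))
  ∑-snocMax {k} {i} 1≤i 2+i≤k h = ∑-bijection h (_++ [ suc i ]) (unique-gList k i (suc i)) (unique-Sep i)
    (snocMax-into {k} {i} 1≤i 2+i≤k) (λ {y} {z} _ _ → ∷ʳ-injectiveˡ y z) (snocMax-onto {k} {i} 2+i≤k)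

  module _ (p q u v s t : Carrier) where

    -- The empty `R` gives a term of its own because the product formula for a skew sum needs two
    -- nonempty parts. In `F₋` the empty permutation has been removed accordingly.
    f₀≈ : ∀ {k} → 2 ≤ k →
      f k 0 p q u v s t ≐ mono 1 (u · v · s · t) ⊕ scale (q · u · v · s) (sh 1 (F₋ k p q 𝟙 v s t))
    f₀≈ 2≤k zero = K.trans (f-0 0 (2≤⇒1≤ 0 2≤k) p q u v s t) (K.sym (K.trans (K.+-identityˡ _) (K.zeroʳ _)))
    f₀≈ {suc zero} (s≤s ()) (suc zero)
    -- `k` is exposed as a successor so that `Av k 0` computes to the list of the empty permutation.
    f₀≈ {k@(suc (suc k₀))} 2≤k (suc zero) = begin
      f k 0 p q u v s t 1                                   ≈⟨ ∑-consMax 2≤k 0 (w p q u v s t) ⟩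
      w p q u v s t [ 1 ] ⊹ 0#                              ≈⟨ K.+-cong (w-singleton p q u v s t 1) (K.sym (K.zeroʳ _)) ⟩
      u ∙ v ∙ s ∙ t ⊹ q ∙ u ∙ v ∙ s ∙ 0#                    ≈⟨ K.+-congˡ (K.*-congˡ (K.sym (F₋-0 {k} (s≤s z≤n) p q 𝟙 v s t))) ⟩
      u ∙ v ∙ s ∙ t ⊹ q ∙ u ∙ v ∙ s ∙ F₋ k p q 𝟙 v s t 0    ∎
      where open ≈-Reasoning
    f₀≈ {k} 2≤k (suc (suc m)) = begin
      f k 0 p q u v s t (suc (suc m))                                ≈⟨ ∑-consMax 2≤k (suc m) (w p q u v s t) ⟩
      ∑ (Av k (suc m)) (λ R → w p q u v s t (suc (suc m) ∷ R))       ≈⟨ ∑-cong (Av k (suc m)) step ⟩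
      ∑ (Av k (suc m)) (λ R → q ∙ u ∙ v ∙ s ∙ w p q 𝟙 v s t R)       ≈⟨ ∑-*ˡ _ (Av k (suc m)) _ ⟨
      q ∙ u ∙ v ∙ s ∙ F k p q 𝟙 v s t (suc m)                        ≈⟨ K.*-congˡ (F₋-≥1 k p q 𝟙 v s t {suc m} (s≤s z≤n)) ⟨
      q ∙ u ∙ v ∙ s ∙ F₋ k p q 𝟙 v s t (suc m)                       ≈⟨ K.+-identityˡ _ ⟨
      0# ⊹ q ∙ u ∙ v ∙ s ∙ F₋ k p q 𝟙 v s t (suc m)                  ∎
      where
      open ≈-Reasoning
      step : ∀ {R} → R ∈ Av k (suc m) → w p q u v s t (suc (suc m) ∷ R) ≈ q ∙ u ∙ v ∙ s ∙ w p q 𝟙 v s t R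
      step R∈ with isPerm (∈-Av⁻ {n = suc m} (2≤⇒1≤ 0 2≤k) R∈)
      ... | pR with perm-nonempty (s≤s z≤n) pR
      ... | _ , xs , refl = w-∷max p q u v s t xs (≤⇒≺[suc] (proj₂ ∘ bounds pR))

    module _ {k i : ℕ} (1≤i : 1 ≤ i) (2+i≤k : 2 + i ≤ k) where

      private
        1≤k = 2≤⇒1≤ i 2+i≤k
        1≤k∸i : 1 ≤ k ∸ i
        1≤k∸i = ≤-trans (s≤s z≤n) (m+n≤o⇒m≤o∸n 2 2+i≤k)

      -- The contribution to g of the permutations that end with their maximum; all of them have
      -- length i + 1.
      shortest : Series
      shortest = mono (i + 1) (p · u · v · t · X i p q u 𝟙 s t)

      -- The part of g_{k,i} coming from permutations whose last entry is not the largest one.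
      g₂ : Series
      g₂ = g k i p q u v s t ⊖ shortest

      g-first : g k i p q u v s t (suc i) ≈ p ∙ u ∙ v ∙ t ∙ X i p q u 𝟙 s t
      g-first = K.trans (∑-snocMax 1≤i 2+i≤k (w p q u v s t)) (K.trans (∑-cong (Sep i) step) (K.sym (∑-*ˡ _ (Sep i) _)))
        where
        step : ∀ {L} → L ∈ Sep i → w p q u v s t (L ++ [ suc i ]) ≈ p ∙ u ∙ v ∙ t ∙ w p q u 𝟙 s t L
        step L∈ with proj₁ (∈-Sep⁻ {i} L∈)
        ... | pL with perm-nonempty 1≤i pL
        ... | _ , xs , refl = w-∷ʳmax p q u v s t xs (≤⇒≺[suc] (proj₂ ∘ bounds pL))

      g₂-first : g₂ (suc i) ≈ 0#
      g₂-first = K.trans (K.+-cong g-first (K.-‿cong (K.trans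
        (K.reflexive (cong (λ m → mono m (p · u · v · t · X i p q u 𝟙 s t) (suc i)) (+-comm i 1))) (mono-≡ (suc i) _)))) (K.-‿inverseʳ _)

      g₂-other : ∀ {n} → n ≢ suc i → g₂ n ≈ g k i p q u v s t n
      g₂-other n≢ = K.trans (K.+-congˡ (K.-‿cong (mono-≢ (i + 1) _ (λ e → n≢ (trans e (+-comm i 1)))))) (x-0≈x _)

      -- Both count the block to the right of the maximum. Its right-to-left minima are visible only
      -- if nothing follows it, so `t` is kept when the remainder ends with its maximum and is set
      -- to 1 otherwise.
      Fₜ F₁ : Series
      Fₜ = F₋ (k ∸ i) p q 𝟙 v 𝟙 t
      F₁ = F₋ (k ∸ i) p q 𝟙 v 𝟙 𝟙

      -- `shortest` with `q` in place of `t`: once a block follows the maximum, there is a descent,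
      -- and the maximum is no longer a right-to-left minimum.
      shortestᶠ : Series
      shortestᶠ = mono (i + 1) (p · q · u · v · X i p q u 𝟙 s t)

      module _ (N : ℕ) where

        -- With nothing after the block, the result is the direct sum of `L` and `N` followed by the
        -- block, so `w-⊕` takes the place of `w-inflate`, whose right part is nonempty.
        w-insertRight-first : ∀ j {σ L} → 1 ≤ j → N ≡ suc (i + j) → σ ∈ Av (k ∸ i) j → L ∈ Sep i →
          w p q u v s t (insertRight i N j σ (L ++ [ suc i ])) ≈
          w p q 𝟙 v 𝟙 t σ ∙ (p ∙ q ∙ u ∙ v ∙ w p q u 𝟙 s t L)
        w-insertRight-first j {σ} {L} 1≤j refl σ∈ L∈ with isPerm (∈-Av⁻ {n = j} 1≤k∸i σ∈) | proj₁ (∈-Sep⁻ {i} L∈)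
        ... | pσ | pL with perm-nonempty 1≤j pσ | perm-nonempty 1≤i pL
        ... | _ , xs , refl | _ , ls , refl = begin
          w p q u v s t (insertRight i N j σ (L ++ [ suc i ]))  ≡⟨ cong (w p q u v s t) (trans
              (insertRight≡ i j σ L [] (size pL)) (cong (λ B → L ++ N ∷ B) (++-identityʳ (map (i +_) σ)))) ⟩
          w p q u v s t (L ++ N ∷ map (i +_) σ)                 ≈⟨ w-⊕ p q u v s t ls (map (i +_) σ) L≺M ⟩
          p ∙ (w p q u 𝟙 s t L ∙ w p q u v 𝟙 t (N ∷ map (i +_) σ))
            ≈⟨ K.*-congˡ (K.*-congˡ (w-∷max p q u v 𝟙 t _ B≺N)) ⟩
          p ∙ (w p q u 𝟙 s t L ∙ (q ∙ u ∙ v ∙ 𝟙 ∙ w p q 𝟙 v 𝟙 t (map (i +_) σ)))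
            ≈⟨ K.*-congˡ (K.*-congˡ (K.*-congˡ (w-shift p q 𝟙 v 𝟙 t i σ))) ⟩
          p ∙ (w p q u 𝟙 s t L ∙ (q ∙ u ∙ v ∙ 𝟙 ∙ w p q 𝟙 v 𝟙 t σ))
            ≈⟨ solve 6 (λ p q u v x y → p ⊗ (x ⊗ (q ⊗ u ⊗ v ⊗ ı ⊗ y)) ⊜ y ⊗ (p ⊗ q ⊗ u ⊗ v ⊗ x)) K.refl p q u v _ _ ⟩
          w p q 𝟙 v 𝟙 t σ ∙ (p ∙ q ∙ u ∙ v ∙ w p q u 𝟙 s t L)   ∎
          where
          open ≈-Reasoning
          leL : ∀ {x} → x ∈ L → x ≤ i
          leL = proj₂ ∘ bounds pL
          L≺M : L ≺ N ∷ map (i +_) σ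
          L≺M = ≺-max∷ (λ h → s≤s (≤-trans (leL h) (m≤m+n i j))) (shift-≺ leL pσ)
          B≺N : map (i +_) σ ≺ [ N ]
          B≺N h (here refl) = shift-bounded pσ h

        w-insertRight : ∀ j {σ ρ} → 1 ≤ j → N ∸ j ≢ suc i → σ ∈ Av (k ∸ i) j → ρ ∈ gList k i (N ∸ j) →
          w p q u v s t (insertRight i N j σ ρ) ≈ q ∙ w p q 𝟙 v 𝟙 𝟙 σ ∙ w p q u v s t ρ
        w-insertRight j {σ} 1≤j n≢ σ∈ ρ∈ with ∈-gList⁻ k i (N ∸ j) 1≤k ρ∈
        ... | a , L , [] , n≡ , refl , c , a∈ = contradiction
          (trans n≡ (cong suc (trans (sym (conf-size c)) (+-identityʳ i)))) n≢
        ... | a , L , R@(r ∷ rs) , n≡ , refl , c , a∈ with ∸≡suc N j n≡ | isPerm (∈-Av⁻ {n = j} 1≤k∸i σ∈)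
        ... | refl | pσ with perm-nonempty 1≤j pσ | conf-nonempty 1≤i c
        ... | _ , xs , refl | _ , ls , refl = begin
          w p q u v s t (insertRight i N j σ (L ++ suc a ∷ R))
            ≡⟨ cong (w p q u v s t) (insertRight≡ a j σ L R (left c)) ⟩
          w p q u v s t (L ++ N ∷ (map (a +_) σ ++ R))
            ≈⟨ w-topRight p q u v s t ls (map (a +_) xs) rs L≺M R≺M B≺N (≤⇒≺[suc] leL) (≤⇒≺[suc] leR) ⟩
          q ∙ w p q 𝟙 v 𝟙 𝟙 (map (a +_) σ) ∙ w p q u v s t (L ++ suc a ∷ R)
            ≈⟨ K.*-congʳ (K.*-congˡ (w-shift p q 𝟙 v 𝟙 𝟙 a σ)) ⟩
          q ∙ w p q 𝟙 v 𝟙 𝟙 σ ∙ w p q u v s t (L ++ suc a ∷ R) ∎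
          where
          open ≈-Reasoning
          leL : ∀ {x} → x ∈ L → x ≤ a
          leL h = ≤m c (∈-++⁺ˡ h)
          leR : ∀ {x} → x ∈ R → x ≤ a
          leR h = ≤m c (∈-++⁺ʳ L h)
          L≺M : L ≺ N ∷ map (a +_) σ
          L≺M = ≺-max∷ (λ h → s≤s (≤-trans (leL h) (m≤m+n a j))) (shift-≺ leL pσ)
          R≺M : R ≺ N ∷ map (a +_) σ
          R≺M = ≺-max∷ (λ h → s≤s (≤-trans (leR h) (m≤m+n a j))) (shift-≺ leR pσ)
          B≺N : map (a +_) σ ≺ [ N ]
          B≺N h (here refl) = shift-bounded pσ h

        -- At most one summand is nonzero: a remainder of length i + 1 ends with its maximum and has
        -- been removed from `g₂`, while `shortestᶠ` vanishes at every other length.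
        blockRight : ∀ j → j ∈ oneTo N →
          ∑ (Av (k ∸ i) j) (λ σ → ∑ (gList k i (N ∸ j)) (λ ρ → w p q u v s t (insertRight i N j σ ρ))) ≈
          Fₜ j ∙ shortestᶠ (N ∸ j) ⊹ q ∙ (F₁ j ∙ g₂ (N ∸ j))
        blockRight j j∈ with proj₁ (oneTo⁻ j∈) | N ∸ j ≟ suc i
        ... | 1≤j | yes n≡ = begin
          ∑ (Av (k ∸ i) j) (λ σ → ∑ (gList k i (N ∸ j)) (λ ρ → w p q u v s t (insertRight i N j σ ρ)))
            ≡⟨ cong (λ n → ∑ (Av (k ∸ i) j) (λ σ → ∑ (gList k i n) (λ ρ → w p q u v s t (insertRight i N j σ ρ)))) n≡ ⟩
          ∑ (Av (k ∸ i) j) (λ σ → ∑ (gList k i (suc i)) (λ ρ → w p q u v s t (insertRight i N j σ ρ)))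
            ≈⟨ ∑-cong (Av (k ∸ i) j) (λ {σ} σ∈ → K.trans (∑-snocMax 1≤i 2+i≤k _)
                 (∑-cong (Sep i) (w-insertRight-first j 1≤j (∸≡suc N j n≡) σ∈))) ⟩
          ∑ (Av (k ∸ i) j) (λ σ → ∑ (Sep i) (λ L → w p q 𝟙 v 𝟙 t σ ∙ (p ∙ q ∙ u ∙ v ∙ w p q u 𝟙 s t L)))
            ≈⟨ ∑-product (Av (k ∸ i) j) (Sep i) _ _ ⟩
          F (k ∸ i) p q 𝟙 v 𝟙 t j ∙ ∑ (Sep i) (λ L → p ∙ q ∙ u ∙ v ∙ w p q u 𝟙 s t L)
            ≈⟨ K.*-cong (K.sym (F₋-≥1 (k ∸ i) p q 𝟙 v 𝟙 t 1≤j)) (K.sym (∑-*ˡ _ (Sep i) _)) ⟩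
          Fₜ j ∙ (p ∙ q ∙ u ∙ v ∙ X i p q u 𝟙 s t)
            ≈⟨ K.*-congˡ (K.trans (K.sym (mono-≡ (i + 1) _))
                 (K.reflexive (cong shortestᶠ (trans (+-comm i 1) (sym n≡))))) ⟩
          Fₜ j ∙ shortestᶠ (N ∸ j)
            ≈⟨ K.+-identityʳ _ ⟨
          Fₜ j ∙ shortestᶠ (N ∸ j) ⊹ 0#
            ≈⟨ K.+-congˡ (K.sym (K.trans (K.*-congˡ (K.trans (K.*-congˡ
                 (K.trans (K.reflexive (cong g₂ n≡)) g₂-first)) (K.zeroʳ _))) (K.zeroʳ _))) ⟩
          Fₜ j ∙ shortestᶠ (N ∸ j) ⊹ q ∙ (F₁ j ∙ g₂ (N ∸ j)) ∎
          where open ≈-Reasoning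
        ... | 1≤j | no n≢ = begin
          ∑ (Av (k ∸ i) j) (λ σ → ∑ (gList k i (N ∸ j)) (λ ρ → w p q u v s t (insertRight i N j σ ρ)))
            ≈⟨ ∑-cong (Av (k ∸ i) j) (λ σ∈ → ∑-cong (gList k i (N ∸ j)) (w-insertRight j 1≤j n≢ σ∈)) ⟩
          ∑ (Av (k ∸ i) j) (λ σ → ∑ (gList k i (N ∸ j)) (λ ρ → q ∙ w p q 𝟙 v 𝟙 𝟙 σ ∙ w p q u v s t ρ))
            ≈⟨ ∑-product (Av (k ∸ i) j) (gList k i (N ∸ j)) _ _ ⟩
          ∑ (Av (k ∸ i) j) (λ σ → q ∙ w p q 𝟙 v 𝟙 𝟙 σ) ∙ g k i p q u v s t (N ∸ j)
            ≈⟨ K.*-cong (K.trans (K.sym (∑-*ˡ q (Av (k ∸ i) j) _)) (K.*-congˡ (K.sym (F₋-≥1 (k ∸ i) p q 𝟙 v 𝟙 𝟙 1≤j))))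
                 (K.sym (g₂-other n≢)) ⟩
          q ∙ F₁ j ∙ g₂ (N ∸ j)
            ≈⟨ K.*-assoc _ _ _ ⟩
          q ∙ (F₁ j ∙ g₂ (N ∸ j))
            ≈⟨ K.+-identityˡ _ ⟨
          0# ⊹ q ∙ (F₁ j ∙ g₂ (N ∸ j))
            ≈⟨ K.+-congʳ (K.sym (K.trans (K.*-congˡ (mono-≢ (i + 1) _ (λ e → n≢ (trans e (+-comm i 1))))) (K.zeroʳ _))) ⟩
          Fₜ j ∙ shortestᶠ (N ∸ j) ⊹ q ∙ (F₁ j ∙ g₂ (N ∸ j)) ∎
          where open ≈-Reasoning

        f-peel : f k i p q u v s t N ≈ (Fₜ ⊛ shortestᶠ) N ⊹ q ∙ (F₁ ⊛ g₂) N
        f-peel = begin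
          f k i p q u v s t N
            ≈⟨ ∑-triples (Av (k ∸ i)) (λ j → gList k i (N ∸ j)) (w p q u v s t) (insertRight i N)
                 (unique-fList k i N) (unique-oneTo N) (unique-Av (k ∸ i)) (λ j → unique-gList k i (N ∸ j))
                 (λ {j} j∈ → insertRight-into {N = N} 2+i≤k {j} (proj₁ (oneTo⁻ j∈)))
                 (λ {j} {σ} {ρ} {j′} _ σ∈ ρ∈ _ σ∈′ ρ∈′ → insertRight-injective {N = N} 2+i≤k {j} {j′ = j′} σ∈ ρ∈ σ∈′ ρ∈′)
                 (insertRight-onto {N = N} 2+i≤k 1≤i) ⟩
          ∑ (oneTo N) (λ j → ∑ (Av (k ∸ i) j) (λ σ → ∑ (gList k i (N ∸ j)) (λ ρ → w p q u v s t (insertRight i N j σ ρ))))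
            ≈⟨ ∑-cong (oneTo N) (λ {j} → blockRight j) ⟩
          ∑ (oneTo N) (λ j → Fₜ j ∙ shortestᶠ (N ∸ j) ⊹ q ∙ (F₁ j ∙ g₂ (N ∸ j)))
            ≈⟨ ∑-+ (oneTo N) _ _ ⟩
          ∑ (oneTo N) (λ j → Fₜ j ∙ shortestᶠ (N ∸ j)) ⊹ ∑ (oneTo N) (λ j → q ∙ (F₁ j ∙ g₂ (N ∸ j)))
            ≈⟨ K.+-congˡ (∑-*ˡ q (oneTo N) _) ⟨
          ∑ (oneTo N) (λ j → Fₜ j ∙ shortestᶠ (N ∸ j)) ⊹ q ∙ ∑ (oneTo N) (λ j → F₁ j ∙ g₂ (N ∸ j))
            ≈⟨ K.+-cong (⊛-tail Fₜ shortestᶠ N (F₋-0 1≤k∸i p q 𝟙 v 𝟙 t))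
                 (K.*-congˡ (⊛-tail F₁ g₂ N (F₋-0 1≤k∸i p q 𝟙 v 𝟙 𝟙))) ⟨
          (Fₜ ⊛ shortestᶠ) N ⊹ q ∙ (F₁ ⊛ g₂) N ∎
          where open ≈-Reasoning

        w-insertLeft : N ≢ suc i → ∀ j {σ ρ} → 1 ≤ j → 1 ≤ i ∸ j → σ ∈ Sep j → ρ ∈ fList k (i ∸ j) (N ∸ j) →
          w p q u v s t (insertLeft i N j σ ρ) ≈ p ∙ w p q u 𝟙 𝟙 𝟙 σ ∙ w p q u v s t ρ
        w-insertLeft N≢ j {σ} 1≤j 1≤i∸j σ∈ ρ∈
          with fMember-right 2+i≤k N≢ {j} (<⇒≤ (m∸n≢0⇒n<m (>⇒≢ 1≤i∸j))) ρ∈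
        ... | a , L , R@(r ∷ rs) , refl , refl , c , a∈ with proj₁ (∈-Sep⁻ {j} σ∈)
        ... | pσ with perm-nonempty 1≤j pσ | conf-nonempty 1≤i∸j c
        ... | _ , xs , refl | _ , ls , refl = begin
          w p q u v s t (insertLeft i N j σ (L ++ suc a ∷ R))
            ≡⟨ cong (w p q u v s t) (trans (insertLeft≡ a j σ L R (left c)) (sym (regroup L B N R))) ⟩
          w p q u v s t (L ++ (B ++ [ N ]) ++ R)
            ≈⟨ w-topLeft p q u v s t ls (map (a +_) xs) rs L≺M R≺M B≺N (≤⇒≺[suc] leL) (≤⇒≺[suc] leR) ⟩
          p ∙ w p q u 𝟙 𝟙 𝟙 B ∙ w p q u v s t (L ++ suc a ∷ R)
            ≈⟨ K.*-congʳ (K.*-congˡ (w-shift p q u 𝟙 𝟙 𝟙 a σ)) ⟩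
          p ∙ w p q u 𝟙 𝟙 𝟙 σ ∙ w p q u v s t (L ++ suc a ∷ R) ∎
          where
          open ≈-Reasoning
          B = map (a +_) σ
          leL : ∀ {x} → x ∈ L → x ≤ a
          leL h = ≤m c (∈-++⁺ˡ h)
          leR : ∀ {x} → x ∈ R → x ≤ a
          leR h = ≤m c (∈-++⁺ʳ L h)
          L≺M : L ≺ B ++ [ N ]
          L≺M = ≺-∷ʳmax B (λ h → s≤s (≤-trans (leL h) (m≤m+n a j))) (shift-≺ leL pσ)
          R≺M : R ≺ B ++ [ N ]
          R≺M = ≺-∷ʳmax B (λ h → s≤s (≤-trans (leR h) (m≤m+n a j))) (shift-≺ leR pσ)
          B≺N : B ≺ [ N ]
          B≺N h (here refl) = shift-bounded pσ h

        w-insertLeft-last : ∀ {m σ R} → N ≡ suc (m + i) → 1 ≤ m → σ ∈ Sep i → R ∈ Av k m →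
          w p q u v s t (insertLeft i N i σ (suc m ∷ R)) ≈
          p ∙ q ∙ u ∙ v ∙ w p q u 𝟙 s 𝟙 σ ∙ w p q 𝟙 v s t R
        w-insertLeft-last {m} {σ} {R} refl 1≤m σ∈ R∈ with proj₁ (∈-Sep⁻ {i} σ∈) | isPerm (∈-Av⁻ {n = m} 1≤k R∈)
        ... | pσ | pR with perm-nonempty 1≤i pσ | perm-nonempty 1≤m pR
        ... | _ , xs , refl | _ , rs , refl = begin
          w p q u v s t (insertLeft i N i σ (suc m ∷ R))
            ≡⟨ cong (w p q u v s t) (trans (insertLeft≡ m i σ [] R (sym (n∸n≡0 i))) (sym (++-assoc B [ N ] R))) ⟩
          w p q u v s t ((B ++ [ N ]) ++ R)
            ≈⟨ w-⊖ p q u v s t (map (m +_) xs ++ [ N ]) rs R≺M ⟩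
          q ∙ (w p q u v s 𝟙 (B ++ [ N ]) ∙ w p q 𝟙 v s t R)
            ≈⟨ K.*-congˡ (K.*-congʳ (K.trans (w-∷ʳmax p q u v s 𝟙 (map (m +_) xs) B≺N)
                 (K.*-congˡ (w-shift p q u 𝟙 s 𝟙 m σ)))) ⟩
          q ∙ (p ∙ u ∙ v ∙ 𝟙 ∙ w p q u 𝟙 s 𝟙 σ ∙ w p q 𝟙 v s t R)
            ≈⟨ solve 6 (λ p q u v x y → q ⊗ (p ⊗ u ⊗ v ⊗ ı ⊗ x ⊗ y) ⊜ p ⊗ q ⊗ u ⊗ v ⊗ x ⊗ y) K.refl p q u v _ _ ⟩
          p ∙ q ∙ u ∙ v ∙ w p q u 𝟙 s 𝟙 σ ∙ w p q 𝟙 v s t R ∎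
          where
          open ≈-Reasoning
          B = map (m +_) σ
          leR : ∀ {x} → x ∈ R → x ≤ m
          leR = proj₂ ∘ bounds pR
          R≺M : R ≺ B ++ [ N ]
          R≺M = ≺-∷ʳmax B (λ h → s≤s (≤-trans (leR h) (m≤m+n m i))) (shift-≺ leR pσ)
          B≺N : B ≺ [ N ]
          B≺N h (here refl) = shift-bounded pσ h

        -- For j = i the block is everything left of the maximum: the remainder starts with its
        -- maximum, and what follows ranges over a whole class `Av`. `w-topLeft` needs something
        -- left of the block, so the weight comes from a skew sum instead, and `s` survives.
        blockLeft-last : N ≢ suc i →
          ∑ (Sep i) (λ σ → ∑ (fList k (i ∸ i) (N ∸ i)) (λ ρ → w p q u v s t (insertLeft i N i σ ρ))) ≈
          p ∙ q ∙ u ∙ v ∙ X i p q u 𝟙 s 𝟙 ∙ sh (i + 1) (F₋ k p q 𝟙 v s t) N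
        blockLeft-last N≢ = K.trans (by-size (N ∸ i) refl) (K.*-congˡ (K.sym (K.trans
            (sh-vanishing (i + 1) (F₋ k p q 𝟙 v s t) N (F₋-0 1≤k p q 𝟙 v s t))
            (K.reflexive (cong (F₋ k p q 𝟙 v s t) (sym (∸-+-assoc N i 1)))))))
          where
          open ≈-Reasoning
          by-size : ∀ n → N ∸ i ≡ n →
            ∑ (Sep i) (λ σ → ∑ (fList k (i ∸ i) n) (λ ρ → w p q u v s t (insertLeft i N i σ ρ))) ≈
            p ∙ q ∙ u ∙ v ∙ X i p q u 𝟙 s 𝟙 ∙ F₋ k p q 𝟙 v s t (n ∸ 1)
          by-size zero _ = K.trans
            (∑-cong (Sep i) (λ _ → ∑-empty (fList k (i ∸ i) 0) _ λ x∈ →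
              case ∈-fList⁻ k (i ∸ i) 0 1≤k x∈ of λ { (_ , _ , _ , () , _) }))
            (K.trans (∑-0 (Sep i)) (K.sym (K.trans (K.*-congˡ (F₋-0 1≤k p q 𝟙 v s t)) (K.zeroʳ _))))
          by-size (suc zero) n≡ = contradiction (∸≡suc N i n≡) N≢
          by-size (suc m@(suc _)) n≡ = begin
            ∑ (Sep i) (λ σ → ∑ (fList k (i ∸ i) (suc m)) (λ ρ → w p q u v s t (insertLeft i N i σ ρ)))
              ≡⟨ cong (λ z → ∑ (Sep i) (λ σ → ∑ (fList k z (suc m)) (λ ρ → w p q u v s t (insertLeft i N i σ ρ)))) (n∸n≡0 i) ⟩
            ∑ (Sep i) (λ σ → ∑ (fList k 0 (suc m)) (λ ρ → w p q u v s t (insertLeft i N i σ ρ)))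
              ≈⟨ ∑-cong (Sep i) (λ σ∈ → K.trans (∑-consMax (≤-trans (m≤m+n 2 i) 2+i≤k) m _)
                   (∑-cong (Av k m) (w-insertLeft-last (∸≡suc N i n≡) (s≤s z≤n) σ∈))) ⟩
            ∑ (Sep i) (λ σ → ∑ (Av k m) (λ R → p ∙ q ∙ u ∙ v ∙ w p q u 𝟙 s 𝟙 σ ∙ w p q 𝟙 v s t R))
              ≈⟨ ∑-product (Sep i) (Av k m) _ _ ⟩
            ∑ (Sep i) (λ σ → p ∙ q ∙ u ∙ v ∙ w p q u 𝟙 s 𝟙 σ) ∙ F k p q 𝟙 v s t m
              ≈⟨ K.*-cong (∑-*ˡ _ (Sep i) _) (F₋-≥1 k p q 𝟙 v s t {m} (s≤s z≤n)) ⟨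
            p ∙ q ∙ u ∙ v ∙ X i p q u 𝟙 s 𝟙 ∙ F₋ k p q 𝟙 v s t m ∎

        sh-f : ∀ j i′ → sh j (f k i′ p q u v s t) N ≈ f k i′ p q u v s t (N ∸ j)
        sh-f j i′ = sh-vanishing j (f k i′ p q u v s t) N (f-0 i′ 1≤k p q u v s t)

        tail : Carrier
        tail = ∑ (oneTo (i ∸ 1)) (λ j → X j p q u 𝟙 𝟙 𝟙 ∙ sh j (f k (i ∸ j) p q u v s t) N)

        1≤i∸ : ∀ {j} → j ∈ oneTo (i ∸ 1) → 1 ≤ i ∸ j
        1≤i∸ j∈ = m<n⇒0<n∸m (≤-trans (s≤s (proj₂ (oneTo⁻ j∈))) (≤-reflexive (m+[n∸m]≡n 1≤i)))

        g₂-peel : g₂ N ≈ p ∙ q ∙ u ∙ v ∙ X i p q u 𝟙 s 𝟙 ∙ sh (i + 1) (F₋ k p q 𝟙 v s t) N ⊹ p ∙ tail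
        g₂-peel with N ≟ suc i
        ... | yes refl = K.trans g₂-first (K.sym (K.trans (K.+-cong
            (K.trans (K.*-congˡ (K.trans (sh-vanishing (i + 1) (F₋ k p q 𝟙 v s t) N (F₋-0 1≤k p q 𝟙 v s t))
              (K.trans (K.reflexive (cong (F₋ k p q 𝟙 v s t) (trans (cong (suc i ∸_) (+-comm i 1)) (n∸n≡0 (suc i)))))
                (F₋-0 1≤k p q 𝟙 v s t)))) (K.zeroʳ _))
            (K.trans (K.*-congˡ (K.trans (∑-cong (oneTo (i ∸ 1)) λ {j} j∈ → vanish j∈) (∑-0 (oneTo (i ∸ 1))))) (K.zeroʳ p)))
            (K.+-identityˡ 0#)))
          where
          vanish : ∀ {j} → j ∈ oneTo (i ∸ 1) → X j p q u 𝟙 𝟙 𝟙 ∙ sh j (f k (i ∸ j) p q u v s t) N ≈ 0#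
          vanish {j} j∈ = K.trans (K.*-congˡ (K.trans (sh-f j (i ∸ j)) (K.trans
            (K.reflexive (cong (f k (i ∸ j) p q u v s t) (+-∸-assoc 1 (≤-trans (proj₂ (oneTo⁻ j∈)) (m∸n≤m i 1)))))
            (f-first 1≤k (1≤i∸ j∈) p q u v s t)))) (K.zeroʳ _)
        ... | no N≢ = begin
          g₂ N
            ≈⟨ g₂-other N≢ ⟩
          g k i p q u v s t N
            ≈⟨ ∑-triples Sep (λ j → fList k (i ∸ j) (N ∸ j)) (w p q u v s t) (insertLeft i N)
                 (unique-gList k i N) (unique-oneTo i) unique-Sep (λ j → unique-fList k (i ∸ j) (N ∸ j))
                 (insertLeft-into 2+i≤k N≢)
                 (insertLeft-injective 2+i≤k N≢)
                 (insertLeft-onto 2+i≤k N≢) ⟩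
          ∑ (oneTo i) block
            -- The last index, j = i, is split off, since it alone exhausts the left part.
            ≡⟨ cong (λ js → ∑ js block) (trans (cong oneTo (sym (m+[n∸m]≡n 1≤i))) (oneTo-∷ʳ (i ∸ 1))) ⟩
          ∑ (oneTo (i ∸ 1) ++ [ suc (i ∸ 1) ]) block
            ≈⟨ ∑-++ (oneTo (i ∸ 1)) [ suc (i ∸ 1) ] block ⟩
          ∑ (oneTo (i ∸ 1)) block ⊹ (block (suc (i ∸ 1)) ⊹ 0#)
            ≈⟨ K.+-comm _ _ ⟩
          (block (suc (i ∸ 1)) ⊹ 0#) ⊹ ∑ (oneTo (i ∸ 1)) block
            ≈⟨ K.+-cong (K.trans (K.+-identityʳ _) (K.trans (K.reflexive (cong block (m+[n∸m]≡n 1≤i))) (blockLeft-last N≢)))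
                 (K.trans (∑-cong (oneTo (i ∸ 1)) step) (K.sym (∑-*ˡ p (oneTo (i ∸ 1)) _))) ⟩
          p ∙ q ∙ u ∙ v ∙ X i p q u 𝟙 s 𝟙 ∙ sh (i + 1) (F₋ k p q 𝟙 v s t) N ⊹ p ∙ tail ∎
          where
          open ≈-Reasoning
          block : ℕ → Carrier
          block j = ∑ (Sep j) (λ σ → ∑ (fList k (i ∸ j) (N ∸ j)) (λ ρ → w p q u v s t (insertLeft i N j σ ρ)))
          step : ∀ {j} → j ∈ oneTo (i ∸ 1) → block j ≈ p ∙ (X j p q u 𝟙 𝟙 𝟙 ∙ sh j (f k (i ∸ j) p q u v s t) N)
          step {j} j∈ = begin
            block j
              ≈⟨ ∑-cong (Sep j) (λ σ∈ → ∑-cong (fList k (i ∸ j) (N ∸ j))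
                   (w-insertLeft N≢ j (proj₁ (oneTo⁻ j∈)) (1≤i∸ j∈) σ∈)) ⟩
            ∑ (Sep j) (λ σ → ∑ (fList k (i ∸ j) (N ∸ j)) (λ ρ → p ∙ w p q u 𝟙 𝟙 𝟙 σ ∙ w p q u v s t ρ))
              ≈⟨ ∑-product (Sep j) (fList k (i ∸ j) (N ∸ j)) _ _ ⟩
            ∑ (Sep j) (λ σ → p ∙ w p q u 𝟙 𝟙 𝟙 σ) ∙ f k (i ∸ j) p q u v s t (N ∸ j)
              ≈⟨ K.*-cong (∑-*ˡ p (Sep j) _) (sh-f j (i ∸ j)) ⟨
            p ∙ X j p q u 𝟙 𝟙 𝟙 ∙ sh j (f k (i ∸ j) p q u v s t) N
              ≈⟨ K.*-assoc _ _ _ ⟩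
            p ∙ (X j p q u 𝟙 𝟙 𝟙 ∙ sh j (f k (i ∸ j) p q u v s t) N) ∎

-- The recurrences

-- This is the condition of `AvoidsP` at the maximum, which has all of `L` below it; it is the
-- reason why i stops at k - 2.
left-bounded : ∀ {k m} L R → AvoidsP k noneSeen (L ++ suc m ∷ R) → (∀ {x} → x ∈ L → x < suc m) → 2 + length L ≤ k
left-bounded {k} L R a h = subst (λ n → 2 + n ≤ k) (trans (+-identityʳ _) (below-all L h)) (proj₁ (proj₂ (avoidsP-++⁻ L a)))

module _ {k m : ℕ} {L R : List ℕ} (c : Conf k (length L) m L R) where

  private
    inRight : Bool
    inRight = (suc m <ᵇ 2) ∨ elemᵇ m R

  condF≡ : ∀ i → condF (suc m) i (L ++ suc m ∷ R) ≡ (length L ≡ᵇ i) ∧ inRight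
  condF≡ i rewrite index≡ c | drop-prefix L {suc m} {R} = refl

  -- For m ≥ 1 the entry `m` occurs exactly once, either in `L` or in `R`, so for a fixed i the
  -- conditions for f and g are complementary. For m = 0 only f applies.
  condG≡ : ∀ i → condG (suc m) i (L ++ suc m ∷ R) ≡ (length L ≡ᵇ i) ∧ not inRight
  condG≡ i rewrite index≡ c | take-prefix L {suc m ∷ R} = by-size m refl
    where
    side : ∀ m′ → m ≡ suc m′ → elemᵇ m L ≡ not (elemᵇ m R)
    side m′ refl with elemᵇ m L in eL | elemᵇ m R in eR
    ... | true | false = refl
    ... | false | true = refl
    ... | true | true = ⊥-elim (unique-disjoint L (distinct (perm-LR c))
      (elem⁻ {m} L (Equivalence.from T-≡ eL)) (elem⁻ {m} R (Equivalence.from T-≡ eR)))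
    ... | false | false with ∈-++⁻ L (perm-max∈ (perm-LR c))
    ... | inj₁ p = ⊥-elim (subst T eL (elem⁺ p))
    ... | inj₂ p = ⊥-elim (subst T eR (elem⁺ p))
    by-size : ∀ m′ → m ≡ m′ → (2 ≤ᵇ suc m′) ∧ (length L ≡ᵇ i) ∧ elemᵇ m L ≡ (length L ≡ᵇ i) ∧ not ((suc m′ <ᵇ 2) ∨ elemᵇ m R)
    by-size zero _ = sym (∧-zeroʳ _)
    by-size (suc m′) e = cong ((length L ≡ᵇ i) ∧_) (side m′ e)

module Identities {c ℓ : Level} (𝓡 : CommutativeRing c ℓ) where
  open Sums 𝓡
  open Recursion 𝓡 hiding (F₁)
  open CommutativeRing 𝓡 using (Carrier; _≈_; 0#; 1#; _-_) renaming (_+_ to infixl 6 _⊹_; _*_ to infixl 7 _∙_)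
  open GF 𝓡
  open import Algebra.Solver.CommutativeMonoid K.*-commutativeMonoid using (solve; _⊜_) renaming (_⊕_ to infixl 7 _⊗_; id to ı)
  import Algebra.Properties.Ring K.ring as RingP
  import Relation.Binary.Reasoning.Setoid K.setoid as ≈-Reasoning

  ∑-select : ∀ {A : Set} (P : A → Bool) xs h → ∑ (select P xs) h ≈ ∑ xs (λ x → if P x then h x else 0#)
  ∑-select P [] h = K.refl
  ∑-select P (x ∷ xs) h with P x
  ... | true = K.+-congˡ (∑-select P xs h)
  ... | false = K.trans (∑-select P xs h) (K.sym (K.+-identityˡ _))

  ∑-delta : ∀ {js l} a → Unique js → l ∈ js → ∑ js (λ i → if l ≡ᵇ i then a else 0#) ≈ a
  ∑-delta {j ∷ js} a (j∉ ∷ _) (here refl) = K.trans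
    (K.+-cong (K.reflexive (cong (λ b → if b then a else 0#) (Equivalence.to T-≡ (≡⇒≡ᵇ j j refl))))
      (K.trans (∑-cong js λ {i} i∈ → off i (λ e → All.lookup j∉ i∈ e)) (∑-0 js)))
    (K.+-identityʳ a)
    where
    off : ∀ i → j ≢ i → (if j ≡ᵇ i then a else 0#) ≈ 0#
    off i j≢i with j ≡ᵇ i in e
    ... | false = K.refl
    ... | true = contradiction (≡ᵇ⇒≡ j i (Equivalence.from T-≡ e)) j≢i
  ∑-delta {j ∷ js} {l} a (j∉ ∷ u) (there l∈) = K.trans (K.+-cong off (∑-delta a u l∈)) (K.+-identityˡ a)
    where
    off : (if l ≡ᵇ j then a else 0#) ≈ 0#
    off with l ≡ᵇ j in e
    ... | false = K.refl
    ... | true = contradiction (sym (≡ᵇ⇒≡ l j (Equivalence.from T-≡ e))) (All.lookup j∉ l∈)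

  -- Both conditions become indicators and the sums over i and over permutations are exchanged. Each
  -- permutation is then met by a delta at i = `length L`, an index that `left-bounded` places in
  -- the range.
  F-decomposition : ∀ {k} → 2 ≤ k → ∀ p q u v s t →
    F k p q u v s t ≐ oneS ⊕ ssum (range 0 (k ∸ 2)) (λ i → f k i p q u v s t ⊕ g k i p q u v s t)
  F-decomposition {k} 2≤k p q u v s t zero = K.trans (F-0 1≤k p q u v s t) (K.sym (K.trans
    (K.+-congˡ (K.trans (∑-cong (range 0 (k ∸ 2)) λ {i} _ → K.trans
      (K.+-cong (f-0 i 1≤k p q u v s t) (g-0 i 1≤k p q u v s t)) (K.+-identityˡ 0#)) (∑-0 (range 0 (k ∸ 2)))))
    (K.+-identityʳ 1#)))
    where 1≤k = 2≤⇒1≤ 0 2≤k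
  F-decomposition {k} 2≤k p q u v s t (suc m) = K.sym (begin
    0# ⊹ ∑ js (λ i → f k i p q u v s t n ⊹ g k i p q u v s t n)
      ≈⟨ K.+-identityˡ _ ⟩
    ∑ js (λ i → f k i p q u v s t n ⊹ g k i p q u v s t n)
      ≈⟨ ∑-cong js (λ {i} _ → K.trans (K.+-cong (∑-select (condF n i) (Av k n) W) (∑-select (condG n i) (Av k n) W))
           (K.sym (∑-+ (Av k n) _ _))) ⟩
    ∑ js (λ i → ∑ (Av k n) (λ π → (if condF n i π then W π else 0#) ⊹ (if condG n i π then W π else 0#)))
      ≈⟨ ∑-swap js (Av k n) _ ⟩
    ∑ (Av k n) (λ π → ∑ js (λ i → (if condF n i π then W π else 0#) ⊹ (if condG n i π then W π else 0#)))
      ≈⟨ ∑-cong (Av k n) once ⟩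
    F k p q u v s t n ∎)
    where
    open ≈-Reasoning
    n = suc m
    js = range 0 (k ∸ 2)
    W = w p q u v s t
    exactlyOne : ∀ b r a → (if b ∧ r then a else 0#) ⊹ (if b ∧ not r then a else 0#) ≈ (if b then a else 0#)
    exactlyOne false r a = K.+-identityˡ 0#
    exactlyOne true true a = K.+-identityʳ a
    exactlyOne true false a = K.+-identityˡ a
    once : ∀ {π} → π ∈ Av k n →
      ∑ js (λ i → (if condF n i π then W π else 0#) ⊹ (if condG n i π then W π else 0#)) ≈ W π
    once π∈ with ∈Av⇒conf {m = m} (2≤⇒1≤ 0 2≤k) π∈
    ... | L , R , refl , c = K.trans
      (∑-cong js λ {i} _ → K.trans
        (K.reflexive (cong₂ (λ a b → (if a then W (L ++ n ∷ R) else 0#) ⊹ (if b then W (L ++ n ∷ R) else 0#)) (condF≡ c i) (condG≡ c i)))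
        (exactlyOne (length L ≡ᵇ i) _ _))
      (∑-delta _ (UniqueP.map⁺ id (UniqueP.upTo⁺ _)) (∈-map⁺ (0 +_) (∈-upTo⁺ (s≤s
        (m+n≤o⇒m≤o∸n (length L) (subst (_≤ k) (+-comm 2 (length L))
          (left-bounded L R (avoiding c) (λ h → s≤s (≤m c (∈-++⁺ˡ h))))))))))

  -- Convolution, scaling and shift of power series

  ∑-upTo-∷ʳ : ∀ n h → ∑ (upTo (suc n)) h ≈ ∑ (upTo n) h ⊹ h n
  ∑-upTo-∷ʳ n h = K.trans (K.reflexive (cong (λ js → ∑ js h) (sym (upTo-∷ʳ n))))
    (K.trans (∑-++ (upTo n) [ n ] h) (K.+-congˡ (K.+-identityʳ _)))

  ⊛-cong : ∀ a {b b′} → b ≐ b′ → a ⊛ b ≐ a ⊛ b′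
  ⊛-cong a e n = ∑-cong (upTo (suc n)) λ {j} _ → K.*-congˡ (e (n ∸ j))

  ⊛-⊕ : ∀ a b b′ → a ⊛ (b ⊕ b′) ≐ (a ⊛ b) ⊕ (a ⊛ b′)
  ⊛-⊕ a b b′ n = K.trans (∑-cong (upTo (suc n)) λ _ → K.distribˡ _ _ _) (∑-+ (upTo (suc n)) _ _)

  ⊛-scale : ∀ a x b → a ⊛ scale x b ≐ scale x (a ⊛ b)
  ⊛-scale a x b n = K.trans
    (∑-cong (upTo (suc n)) λ {j} _ → solve 3 (λ a x b → a ⊗ (x ⊗ b) ⊜ x ⊗ (a ⊗ b)) K.refl (a j) x (b (n ∸ j)))
    (K.sym (∑-*ˡ x (upTo (suc n)) _))

  ⊛-⊖ : ∀ a b b′ → a ⊛ (b ⊖ b′) ≐ (a ⊛ b) ⊖ (a ⊛ b′)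
  ⊛-⊖ a b b′ n = K.trans (⊛-cong a {b ⊖ b′} {b ⊕ scale (K.- 1#) b′} (λ m → K.+-congˡ (K.sym (RingP.-1*x≈-x (b′ m)))) n)
    (K.trans (⊛-⊕ a b (scale (K.- 1#) b′) n) (K.+-congˡ (K.trans (⊛-scale a (K.- 1#) b′ n) (RingP.-1*x≈-x _))))

  sh-cong : ∀ m {a b} → a ≐ b → sh m a ≐ sh m b
  sh-cong m e n with m ≤ᵇ n
  ... | true = e (n ∸ m)
  ... | false = K.refl

  sh-scale : ∀ m x a → sh m (scale x a) ≐ scale x (sh m a)
  sh-scale m x a n with m ≤ᵇ n
  ... | true = K.refl
  ... | false = K.sym (K.zeroʳ x)

  sh-⊕ : ∀ m a b → sh m (a ⊕ b) ≐ sh m a ⊕ sh m b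
  sh-⊕ m a b n with m ≤ᵇ n
  ... | true = K.refl
  ... | false = K.sym (K.+-identityˡ 0#)

  sh-ssum : ∀ m js a → sh m (ssum js a) ≐ ssum js (λ j → sh m (a j))
  sh-ssum m js a n with m ≤ᵇ n
  ... | true = K.refl
  ... | false = K.sym (∑-0 js)

  sh-suc : ∀ m a → sh (suc m) a ≐ sh 1 (sh m a)
  sh-suc m a zero = K.refl
  sh-suc zero a (suc n) = K.refl
  sh-suc (suc m) a (suc n) = K.refl

  sh-sh : ∀ j m a → sh j (sh m a) ≐ sh (j + m) a
  sh-sh zero m a n = K.refl
  sh-sh (suc j) m a n = K.trans (sh-suc j (sh m a) n) (K.trans (sh-cong 1 (sh-sh j m a) n) (K.sym (sh-suc (j + m) a n)))

  ⊛-sh₁ : ∀ a b → a ⊛ sh 1 b ≐ sh 1 (a ⊛ b)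
  ⊛-sh₁ a b zero = K.trans (K.+-identityʳ _) (K.zeroʳ _)
  -- The last index n + 1 meets the constant term of `sh 1 b`, which is 0, so the sum shortens to
  -- the one for `b`.
  ⊛-sh₁ a b (suc n) = K.trans (∑-upTo-∷ʳ (suc n) _) (K.trans
    (K.+-cong (∑-cong (upTo (suc n)) λ j∈ → K.*-congˡ (K.reflexive (cong (sh 1 b) (+-∸-assoc 1 (≤-pred (∈-upTo⁻ j∈))))))
      (K.trans (K.*-congˡ (K.reflexive (cong (sh 1 b) (n∸n≡0 n)))) (K.zeroʳ _)))
    (K.+-identityʳ _))

  ⊛-sh : ∀ m a b → a ⊛ sh m b ≐ sh m (a ⊛ b)
  ⊛-sh zero a b n = K.refl
  ⊛-sh (suc m) a b n = K.trans (⊛-cong a (sh-suc m b) n) (K.trans (⊛-sh₁ a (sh m b) n)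
    (K.trans (sh-cong 1 (⊛-sh m a b) n) (K.sym (sh-suc m (a ⊛ b) n))))

  ⊛-mono : ∀ m a x → a ⊛ mono m x ≐ scale x (sh m a)
  ⊛-mono zero a x n = K.trans (∑-upTo-∷ʳ n _) (K.trans
    (K.+-cong
      (K.trans (∑-cong (upTo n) λ j∈ → K.trans (K.*-congˡ (mono-≢ 0 x (m>n⇒m∸n≢0 (∈-upTo⁻ j∈)))) (K.zeroʳ _)) (∑-0 (upTo n)))
      (K.*-congˡ (K.trans (K.reflexive (cong (mono 0 x) (n∸n≡0 n))) (mono-≡ 0 x))))
    (K.trans (K.+-identityˡ _) (K.*-comm _ _)))
  ⊛-mono (suc m) a x n = K.trans (⊛-cong a mono-suc n) (K.trans (⊛-sh₁ a (mono m x) n)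
    (K.trans (sh-cong 1 (⊛-mono m a x) n) (K.trans (sh-scale 1 x (sh m a) n) (K.*-congˡ (K.sym (sh-suc m a n))))))
    where
    mono-suc : mono (suc m) x ≐ sh 1 (mono m x)
    mono-suc zero = K.refl
    mono-suc (suc n) = K.refl

  x≈y+[x-y] : ∀ x y → x ≈ y ⊹ (x - y)
  x≈y+[x-y] x y = K.sym (K.trans (K.+-comm _ _) (K.trans (K.+-assoc _ _ _)
    (K.trans (K.+-congˡ (K.-‿inverseˡ y)) (K.+-identityʳ x))))

  -- Substituting each peeling identity into the other, and the case k = 2

  module _ (p q u v s t : Carrier) where

    f≈ : ∀ {k i} (1≤i : 1 ≤ i) (2+i≤k : 2 + i ≤ k) → f k i p q u v s t ≐
      scale (p · q · u · v · X i p q u 𝟙 s t) (sh (i + 1) (F₋ (k ∸ i) p q 𝟙 v 𝟙 t))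
      ⊕ scale q (F₋ (k ∸ i) p q 𝟙 v 𝟙 𝟙 ⊛ g₂ p q u v s t 1≤i 2+i≤k)
    f≈ {k} {i} 1≤i 2+i≤k n = K.trans (f-peel p q u v s t 1≤i 2+i≤k n) (K.+-congʳ (⊛-mono (i + 1) (F₋ (k ∸ i) p q 𝟙 v 𝟙 t) (p · q · u · v · X i p q u 𝟙 s t) n))

    f-recurrence : ∀ {k i} → 1 ≤ i → 2 + i ≤ k → f k i p q u v s t ≐
      scale (p · q · u · v) (sh (i + 1) (scale (X i p q u 𝟙 s t) (F₋ (k ∸ i) p q 𝟙 v 𝟙 t)))
      ⊕ scale (p · q · q · u · v) (sh (i + 1) (scale (X i p q u 𝟙 s 𝟙)
          (F₋ (k ∸ i) p q 𝟙 v 𝟙 𝟙 ⊛ F₋ k p q 𝟙 v s t)))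
      ⊕ scale (p · q) (F₋ (k ∸ i) p q 𝟙 v 𝟙 𝟙 ⊛
          ssum (range 1 (i ∸ 1)) (λ j → scale (X j p q u 𝟙 𝟙 𝟙) (sh j (f k (i ∸ j) p q u v s t))))
    f-recurrence {k} {i} 1≤i 2+i≤k n = begin
      f k i p q u v s t n
        ≈⟨ f≈ 1≤i 2+i≤k n ⟩
      p ∙ q ∙ u ∙ v ∙ Xt ∙ sh (i + 1) Ft n ⊹ q ∙ (F₁ ⊛ g₂ p q u v s t 1≤i 2+i≤k) n
        ≈⟨ K.+-congˡ (K.*-congˡ (⊛-cong F₁ (g₂-peel p q u v s t 1≤i 2+i≤k) n)) ⟩
      p ∙ q ∙ u ∙ v ∙ Xt ∙ sh (i + 1) Ft n ⊹ q ∙ (F₁ ⊛ (scale (p ∙ q ∙ u ∙ v ∙ X₁) (sh (i + 1) Fk) ⊕ scale p rest)) n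
        ≈⟨ K.+-congˡ (K.*-congˡ (K.trans (⊛-⊕ F₁ (scale (p ∙ q ∙ u ∙ v ∙ X₁) (sh (i + 1) Fk)) (scale p rest) n) (K.+-cong
             (K.trans (⊛-scale F₁ (p ∙ q ∙ u ∙ v ∙ X₁) (sh (i + 1) Fk) n) (K.*-congˡ (⊛-sh (i + 1) F₁ Fk n))) (⊛-scale F₁ p rest n)))) ⟩
      p ∙ q ∙ u ∙ v ∙ Xt ∙ sh (i + 1) Ft n ⊹ q ∙ (p ∙ q ∙ u ∙ v ∙ X₁ ∙ sh (i + 1) (F₁ ⊛ Fk) n ⊹ p ∙ (F₁ ⊛ rest) n)
        ≈⟨ K.+-congˡ (K.distribˡ q _ _) ⟩
      p ∙ q ∙ u ∙ v ∙ Xt ∙ sh (i + 1) Ft n ⊹ (q ∙ (p ∙ q ∙ u ∙ v ∙ X₁ ∙ sh (i + 1) (F₁ ⊛ Fk) n) ⊹ q ∙ (p ∙ (F₁ ⊛ rest) n))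
        ≈⟨ K.+-assoc _ _ _ ⟨
      p ∙ q ∙ u ∙ v ∙ Xt ∙ sh (i + 1) Ft n ⊹ q ∙ (p ∙ q ∙ u ∙ v ∙ X₁ ∙ sh (i + 1) (F₁ ⊛ Fk) n) ⊹ q ∙ (p ∙ (F₁ ⊛ rest) n)
        ≈⟨ K.+-cong (K.+-cong
             (K.trans (K.*-assoc _ _ _) (K.*-congˡ (K.sym (sh-scale (i + 1) Xt Ft n))))
             (K.trans (solve 6 (λ p q u v x y → q ⊗ (p ⊗ q ⊗ u ⊗ v ⊗ x ⊗ y) ⊜ p ⊗ q ⊗ q ⊗ u ⊗ v ⊗ (x ⊗ y)) K.refl p q u v _ _)
               (K.*-congˡ (K.sym (sh-scale (i + 1) X₁ (F₁ ⊛ Fk) n)))))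
             (solve 3 (λ p q x → q ⊗ (p ⊗ x) ⊜ p ⊗ q ⊗ x) K.refl p q _) ⟩
      _ ∎
      where
      open ≈-Reasoning
      Xt = X i p q u 𝟙 s t
      X₁ = X i p q u 𝟙 s 𝟙
      Ft = F₋ (k ∸ i) p q 𝟙 v 𝟙 t
      F₁ = F₋ (k ∸ i) p q 𝟙 v 𝟙 𝟙
      Fk = F₋ k p q 𝟙 v s t
      rest : Series
      rest = ssum (range 1 (i ∸ 1)) (λ j → scale (X j p q u 𝟙 𝟙 𝟙) (sh j (f k (i ∸ j) p q u v s t)))

    -- `shortest` is split off, and each f at i - j in `g₂-peel` is expanded by the peeling identity
    -- `f≈`, not by `f-recurrence`. The expansion thus stops at `g₂` for the smaller index i - j.
    g-recurrence : ∀ {k i} → 1 ≤ i → 2 + i ≤ k → g k i p q u v s t ≐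
      mono (i + 1) (p · u · v · t · X i p q u 𝟙 s t)
      ⊕ scale (p · q · u · v · X i p q u 𝟙 s 𝟙) (sh (i + 1) (F₋ k p q 𝟙 v s t))
      ⊕ scale (p · p · q · u · v) (sh (i + 1) (ssum (range 1 (i ∸ 1)) (λ j →
          scale (X j p q u 𝟙 𝟙 𝟙 · X (i ∸ j) p q u 𝟙 s t) (F₋ (k ∸ i + j) p q 𝟙 v 𝟙 t))))
      ⊕ scale (p · q) (ssum (range 1 (i ∸ 1)) (λ j →
          scale (X j p q u 𝟙 𝟙 𝟙) (sh j (F₋ (k ∸ i + j) p q 𝟙 v 𝟙 𝟙 ⊛
            (g k (i ∸ j) p q u v s t ⊖ mono (i ∸ j + 1) (p · u · v · t · X (i ∸ j) p q u 𝟙 s t))))))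
    g-recurrence {k} {i} 1≤i 2+i≤k n = begin
      g k i p q u v s t n
        ≈⟨ x≈y+[x-y] _ _ ⟩
      first ⊹ g₂ p q u v s t 1≤i 2+i≤k n
        ≈⟨ K.+-congˡ (g₂-peel p q u v s t 1≤i 2+i≤k n) ⟩
      first ⊹ (second ⊹ p ∙ ∑ js (λ j → X j p q u 𝟙 𝟙 𝟙 ∙ sh j (f k (i ∸ j) p q u v s t) n))
        ≈⟨ K.+-assoc _ _ _ ⟨
      first ⊹ second ⊹ p ∙ ∑ js (λ j → X j p q u 𝟙 𝟙 𝟙 ∙ sh j (f k (i ∸ j) p q u v s t) n)
        ≈⟨ K.+-congˡ (K.*-congˡ (∑-cong js λ {j} j∈ → K.trans (K.*-congˡ (expand j∈)) (K.distribˡ _ _ _))) ⟩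
      first ⊹ second ⊹ p ∙ ∑ js (λ j → X j p q u 𝟙 𝟙 𝟙 ∙ (p ∙ q ∙ u ∙ v ∙ X (i ∸ j) p q u 𝟙 s t ∙ sh (i + 1) (Ft j) n)
                                     ⊹ X j p q u 𝟙 𝟙 𝟙 ∙ (q ∙ sh j (F₁ j ⊛ G j) n))
        ≈⟨ K.+-congˡ (K.trans (K.*-congˡ (∑-+ js _ _)) (K.distribˡ p _ _)) ⟩
      first ⊹ second ⊹ (p ∙ ∑ js (λ j → X j p q u 𝟙 𝟙 𝟙 ∙ (p ∙ q ∙ u ∙ v ∙ X (i ∸ j) p q u 𝟙 s t ∙ sh (i + 1) (Ft j) n))
                      ⊹ p ∙ ∑ js (λ j → X j p q u 𝟙 𝟙 𝟙 ∙ (q ∙ sh j (F₁ j ⊛ G j) n)))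
        ≈⟨ K.+-assoc _ _ _ ⟨
      first ⊹ second ⊹ p ∙ ∑ js (λ j → X j p q u 𝟙 𝟙 𝟙 ∙ (p ∙ q ∙ u ∙ v ∙ X (i ∸ j) p q u 𝟙 s t ∙ sh (i + 1) (Ft j) n))
                     ⊹ p ∙ ∑ js (λ j → X j p q u 𝟙 𝟙 𝟙 ∙ (q ∙ sh j (F₁ j ⊛ G j) n))
        ≈⟨ K.+-cong (K.+-congˡ third) fourth ⟩
      _ ∎
      where
      open ≈-Reasoning
      js = range 1 (i ∸ 1)
      first = mono (i + 1) (p · u · v · t · X i p q u 𝟙 s t) n
      second = p ∙ q ∙ u ∙ v ∙ X i p q u 𝟙 s 𝟙 ∙ sh (i + 1) (F₋ k p q 𝟙 v s t) n
      Ft F₁ G : ℕ → Series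
      Ft j = F₋ (k ∸ i + j) p q 𝟙 v 𝟙 t
      F₁ j = F₋ (k ∸ i + j) p q 𝟙 v 𝟙 𝟙
      -- This is `g₂` at i - j by computation, so it matches the last factor in `f≈`.
      G j = g k (i ∸ j) p q u v s t ⊖ mono (i ∸ j + 1) (p · u · v · t · X (i ∸ j) p q u 𝟙 s t)
      i≤k : i ≤ k
      i≤k = ≤-trans (m≤n+m i 2) 2+i≤k
      expand : ∀ {j} → j ∈ js → sh j (f k (i ∸ j) p q u v s t) n ≈
        p ∙ q ∙ u ∙ v ∙ X (i ∸ j) p q u 𝟙 s t ∙ sh (i + 1) (Ft j) n ⊹ q ∙ sh j (F₁ j ⊛ G j) n
      expand {j} j∈ = begin
        sh j (f k (i ∸ j) p q u v s t) n
          ≈⟨ sh-cong j (f≈ (m<n⇒0<n∸m j<i) (≤-trans (+-monoʳ-≤ 2 (m∸n≤m i j)) 2+i≤k)) n ⟩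
        sh j (body (k ∸ (i ∸ j))) n
          ≡⟨ cong (λ l → sh j (body l) n) k∸i+j ⟩
        sh j (body (k ∸ i + j)) n
          ≈⟨ sh-⊕ j (scale cⱼ (sh (i ∸ j + 1) (Ft j))) (scale q (F₁ j ⊛ G j)) n ⟩
        sh j (scale cⱼ (sh (i ∸ j + 1) (Ft j))) n ⊹ sh j (scale q (F₁ j ⊛ G j)) n
          ≈⟨ K.+-cong (K.trans (sh-scale j cⱼ (sh (i ∸ j + 1) (Ft j)) n) (K.*-congˡ (K.trans (sh-sh j (i ∸ j + 1) (Ft j) n)
               (K.reflexive (cong (λ l → sh l (Ft j) n) (trans (sym (+-assoc j (i ∸ j) 1)) (cong (_+ 1) (m+[n∸m]≡n (<⇒≤ j<i))))))))
             ) (sh-scale j q (F₁ j ⊛ G j) n) ⟩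
        cⱼ ∙ sh (i + 1) (Ft j) n ⊹ q ∙ sh j (F₁ j ⊛ G j) n ∎
        where
        cⱼ = p ∙ q ∙ u ∙ v ∙ X (i ∸ j) p q u 𝟙 s t
        j<i : j < i
        j<i = ≤-trans (s≤s (proj₂ (oneTo⁻ j∈))) (≤-reflexive (m+[n∸m]≡n 1≤i))
        body : ℕ → Series
        body l = scale cⱼ (sh (i ∸ j + 1) (F₋ l p q 𝟙 v 𝟙 t)) ⊕ scale q (F₋ l p q 𝟙 v 𝟙 𝟙 ⊛ G j)
        -- Origin of the index k - i + j: the left part has shrunk to i - j entries, and the block
        -- on the right avoids P with its index lowered by that number.
        k∸i+j : k ∸ (i ∸ j) ≡ k ∸ i + j
        k∸i+j = sym (trans (sym (+-∸-comm j i≤k))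
          (trans (cong₂ _∸_ (+-comm k j) (sym (m+[n∸m]≡n (<⇒≤ j<i)))) ([m+n]∸[m+o]≡n∸o j k (i ∸ j))))
      third : p ∙ ∑ js (λ j → X j p q u 𝟙 𝟙 𝟙 ∙ (p ∙ q ∙ u ∙ v ∙ X (i ∸ j) p q u 𝟙 s t ∙ sh (i + 1) (Ft j) n)) ≈
        p ∙ p ∙ q ∙ u ∙ v ∙ sh (i + 1) (ssum js (λ j → scale (X j p q u 𝟙 𝟙 𝟙 · X (i ∸ j) p q u 𝟙 s t) (Ft j))) n
      third = K.trans (∑-*ˡ p js _) (K.trans
        (∑-cong js λ {j} _ → K.trans
          (solve 7 (λ p q u v x y z → p ⊗ (x ⊗ (p ⊗ q ⊗ u ⊗ v ⊗ y ⊗ z)) ⊜ p ⊗ p ⊗ q ⊗ u ⊗ v ⊗ (x ⊗ y ⊗ z)) K.refl p q u v _ _ _)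
          (K.*-congˡ (K.sym (sh-scale (i + 1) (X j p q u 𝟙 𝟙 𝟙 · X (i ∸ j) p q u 𝟙 s t) (Ft j) n))))
        (K.trans (K.sym (∑-*ˡ _ js _)) (K.*-congˡ (K.sym (sh-ssum (i + 1) js (λ j → scale (X j p q u 𝟙 𝟙 𝟙 · X (i ∸ j) p q u 𝟙 s t) (Ft j)) n)))))
      fourth : p ∙ ∑ js (λ j → X j p q u 𝟙 𝟙 𝟙 ∙ (q ∙ sh j (F₁ j ⊛ G j) n)) ≈
        p ∙ q ∙ ∑ js (λ j → X j p q u 𝟙 𝟙 𝟙 ∙ sh j (F₁ j ⊛ G j) n)
      fourth = K.trans (K.*-congˡ (K.trans
        (∑-cong js λ _ → solve 3 (λ q x y → x ⊗ (q ⊗ y) ⊜ q ⊗ (x ⊗ y)) K.refl q _ _) (K.sym (∑-*ˡ q js _))))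
        (K.sym (K.*-assoc _ _ _))

    -- A permutation avoiding P_2 is decreasing, so its first entry is its only left-to-right
    -- maximum and `u` occurs to the first power. Formally, `u` enters the right side of `f₀≈` only
    -- as a factor.
    f₂₀-linear : scale u (F₋ 2 p q 𝟙 v s t) ≐ f 2 0 p q u v s t
    f₂₀-linear n = begin
      u ∙ F₋ 2 p q 𝟙 v s t n
        ≈⟨ K.*-congˡ (K.trans (K.+-congʳ (F-decomposition ≤-refl p q 𝟙 v s t n)) (K.trans (K.+-congʳ (K.+-comm _ _))
             (K.trans (K.+-assoc _ _ _) (K.trans (K.+-congˡ (K.-‿inverseʳ _)) (K.+-identityʳ _))))) ⟩
      u ∙ (f 2 0 p q 𝟙 v s t n ⊹ g 2 0 p q 𝟙 v s t n ⊹ 0#)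
        ≈⟨ K.*-congˡ (K.trans (K.+-identityʳ _) (K.trans (K.+-congˡ (g₀≈0 {2} (s≤s z≤n) p q 𝟙 v s t n)) (K.+-identityʳ _))) ⟩
      u ∙ f 2 0 p q 𝟙 v s t n
        ≈⟨ K.*-congˡ (f₀≈ p q 𝟙 v s t {2} ≤-refl n) ⟩
      u ∙ (mono 1 (𝟙 · v · s · t) n ⊹ q ∙ 𝟙 ∙ v ∙ s ∙ sh 1 (F₋ 2 p q 𝟙 v s t) n)
        ≈⟨ K.distribˡ u _ _ ⟩
      u ∙ mono 1 (𝟙 · v · s · t) n ⊹ u ∙ (q ∙ 𝟙 ∙ v ∙ s ∙ sh 1 (F₋ 2 p q 𝟙 v s t) n)
        ≈⟨ K.+-cong mono-linear (solve 5 (λ q u v s x → u ⊗ (q ⊗ ı ⊗ v ⊗ s ⊗ x) ⊜ q ⊗ u ⊗ v ⊗ s ⊗ x) K.refl q u v s _) ⟩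
      mono 1 (u · v · s · t) n ⊹ q ∙ u ∙ v ∙ s ∙ sh 1 (F₋ 2 p q 𝟙 v s t) n
        ≈⟨ f₀≈ p q u v s t {2} ≤-refl n ⟨
      f 2 0 p q u v s t n ∎
      where
      open ≈-Reasoning
      mono-linear : u ∙ mono 1 (𝟙 · v · s · t) n ≈ mono 1 (u · v · s · t) n
      mono-linear with n ≡ᵇ 1
      ... | false = K.zeroʳ u
      ... | true = solve 4 (λ u v s t → u ⊗ (ı ⊗ v ⊗ s ⊗ t) ⊜ u ⊗ v ⊗ s ⊗ t) K.refl u v s t

    -- By `f₂₀-linear` the initial condition closes up to f = uvstx + qvsx f. The fraction is
    -- expressed by multiplying with its denominator 1 - qvsx.
    f₂₀-closed : f 2 0 p q u v s t ⊛ (oneS ⊖ mono 1 (q · v · s)) ≐ mono 1 (u · v · s · t)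
    f₂₀-closed n = begin
      (f 2 0 p q u v s t ⊛ (oneS ⊖ mono 1 (q · v · s))) n
        ≈⟨ ⊛-⊖ (f 2 0 p q u v s t) oneS (mono 1 (q · v · s)) n ⟩
      (f 2 0 p q u v s t ⊛ oneS) n - (f 2 0 p q u v s t ⊛ mono 1 (q · v · s)) n
        ≈⟨ K.+-cong (K.trans (⊛-mono 0 (f 2 0 p q u v s t) 1# n) (K.*-identityˡ _)) (K.-‿cong (⊛-mono 1 (f 2 0 p q u v s t) (q · v · s) n)) ⟩
      f 2 0 p q u v s t n - q ∙ v ∙ s ∙ sh 1 (f 2 0 p q u v s t) n
        ≈⟨ K.+-cong (f₀≈ p q u v s t {2} ≤-refl n) (K.-‿cong (K.trans
             (K.*-congˡ (K.trans (K.sym (sh-cong 1 f₂₀-linear n)) (sh-scale 1 u (F₋ 2 p q 𝟙 v s t) n)))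
             (solve 5 (λ q u v s x → q ⊗ v ⊗ s ⊗ (u ⊗ x) ⊜ q ⊗ u ⊗ v ⊗ s ⊗ x) K.refl q u v s _))) ⟩
      mono 1 (u · v · s · t) n ⊹ y - y
        ≈⟨ K.trans (K.+-assoc _ _ _) (K.trans (K.+-congˡ (K.-‿inverseʳ y)) (K.+-identityʳ _)) ⟩
      mono 1 (u · v · s · t) n ∎
      where
      open ≈-Reasoning
      y = q ∙ u ∙ v ∙ s ∙ sh 1 (F₋ 2 p q 𝟙 v s t) n

theorem3p1 : {c ℓ : Level} (R : CommutativeRing c ℓ) →
    let open GF R in
    (k : ℕ) → 2 ≤ k → (p q u v s t : Elt) →
    (F k p q u v s t ≐ oneS ⊕ ssum (range 0 (k ∸ 2)) (λ i → f k i p q u v s t ⊕ g k i p q u v s t))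
    × ((i : ℕ) → 1 ≤ i → i ≤ k ∸ 2 →
    f k i p q u v s t ≐
    scale (p · q · u · v) (sh (i + 1) (scale (X i p q u 𝟙 s t) (F₋ (k ∸ i) p q 𝟙 v 𝟙 t)))
    ⊕ scale (p · q · q · u · v) (sh (i + 1) (scale (X i p q u 𝟙 s 𝟙)
    (F₋ (k ∸ i) p q 𝟙 v 𝟙 𝟙 ⊛ F₋ k p q 𝟙 v s t)))
    ⊕ scale (p · q) (F₋ (k ∸ i) p q 𝟙 v 𝟙 𝟙 ⊛
    ssum (range 1 (i ∸ 1)) (λ j → scale (X j p q u 𝟙 𝟙 𝟙) (sh j (f k (i ∸ j) p q u v s t)))))
    × ((i : ℕ) → 1 ≤ i → i ≤ k ∸ 2 →
    g k i p q u v s t ≐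
    mono (i + 1) (p · u · v · t · X i p q u 𝟙 s t)
    ⊕ scale (p · q · u · v · X i p q u 𝟙 s 𝟙) (sh (i + 1) (F₋ k p q 𝟙 v s t))
    ⊕ scale (p · p · q · u · v) (sh (i + 1) (ssum (range 1 (i ∸ 1)) (λ j →
    scale (X j p q u 𝟙 𝟙 𝟙 · X (i ∸ j) p q u 𝟙 s t) (F₋ (k ∸ i + j) p q 𝟙 v 𝟙 t))))
    ⊕ scale (p · q) (ssum (range 1 (i ∸ 1)) (λ j →
    scale (X j p q u 𝟙 𝟙 𝟙) (sh j (F₋ (k ∸ i + j) p q 𝟙 v 𝟙 𝟙 ⊛
    (g k (i ∸ j) p q u v s t ⊖ mono (i ∸ j + 1) (p · u · v · t · X (i ∸ j) p q u 𝟙 s t)))))))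
    × (f k 0 p q u v s t ≐ mono 1 (u · v · s · t) ⊕ scale (q · u · v · s) (sh 1 (F₋ k p q 𝟙 v s t)))
    × (g k 0 p q u v s t ≐ zeroS)
    × (f 2 0 p q u v s t ⊛ (oneS ⊖ mono 1 (q · v · s)) ≐ mono 1 (u · v · s · t))
theorem3p1 𝓡 k 2≤k p q u v s t =
  F-decomposition 2≤k p q u v s t ,
  (λ i 1≤i i≤k∸2 → f-recurrence p q u v s t 1≤i (bound i≤k∸2)) ,
  (λ i 1≤i i≤k∸2 → g-recurrence p q u v s t 1≤i (bound i≤k∸2)) ,
  f₀≈ p q u v s t 2≤k ,
  g₀≈0 (2≤⇒1≤ 0 2≤k) p q u v s t ,
  f₂₀-closed p q u v s t
  where
  open Recursion 𝓡
  open Identities 𝓡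
  bound : ∀ {i} → i ≤ k ∸ 2 → 2 + i ≤ k
  bound i≤ = ≤-trans (+-monoʳ-≤ 2 i≤) (≤-reflexive (m+[n∸m]≡n 2≤k))
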